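{- Let $G$ be a finite group with $|G|\ge 3$. 1. $1\in\Delta^*(G)$ and $\{\operatorname{ord}(g)-2 : g\in G \text{ with } \operatorname{ord}(g)\ge 3\}\subset\Delta^*(G)$. 2. $\max\Delta^*(G)\le \mathsf D(G)-2$. 3. $\max\Delta^*(G)=|G|-2$ if and only if $G$ is cyclic or a dihedral group of order $2n$ for some odd $n\ge 3$. 4. If $G$ is a dihedral group of order $2n$ for some odd $n\ge 3$, then $\{1,2,n-2,2n-2\}\subset\Delta^*(G)$ and $\max\bigl(\Delta^*(G)\setminus\{2n-2\}\bigr)=\max\{2,n-2\}$. 5. If $\max\Delta^*(G)=\mathsf D(G)-2$, then $G$ is cyclic or there is a subgroup $G_1\subset G$ such that $\mathsf D(G_1)=\mathsf D(G)$ and $G_1$ is generated by elements of order two.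
   Context: Let $G$ be a finite group, written multiplicatively, with identity $1_G$, and $G_0\subset G$ a subset. A sequence over $G_0$ is an element of the free abelian monoid $\mathcal F(G_0)$ with basis $G_0$ (a finite unordered list, repetition allowed), the operation being concatenation; $|S|$ is the number of terms of $S$ counted with multiplicity. A sequence is product-one if its terms can be ordered so that their product in $G$ equals $1_G$ (the empty sequence is product-one). $\mathcal B(G_0)$ is the monoid of product-one sequences over $G_0$. An atom is a nonempty product-one sequence that is not the concatenation of two nonempty product-one sequences; $\mathcal A(G_0)$ is the set of atoms of $\mathcal B(G_0)$. $\mathsf D(G_0)=\max\{|S|: S\in\mathcal A(G_0)\}$. For $A\in\mathcal B(G_0)$, $\mathsf L(A)$ is the set of all $k\in\mathbb N_0$ such that $A$ is a concatenation of $k$ atoms. For $L\subset\mathbb Z$, $\Delta(L)$ is the set of all $d\in\mathbb N$ for which there is $a\in L$ with $L\cap\{a,a+1,\dots,a+d\}=\{a,a+d\}$. Put $\Delta(G_0)=\bigcup_{A\in\mathcal B(G_0)}\Delta(\mathsf L(A))$ and $$\Delta^*(G)=\{\min\Delta(G_0): G_0\subset G\ \text{such that}\ \Delta(G_0)\ne\emptyset\}.$$ -}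

module Defs where

open import Level using (Level; _⊔_; 0ℓ) renaming (suc to lsuc)
open import Algebra.Bundles using (Group)
open import Algebra.Structures using (IsGroup)
import Algebra.Definitions.RawMonoid as RawMonoidPower
open import Data.Fin.Base using (Fin)
open import Data.List.Base using (List; []; _++_; concat; foldr; length)
open import Data.List.Relation.Binary.Permutation.Propositional using (_↭_)
open import Data.List.Relation.Unary.All using (All)
open import Data.Nat.Base using (ℕ; _*_; _+_; _≤_; _<_)
open import Data.Product.Base using (_×_; ∃-syntax)
open import Function.Bundles using (_↔_)
open import Relation.Binary.PropositionalEquality using (_≡_; _≢_)
open import Relation.Nullary.Negation.Core using (¬_)
open import Relation.Unary using (Pred; Decidable; _∈_; _⊆_; _≐_; _∩_; _∪_; ｛_｝; U)

private
  variable
    ℓ : Level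

IsMin : Pred ℕ ℓ → ℕ → Set ℓ
IsMin X m = m ∈ X × (∀ x → x ∈ X → m ≤ x)

IsMax : Pred ℕ ℓ → ℕ → Set ℓ
IsMax X m = m ∈ X × (∀ x → x ∈ X → x ≤ m)

-- The positive distances of a set of natural numbers; d = 0 has to be excluded
-- by hand, since a alone satisfies the interval condition for d = 0.
Distances : Pred ℕ ℓ → Pred ℕ ℓ
Distances L d =
  0 < d × ∃[ a ] (a ∈ L × (L ∩ (λ x → a ≤ x × x ≤ a + d)) ≐ (｛ a ｝ ∪ ｛ a + d ｝))

-- Equality of group elements is propositional equality, and the bijection with
-- Fin ∣G∣ makes it decidable.
record FiniteGroup (a : Level) : Set (lsuc a) where
  infixl 7 _∙_
  infix 8 _⁻¹
  field
    Carrier     : Set a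
    _∙_         : Carrier → Carrier → Carrier
    ε           : Carrier
    _⁻¹         : Carrier → Carrier
    isGroup     : IsGroup _≡_ _∙_ ε _⁻¹
    ∣G∣         : ℕ
    enumeration : Fin ∣G∣ ↔ Carrier

  group : Group a a
  group = record { isGroup = isGroup }

module GroupNotions {a} (G : FiniteGroup a) where
  open FiniteGroup G

  infixr 9 _^_
  _^_ : Carrier → ℕ → Carrier
  g ^ k = RawMonoidPower._×_ (Group.rawMonoid group) k g

  IsOrder : Carrier → ℕ → Set a
  IsOrder g = IsMin (λ k → 0 < k × g ^ k ≡ ε)

  data ⟨_⟩ (X : Pred Carrier ℓ) : Pred Carrier (a ⊔ ℓ) where
    generator : ∀ {g} → g ∈ X → g ∈ ⟨ X ⟩
    identity  : ε ∈ ⟨ X ⟩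
    product   : ∀ {g h} → g ∈ ⟨ X ⟩ → h ∈ ⟨ X ⟩ → g ∙ h ∈ ⟨ X ⟩
    inverse   : ∀ {g} → g ∈ ⟨ X ⟩ → g ⁻¹ ∈ ⟨ X ⟩

  IsSubgroup : Pred Carrier ℓ → Set (a ⊔ ℓ)
  IsSubgroup H =
    ε ∈ H × (∀ {g h} → g ∈ H → h ∈ H → g ∙ h ∈ H) × (∀ {g} → g ∈ H → g ⁻¹ ∈ H)

  IsCyclic : Set a
  IsCyclic = ∃[ g ] U ⊆ ⟨ ｛ g ｝ ⟩

  -- G is generated by σ, τ subject to the relations σⁿ = τ² = 1, τσ = σ⁻¹τ of
  -- the dihedral group of order 2n, hence a quotient of it; as G has order 2n,
  -- these relations present G.
  IsDihedral : ℕ → Set a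
  IsDihedral n =
    ∣G∣ ≡ 2 * n ×
    ∃[ σ ] ∃[ τ ] (U ⊆ ⟨ ｛ σ ｝ ∪ ｛ τ ｝ ⟩ ×
                   σ ^ n ≡ ε × τ ^ 2 ≡ ε × τ ∙ σ ≡ σ ⁻¹ ∙ τ)

  GeneratedByInvolutions : Pred Carrier ℓ → Set (lsuc 0ℓ ⊔ a ⊔ ℓ)
  GeneratedByInvolutions H =
    ∃[ X ] ((∀ g → g ∈ X → IsOrder g 2) × H ≐ ⟨_⟩ {ℓ = 0ℓ} X)

-- An element of the free abelian monoid is represented by a list of its terms;
-- lists related by _↭_ represent the same sequence, and concatenation is _++_.
module ProductOneSequences {a} (G : FiniteGroup a) where
  open FiniteGroup G

  Sequence : Set a
  Sequence = List Carrier

  ProductOne : Pred Sequence a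
  ProductOne S = ∃[ T ] (S ↭ T × foldr _∙_ ε T ≡ ε)

  𝓑 : Pred Carrier ℓ → Pred Sequence (a ⊔ ℓ)
  𝓑 G₀ S = All G₀ S × ProductOne S

  𝓐 : Pred Carrier ℓ → Pred Sequence (a ⊔ ℓ)
  𝓐 G₀ A =
    A ∈ 𝓑 G₀ × A ≢ [] ×
    ¬ (∃[ S ] ∃[ T ] (S ∈ 𝓑 G₀ × S ≢ [] × T ∈ 𝓑 G₀ × T ≢ [] × A ↭ S ++ T))

  IsDavenport : Pred Carrier ℓ → ℕ → Set (a ⊔ ℓ)
  IsDavenport G₀ = IsMax (λ k → ∃[ S ] (S ∈ 𝓐 G₀ × length S ≡ k))

  𝖫 : Pred Carrier ℓ → Sequence → Pred ℕ (a ⊔ ℓ)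
  𝖫 G₀ A k = ∃[ Us ] (length Us ≡ k × All (𝓐 G₀) Us × A ↭ concat Us)

  Δ : Pred Carrier ℓ → Pred ℕ (a ⊔ ℓ)
  Δ G₀ d = ∃[ A ] (A ∈ 𝓑 G₀ × d ∈ Distances (𝖫 G₀ A))

  -- Subsets of the finite set Carrier are the decidable predicates.  IsMin
  -- includes that Δ G₀ is nonempty.
  Δ* : Pred ℕ (lsuc 0ℓ ⊔ a)
  Δ* d = ∃[ G₀ ] (Decidable G₀ × IsMin (Δ {ℓ = 0ℓ} G₀) d)

{-# OPTIONS --safe #-}

-- Let d = min Δ(G₀); it divides all differences of lengths of factorizations over
-- G₀.  Let k(S) = Σ 1/ord(g) be the cross number.  If some atom S has k(S) < 1, then
-- trading the atoms g T₁, …, g Tₙ with n = ord(g) for gⁿ and the atoms of T₁ ⋯ Tₙ in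
-- a high power of S must at some point decrease their number, so that d ≤ ord(g) - 2
-- for some g.  Otherwise some atom S = g₁ ⋯ gₘ has k(S) > 1, and the complement of S
-- in Π gᵢ^{ord(gᵢ)}, which has product one, is a product of l ≤ m - 2 atoms; hence
-- d ≤ m - 1 - l ≤ D(G) - 2.  Equality forces ord(g) = D(G), and then G is cyclic, or
-- it forces the complement to be an atom, and then all gᵢ are involutions.  If in
-- addition m = ∣G∣, then the partial products of S exhaust G, and short relations
-- are products of squares, so that S = (x y)ⁿ with n odd and G is dihedral.
--
-- Conversely, d divides all differences if there is a weight on G₀ for which all
-- atoms have the same nonzero weight c modulo c d.
module Submission where

open import Defs
open import Level using (Level; 0ℓ)
open import Algebra.Bundles using (Group)
import Algebra.Properties.Group as GroupProperties
import Algebra.Properties.Monoid.Mult as MonoidPowers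
open import Data.Bool.Base using (Bool; true; false; if_then_else_)
open import Data.Bool.Properties using (T?)
open import Data.Empty using (⊥; ⊥-elim)
open import Data.Fin.Base using (Fin; zero; suc; toℕ; fromℕ<)
import Data.Fin.Base as Fin
import Data.Fin.Properties as Fin
open import Data.List.Base using (List; []; _∷_; [_]; _++_; _∷ʳ_; concat; foldr; length; map; replicate; take; drop; tabulate; InitLast; _∷ʳ′_; initLast)
open import Data.List.Properties using (++-assoc; ++-identityʳ; length-++; length-replicate; length-map; concat-++; ++-conicalˡ; ++-conicalʳ; take++drop≡id; length-take; length-drop; length-tabulate; ∷ʳ-injective; map-++)
open import Data.List.Membership.Propositional using () renaming (_∈_ to _∈ˡ_; _∉_ to _∉ˡ_)
open import Data.List.Membership.Propositional.Properties using (∈-∃++; ∈-++⁺ʳ; ∈-concat⁻′; ∈-tabulate⁺)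
open import Data.List.Relation.Binary.Permutation.Propositional using (_↭_; ↭-refl; ↭-sym; ↭-trans; ↭-reflexive; prep; module PermutationReasoning)
import Data.List.Relation.Binary.Permutation.Propositional.Properties as ↭
open import Data.List.Relation.Unary.All using (All; []; _∷_)
import Data.List.Relation.Unary.All as All
import Data.List.Relation.Unary.All.Properties as All
open import Data.List.Relation.Unary.Any using (Any; here; there)
import Data.List.Relation.Unary.Any as Any
open import Data.Nat.Base using (ℕ; zero; suc; _+_; _*_; _∸_; _≤_; _<_; _⊔_; z≤n; s≤s; _!; NonZero; >-nonZero)
import Data.Nat.Base as ℕ
open import Data.Nat.DivMod using (_/_; _%_; m≡m%n+[m/n]*n; m%n<n)
open import Data.Nat.Divisibility using (_∣_; divides; ∣-trans; ∣-refl; ∣⇒≤; m∣m*n; n∣m*n; ∣m+n∣m⇒∣n; m≤n⇒m!∣n!; ∣m∣n⇒∣m+n; _∣?_)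
open import Data.Nat.Induction using (<-wellFounded)
open import Data.Nat.ListAction using (sum)
open import Data.Nat.ListAction.Properties using (sum-↭; sum-++)
open import Data.Nat.Primality using (euclidsLemma; prime[2])
open import Data.Nat.Properties hiding (_≟_)
import Data.Nat.Properties as ℕ
open import Data.Nat.Tactic.RingSolver using (solve-∀)
open import Data.Product.Base using (_×_; _,_; proj₁; proj₂; ∃; ∃₂; ∃-syntax)
open import Data.Sum.Base using (_⊎_; inj₁; inj₂)
import Data.Sum.Base as Sum
open import Data.Unit.Base using (tt)
open import Function.Base using (_∘_; case_of_)
open import Function.Bundles using (_⇔_; mk⇔; module Inverse)
open import Function.Properties.Inverse using (↔⇒↣; ↔-sym)
import Data.List.Membership.Propositional as Membership
open import Induction.WellFounded using (Acc; acc)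
open import Relation.Binary.Definitions using (DecidableEquality; tri<; tri≈; tri>)
open import Relation.Binary.PropositionalEquality using (_≡_; _≢_; refl; sym; trans; cong; cong₂; subst; subst₂; module ≡-Reasoning)
open import Relation.Nullary.Decidable using (Dec; yes; no; does; map′; _×-dec_; _⊎-dec_; ¬?; True; toWitness; fromWitness; via-injection)
open import Relation.Nullary.Negation.Core using (¬_; contradiction)
open import Relation.Unary using (Pred; Decidable; _∈_; _⊆_; _∪_; _∖_; ｛_｝; U)

-- The obstacle is noncommutativity: an atom has product 1 only in suitable orders, and a
-- product-one sequence need not remain one when a product-one part is removed. Atoms are therefore
-- kept in an order with product 1, and contiguous blocks are cut out of such words. An exchange
-- takes atoms with a common first term g, because then every tail Tᵢ has product exactly g⁻¹, and n
-- = ord(g) tails in a row have product 1. Among more than ∣G∣² ordered atoms some g is the first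
-- term of ord(g) of them. Setting gⁿ aside lowers the cross number by 1 and, unless d ≤ ord(g) - 2,
-- the number of remaining atoms by at most 1. So the number of atoms exceeds the cross number by at
-- most ∣G∣², and a sufficiently high power of an atom S with k(S) < 1 violates this fixed bound.
-- The weights solve congruences: over the two-element sets in question every atom is one of few
-- types, since small product-one parts can be split off from anything else.

private
  variable
    ℓ : Level

-- Search in ℕ, permutations and weights of lists

least : ∀ {p} {P : Pred ℕ p} → Decidable P → ∃ P → ∃ (IsMin P)
least {P = P} P? (n , Pn) = go 0 n (λ _ ()) (n , +-identityʳ n , Pn)
  where
  -- `k + fuel` always equals the known witness, so the fuel runs out only at the witness itself.
  go : ∀ k fuel → (∀ x → x < k → ¬ P x) → (∃[ n ] n + 0 ≡ k + fuel × P n) → ∃ (IsMin P)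
  go k fuel none hit with P? k
  ... | yes Pk = k , Pk , λ x Px → ≮⇒≥ λ x<k → none x x<k Px
  go k zero none (n , eq , Pn) | no ¬Pk =
    contradiction (subst P (trans (sym (+-identityʳ n)) (trans eq (+-identityʳ k))) Pn) ¬Pk
  go k (suc fuel) none (n , eq , Pn) | no ¬Pk =
    go (suc k) fuel
      (λ x x<1+k Px → case m≤n⇒m<n∨m≡n (ℕ.s≤s⁻¹ x<1+k) of λ where
        (inj₁ x<k)  → none x x<k Px
        (inj₂ refl) → ¬Pk Px)
      (n , trans eq (+-suc k fuel) , Pn)

greatest : ∀ {p} {P : Pred ℕ p} → Decidable P → ∃ P → ∀ N → (∀ x → P x → x ≤ N) → ∃ (IsMax P)
greatest {P = P} P? w zero bound with w
... | n , Pn = n , Pn , λ x Px → ≤-trans (bound x Px) z≤n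
greatest {P = P} P? w (suc N) bound with P? (suc N)
... | yes PN = suc N , PN , bound
... | no ¬PN = greatest P? w N λ x Px → ℕ.s≤s⁻¹ (≤∧≢⇒< (bound x Px) λ { refl → ¬PN Px })

module _ {a} {A : Set a} (_≟_ : DecidableEquality A) where

  private
    _∈?_ : (x : A) (xs : List A) → Dec (x ∈ˡ xs)
    x ∈? xs = Any.any? (x ≟_) xs

  ↭-dec : (xs ys : List A) → Dec (xs ↭ ys)
  ↭-dec [] [] = yes ↭-refl
  ↭-dec [] (y ∷ ys) = no λ p → ↭.¬x∷xs↭[] (↭-sym p)
  ↭-dec (x ∷ xs) ys with x ∈? ys
  ... | no x∉ys = no λ p → x∉ys (↭.∈-resp-↭ p (here refl))
  ... | yes x∈ys with ∈-∃++ x∈ys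
  ... | as , bs , refl =
    map′ (λ p → ↭-trans (prep x p) (↭-sym (↭.shift x as bs)))
         (λ p → ↭.drop-∷ (↭-trans p (↭.shift x as bs)))
         (↭-dec xs (as ++ bs))

  abstract
    -- Pigeonhole principle with multiplicities, by induction on `vs`: either the first value is hit
    -- more than `M` times, or dropping its at most `M` hits leaves too many entries for the other
    -- values.
    crowded : ∀ {b} {B : Set b} (f : B → A) (vs : List A) (xs : List B) →
              All (λ x → f x ∈ˡ vs) xs → ∀ M → length vs * M < length xs →
              ∃[ v ] ∃[ hits ] ∃[ rest ]
                (All (λ x → f x ≡ v) hits × M < length hits × xs ↭ hits ++ rest)
    crowded f [] [] _ M ()
    crowded f [] (x ∷ xs) (() ∷ _) M lt
    crowded {B = B} f (v ∷ vs) xs covered M lt = decide (partition xs covered)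
      where
      partition : ∀ ys → All (λ x → f x ∈ˡ (v ∷ vs)) ys →
                  ∃[ hits ] ∃[ rest ] (All (λ x → f x ≡ v) hits ×
                    All (λ x → f x ∈ˡ vs) rest × ys ↭ hits ++ rest)
      partition [] [] = [] , [] , [] , [] , ↭-refl
      partition (y ∷ ys) (p ∷ ps) with partition ys ps | f y ≟ v | p
      ... | hits , rest , H , R , eq | yes e | _ = y ∷ hits , rest , e ∷ H , R , prep y eq
      ... | _ | no ¬e | here e = contradiction e ¬e
      ... | hits , rest , H , R , eq | no ¬e | there q =
        hits , y ∷ rest , H , q ∷ R , ↭-trans (prep y eq) (↭-sym (↭.shift y hits rest))

      decide : (∃[ hits ] ∃[ rest ] (All (λ x → f x ≡ v) hits ×
                 All (λ x → f x ∈ˡ vs) rest × xs ↭ hits ++ rest)) →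
               ∃[ w ] ∃[ hits ] ∃[ rest ]
                 (All (λ x → f x ≡ w) hits × M < length hits × xs ↭ hits ++ rest)
      decide (hits , rest , H , R , eq) with M ℕ.<? length hits
      ... | yes big = v , hits , rest , H , big , eq
      ... | no ¬big =
        let w , hits′ , rest′ , H′ , big′ , eq′ = crowded f vs rest R M small
        in w , hits′ , hits ++ rest′ , H′ , big′ ,
           ↭-trans eq (↭-trans (↭.++⁺ˡ hits eq′) (↭.shifts hits hits′))
        where
        small : length vs * M < length rest
        small = +-cancelˡ-< M _ _ (≤-trans lt
          (≤-trans (≤-reflexive (trans (↭.↭-length eq) (length-++ hits)))
                   (+-monoˡ-≤ (length rest) (≮⇒≥ ¬big))))

concat-↭ : ∀ {a} {A : Set a} {xss yss : List (List A)} → xss ↭ yss → concat xss ↭ concat yss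
concat-↭ _↭_.refl = ↭-refl
concat-↭ (prep xs p) = ↭.++⁺ˡ xs (concat-↭ p)
concat-↭ (_↭_.swap xs ys p) = ↭-trans (↭.shifts xs ys) (↭.++⁺ˡ ys (↭.++⁺ˡ xs (concat-↭ p)))
concat-↭ (_↭_.trans p q) = ↭-trans (concat-↭ p) (concat-↭ q)

-- Additive functions on sequences. They serve as cross number, as multiplicity of a term, as the
-- number of terms outside a cyclic subgroup, and as the weights that prove divisibility of
-- distances.
module Weight {a} {A : Set a} (w : A → ℕ) where

  weight : List A → ℕ
  weight S = sum (map w S)

  weight-++ : ∀ S T → weight (S ++ T) ≡ weight S + weight T
  weight-++ S T = trans (cong sum (map-++ w S T)) (sum-++ (map w S) (map w T))

  weight-↭ : ∀ {S T} → S ↭ T → weight S ≡ weight T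
  weight-↭ p = sum-↭ (↭.map⁺ w p)

  weight-replicate : ∀ n x → weight (replicate n x) ≡ n * w x
  weight-replicate zero    x = refl
  weight-replicate (suc n) x = cong (w x +_) (weight-replicate n x)

  weight-concat-replicate : ∀ n S → weight (concat (replicate n S)) ≡ n * weight S
  weight-concat-replicate zero    S = refl
  weight-concat-replicate (suc n) S =
    trans (weight-++ S _) (cong (weight S +_) (weight-concat-replicate n S))

  light : ∀ c Us → weight (concat Us) < length Us * c → Any (λ V → weight V < c) Us
  light c (V ∷ Us) lt with weight V ℕ.<? c
  ... | yes V<c = here V<c
  ... | no  V≮c = there (light c Us (+-cancelˡ-< c _ _
        (≤-<-trans (+-monoˡ-≤ _ (≮⇒≥ V≮c)) (subst (_< _) (weight-++ V (concat Us)) lt))))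

  heavy : ∀ c Us → length Us * c < weight (concat Us) → Any (λ V → c < weight V) Us
  heavy c (V ∷ Us) lt with c ℕ.<? weight V
  ... | yes c<V = here c<V
  ... | no  c≮V = there (heavy c Us (+-cancelˡ-< c _ _
        (<-≤-trans (subst (_ <_) (weight-++ V (concat Us)) lt) (+-monoˡ-≤ _ (≮⇒≥ c≮V)))))

parity : ∀ n → 2 ∣ n ⊎ (∃[ k ] n ≡ 1 + k * 2)
parity zero = inj₁ (divides 0 refl)
parity (suc n) with parity n
... | inj₁ (divides k refl) = inj₂ (k , refl)
... | inj₂ (k , refl)       = inj₁ (divides (suc k) refl)

odd-∤ : ∀ k → ¬ (2 ∣ 1 + k * 2)
odd-∤ k 2∣ with ∣m+n∣m⇒∣n {2} {k * 2} (subst (2 ∣_) (+-comm 1 (k * 2)) 2∣) (n∣m*n k)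
... | divides zero ()
... | divides (suc _) ()

-- Finite groups: orders, powers, products and exhaustive search

module Arithmetic {a} (G : FiniteGroup a) where

  open FiniteGroup G
  open GroupNotions G
  open ProductOneSequences G
  open Group group using (assoc; identityˡ; identityʳ; inverseˡ; inverseʳ; monoid)
  open GroupProperties group using (inverseʳ-unique; inverseˡ-unique; ⁻¹-involutive; ⁻¹-anti-homo-∙; ε⁻¹≈ε; ∙-cancelˡ; ∙-cancelʳ)

  element : Fin ∣G∣ → Carrier
  element = Inverse.to enumeration

  index : Carrier → Fin ∣G∣
  index = Inverse.from enumeration

  element-index : ∀ g → element (index g) ≡ g
  element-index = Inverse.strictlyInverseˡ enumeration

  infix 4 _≟_
  abstract
    _≟_ : DecidableEquality Carrier
    _≟_ = via-injection (↔⇒↣ (↔-sym enumeration)) Fin._≟_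

  ∃? : ∀ {p} {P : Pred Carrier p} → Decidable P → Dec (∃ P)
  ∃? {P = P} P? = map′ (λ (i , p) → element i , p)
                       (λ (g , p) → index g , subst P (sym (element-index g)) p)
                       (Fin.any? (P? ∘ element))

  ∀? : ∀ {p} {P : Pred Carrier p} → Decidable P → (∀ g → P g) ⊎ (∃[ g ] ¬ P g)
  ∀? P? with ∃? (¬? ∘ P?)
  ... | yes counterexample = inj₂ counterexample
  ... | no none = inj₁ λ g → case P? g of λ where
    (yes p) → p
    (no ¬p) → contradiction (g , ¬p) none

  collision : ∀ {m} (f : Fin m → Carrier) → ∣G∣ < m → ∃[ i ] ∃[ j ] (i Fin.< j × f i ≡ f j)
  collision f lt with i , j , i<j , eq ← Fin.pigeonhole lt (index ∘ f) =
    i , j , i<j ,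
    trans (sym (element-index (f i))) (trans (cong element eq) (element-index (f j)))

  ∣G∣≤-image : ∀ {N} (f : Fin N → Carrier) → (∀ g → ∃[ i ] f i ≡ g) → ∣G∣ ≤ N
  ∣G∣≤-image f onto = Fin.injective⇒≤ {f = λ i → proj₁ (onto (element i))} λ {i} {j} eq →
    trans (sym (Inverse.strictlyInverseʳ enumeration i))
      (trans (cong index (trans (sym (proj₂ (onto (element i))))
                                (trans (cong f eq) (proj₂ (onto (element j))))))
             (Inverse.strictlyInverseʳ enumeration j))

  ^-+ : ∀ g m n → g ^ (m + n) ≡ g ^ m ∙ g ^ n
  ^-+ g m n = MonoidPowers.×-homo-+ monoid g m n

  ^-* : ∀ g m n → (g ^ n) ^ m ≡ g ^ (m * n)
  ^-* g m n = MonoidPowers.×-assocˡ monoid g m n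

  ^-suc : ∀ g n → g ^ suc n ≡ g ^ n ∙ g
  ^-suc g n = trans (cong (g ^_) (+-comm 1 n)) (trans (^-+ g n 1) (cong (g ^ n ∙_) (identityʳ g)))

  ε^ : ∀ n → ε ^ n ≡ ε
  ε^ zero    = refl
  ε^ (suc n) = trans (identityˡ _) (ε^ n)

  ⁻¹-^ : ∀ g n → (g ⁻¹) ^ n ≡ (g ^ n) ⁻¹
  ⁻¹-^ g zero    = sym ε⁻¹≈ε
  ⁻¹-^ g (suc n) = trans (cong (g ⁻¹ ∙_) (⁻¹-^ g n))
    (trans (sym (⁻¹-anti-homo-∙ (g ^ n) g)) (cong _⁻¹ (sym (^-suc g n))))

  commute-^ : ∀ {g h} → g ∙ h ≡ h ∙ g → ∀ i → g ∙ h ^ i ≡ h ^ i ∙ g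
  commute-^ eq zero = trans (identityʳ _) (sym (identityˡ _))
  commute-^ {g} {h} eq (suc i) = begin
    g ∙ (h ∙ h ^ i)   ≡⟨ assoc _ _ _ ⟨
    g ∙ h ∙ h ^ i     ≡⟨ cong (_∙ h ^ i) eq ⟩
    h ∙ g ∙ h ^ i     ≡⟨ assoc _ _ _ ⟩
    h ∙ (g ∙ h ^ i)   ≡⟨ cong (h ∙_) (commute-^ eq i) ⟩
    h ∙ (h ^ i ∙ g)   ≡⟨ assoc _ _ _ ⟨
    h ∙ h ^ i ∙ g     ∎
    where open ≡-Reasoning

  abstract
    order : ∀ g → ∃[ k ] IsOrder g k
    order g = least (λ k → (0 ℕ.<? k) ×-dec (g ^ k ≟ ε)) witness
      where
      witness : ∃[ k ] (0 < k × g ^ k ≡ ε)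
      witness with i , j , i<j , eq ← collision {suc ∣G∣} (λ i → g ^ toℕ i) ≤-refl =
        toℕ j ∸ toℕ i , m<n⇒0<n∸m i<j ,
        ∙-cancelˡ (g ^ toℕ i) _ _ (trans (sym (^-+ g (toℕ i) _))
          (trans (cong (g ^_) (m+[n∸m]≡n (<⇒≤ i<j))) (trans (sym eq) (sym (identityʳ _)))))

  ord : Carrier → ℕ
  ord g = proj₁ (order g)

  order≢0 : ∀ {g k} → IsOrder g k → NonZero k
  order≢0 ((0<k , _) , _) = >-nonZero 0<k

  order-∣ : ∀ {g k} → IsOrder g k → ∀ m → g ^ m ≡ ε → k ∣ m
  order-∣ {g} {k} o@((0<k , gᵏ≡ε) , k-min) m gᵐ≡ε = divides (m / k) (trans m≡ (cong (_+ m / k * k) r≡0))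
    where
    instance _ = order≢0 o
    m≡ = m≡m%n+[m/n]*n m k
    gʳ≡ε : g ^ (m % k) ≡ ε
    gʳ≡ε = begin
      g ^ (m % k)                        ≡⟨ identityʳ _ ⟨
      g ^ (m % k) ∙ ε                    ≡⟨ cong (g ^ (m % k) ∙_) (ε^ (m / k)) ⟨
      g ^ (m % k) ∙ ε ^ (m / k)          ≡⟨ cong (λ x → g ^ (m % k) ∙ x ^ (m / k)) gᵏ≡ε ⟨
      g ^ (m % k) ∙ (g ^ k) ^ (m / k)    ≡⟨ cong (g ^ (m % k) ∙_) (^-* g (m / k) k) ⟩
      g ^ (m % k) ∙ g ^ (m / k * k)      ≡⟨ ^-+ g (m % k) _ ⟨
      g ^ (m % k + m / k * k)            ≡⟨ cong (g ^_) m≡ ⟨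
      g ^ m                              ≡⟨ gᵐ≡ε ⟩
      ε                                  ∎
      where open ≡-Reasoning
    r≡0 : m % k ≡ 0
    r≡0 with m % k in eq
    ... | zero  = refl
    ... | suc r = contradiction (subst (_≤ _) refl (k-min (suc r) (s≤s z≤n , subst (λ x → g ^ x ≡ ε) eq gʳ≡ε)))
                    (<⇒≱ (subst (_< k) eq (m%n<n m k)))

  ord-∣ : ∀ g m → g ^ m ≡ ε → ord g ∣ m
  ord-∣ g = order-∣ (proj₂ (order g))

  g^ord≡ε : ∀ g → g ^ ord g ≡ ε
  g^ord≡ε g = proj₂ (proj₁ (proj₂ (order g)))

  0<ord : ∀ g → 0 < ord g
  0<ord g = proj₁ (proj₁ (proj₂ (order g)))

  ord≤∣G∣ : ∀ g → ord g ≤ ∣G∣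
  ord≤∣G∣ g = ≮⇒≥ λ ∣G∣<k →
    let k = ord g
        i , j , i<j , eq = collision {k} (λ i → g ^ toℕ i) ∣G∣<k
        gʲ⁻ⁱ≡ε = ∙-cancelˡ (g ^ toℕ i) _ _ (trans (sym (^-+ g (toℕ i) _))
          (trans (cong (g ^_) (m+[n∸m]≡n (<⇒≤ i<j))) (trans (sym eq) (sym (identityʳ _)))))
    in <⇒≱ (≤-<-trans (m∸n≤m (toℕ j) (toℕ i)) (Fin.toℕ<n j))
           (proj₂ (proj₂ (order g)) _ (m<n⇒0<n∸m i<j , gʲ⁻ⁱ≡ε))

  ord≡1⇒≡ε : ∀ g → ord g ≤ 1 → g ≡ ε
  ord≡1⇒≡ε g k≤1 = trans (sym (identityʳ g))
    (subst (λ k → g ^ k ≡ ε) (≤-antisym k≤1 (0<ord g)) (g^ord≡ε g))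

  prod : Sequence → Carrier
  prod = foldr _∙_ ε

  prod-++ : ∀ S T → prod (S ++ T) ≡ prod S ∙ prod T
  prod-++ []      T = sym (identityˡ _)
  prod-++ (g ∷ S) T = trans (cong (g ∙_) (prod-++ S T)) (sym (assoc g _ _))

  prod-replicate : ∀ n g → prod (replicate n g) ≡ g ^ n
  prod-replicate zero    g = refl
  prod-replicate (suc n) g = cong (g ∙_) (prod-replicate n g)

  prod-concat-replicate : ∀ n S → prod (concat (replicate n S)) ≡ prod S ^ n
  prod-concat-replicate zero    S = refl
  prod-concat-replicate (suc n) S = trans (prod-++ S _) (cong (prod S ∙_) (prod-concat-replicate n S))

  infix 4 _↭?_
  _↭?_ : (S T : Sequence) → Dec (S ↭ T)
  _↭?_ = ↭-dec _≟_

  -- Exhaustive search over a finite alphabet. It decides whether a sequence is product-one and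
  -- whether it splits, so that a sequence which is not an atom can actually be taken apart.
  ∃List? : ∀ {p} {P : Pred Sequence p} → Decidable P → ∀ k → Dec (∃[ S ] (length S ≡ k × P S))
  ∃List? P? zero = map′ (λ p → [] , refl , p) (λ { ([] , _ , p) → p }) (P? [])
  ∃List? P? (suc k) =
    map′ (λ (g , S , eq , p) → g ∷ S , cong suc eq , p)
         (λ { (g ∷ S , eq , p) → g , S , suc-injective eq , p })
         (∃? λ g → ∃List? (P? ∘ (g ∷_)) k)

  ∃List≤? : ∀ {p} {P : Pred Sequence p} → Decidable P → ∀ N → Dec (∃[ S ] (length S ≤ N × P S))
  ∃List≤? P? N =
    map′ (λ { (k , k<1+N , S , refl , p) → S , ℕ.s≤s⁻¹ k<1+N , p })
         (λ (S , S≤N , p) → length S , s≤s S≤N , S , refl , p)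
         (anyUpTo? (∃List? P?) (suc N))

  ≢[]? : (S : Sequence) → Dec (S ≢ [])
  ≢[]? []      = no λ ¬e → ¬e refl
  ≢[]? (_ ∷ _) = yes λ ()

  productOne : ∀ {S} → prod S ≡ ε → ProductOne S
  productOne {S} eq = S , ↭-refl , eq

  productOne-↭ : ∀ {S T} → S ↭ T → ProductOne S → ProductOne T
  productOne-↭ p (R , q , eq) = R , ↭-trans (↭-sym p) q , eq

  productOne-++ : ∀ {S T} → ProductOne S → ProductOne T → ProductOne (S ++ T)
  productOne-++ (S′ , p , e) (T′ , q , f) =
    S′ ++ T′ , ↭.++⁺ p q , trans (prod-++ S′ T′) (trans (cong₂ _∙_ e f) (identityˡ ε))

  productOne? : Decidable ProductOne
  productOne? S =
    map′ (λ (T , _ , p , eq) → T , p , eq)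
         (λ (T , p , eq) → T , sym (↭.↭-length p) , p , eq)
         (∃List? (λ T → (S ↭? T) ×-dec (prod T ≟ ε)) (length S))

  -- Atoms and factorizations

  Splits : Pred Sequence a
  Splits A = ∃[ S ] ∃[ T ] (ProductOne S × S ≢ [] × ProductOne T × T ≢ [] × A ↭ S ++ T)

  -- Free of `G₀`: the parts of a sequence over `G₀` are again over `G₀`, so the atoms over `G₀` are
  -- the atoms of `G` whose terms lie in `G₀`.
  Atom : Pred Sequence a
  Atom A = ProductOne A × A ≢ [] × ¬ Splits A

  -- An atom listed in an order that multiplies to `ε`; first terms, tails and prefix products refer
  -- to this order.
  OrderedAtom : Pred Sequence a
  OrderedAtom A = Atom A × prod A ≡ ε

  splits? : Decidable Splits
  splits? A = map′ to from
    (∃List≤? (λ S → productOne? S ×-dec (≢[]? S) ×-dec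
       ∃List≤? (λ T → productOne? T ×-dec ≢[]? T ×-dec (A ↭? S ++ T)) (length A)) (length A))
    where
    to : _ → Splits A
    to (S , _ , pS , neS , T , _ , pT , neT , p) = S , T , pS , neS , pT , neT , p
    from : Splits A → _
    from (S , T , pS , neS , pT , neT , p) =
      S , ≤-trans (m≤m+n _ _) lengths , pS , neS , T , ≤-trans (m≤n+m _ (length S)) lengths , pT , neT , p
      where
      lengths : length S + length T ≤ length A
      lengths = ≤-reflexive (trans (sym (length-++ S)) (sym (↭.↭-length p)))

  atom? : Decidable Atom
  atom? A = productOne? A ×-dec ≢[]? A ×-dec ¬? (splits? A)

  splits-↭ : ∀ {A B} → A ↭ B → Splits A → Splits B
  splits-↭ p (S , T , pS , neS , pT , neT , q) = S , T , pS , neS , pT , neT , ↭-trans (↭-sym p) q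

  atom-↭ : ∀ {A B} → A ↭ B → Atom A → Atom B
  atom-↭ p (one , ne , ¬s) =
    productOne-↭ p one , (λ { refl → ne (↭.↭-empty-inv p) }) , ¬s ∘ splits-↭ (↭-sym p)

  orderedAtom : ∀ {A} → Atom A → ∃[ B ] (A ↭ B × OrderedAtom B)
  orderedAtom at@((B , p , eq) , _) = B , p , atom-↭ p at , eq

  𝓐⇒atom : ∀ {G₀ : Pred Carrier ℓ} {A} → 𝓐 G₀ A → All G₀ A × Atom A
  𝓐⇒atom {G₀ = G₀} ((over , one) , ne , irr) = over , one , ne ,
    λ (S , T , pS , neS , pT , neT , p) →
      let overST = ↭.All-resp-↭ p over
      in irr (S , T , (All.++⁻ˡ S overST , pS) , neS , (All.++⁻ʳ S overST , pT) , neT , p)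

  atom⇒𝓐 : ∀ {G₀ : Pred Carrier ℓ} {A} → All G₀ A → Atom A → 𝓐 G₀ A
  atom⇒𝓐 over (one , ne , irr) = (over , one) , ne ,
    λ (S , T , (_ , pS) , neS , (_ , pT) , neT , p) → irr (S , T , pS , neS , pT , neT , p)

  Factorization : Sequence → ℕ → Set a
  Factorization A k = ∃[ Us ] (length Us ≡ k × All OrderedAtom Us × A ↭ concat Us)

  abstract
    factorization : ∀ S → ProductOne S → ∃ (Factorization S)
    factorization S = go S (<-wellFounded (length S))
      where
      shorter : ∀ {A S T : Sequence} → A ↭ S ++ T → S ≢ [] → length T < length A
      shorter {S = []} p ne = contradiction refl ne
      shorter {S = g ∷ S} {T} p ne =
        subst (length T <_) (sym (trans (↭.↭-length p) (length-++ (g ∷ S)))) (s≤s (m≤n+m _ (length S)))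
      go : ∀ S → Acc _<_ (length S) → ProductOne S → ∃ (Factorization S)
      go [] _ _ = 0 , [] , refl , [] , ↭-refl
      go S@(_ ∷ _) (acc rec) one with splits? S
      ... | no ¬s with T , p , at ← orderedAtom (one , (λ ()) , ¬s) =
        1 , [ T ] , refl , at ∷ [] , ↭-trans p (↭-reflexive (sym (++-identityʳ T)))
      ... | yes (A , B , pA , neA , pB , neB , p)
        with k , Us , _ , atU , q ← go A (rec (shorter (↭-trans p (↭.++-comm A B)) neB)) pA
           | l , Vs , _ , atV , r ← go B (rec (shorter p neA)) pB
        = length (Us ++ Vs) , Us ++ Vs , refl , All.++⁺ atU atV ,
          ↭-trans p (↭-trans (↭.++⁺ q r) (↭-reflexive (concat-++ Us Vs)))

    factorization-↭ : ∀ {A B k} → A ↭ B → Factorization A k → Factorization B k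
    factorization-↭ p (Us , eq , at , q) = Us , eq , at , ↭-trans (↭-sym p) q

    factorization-++ : ∀ {A B k l} → Factorization A k → Factorization B l → Factorization (A ++ B) (k + l)
    factorization-++ (Us , refl , atU , p) (Vs , refl , atV , q) =
      Us ++ Vs , length-++ Us , All.++⁺ atU atV ,
      ↭-trans (↭.++⁺ p q) (↭-reflexive (concat-++ Us Vs))

    factorization-replicate : ∀ {A k} n → Factorization A k → Factorization (concat (replicate n A)) (n * k)
    factorization-replicate zero    f = [] , refl , [] , ↭-refl
    factorization-replicate (suc n) f = factorization-++ f (factorization-replicate n f)

    factorization-atom : ∀ {A} → Atom A → Factorization A 1
    factorization-atom at with B , p , ordered ← orderedAtom at =
      [ B ] , refl , ordered ∷ [] , ↭-trans p (↭-reflexive (sym (++-identityʳ B)))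

    factorization-≡ : ∀ {A k l} → k ≡ l → Factorization A k → Factorization A l
    factorization-≡ refl f = f

    factorization⇒productOne : ∀ {A k} → Factorization A k → ProductOne A
    factorization⇒productOne (Us , _ , at , p) = productOne-↭ (↭-sym p) (go Us at)
      where
      go : ∀ Us → All OrderedAtom Us → ProductOne (concat Us)
      go [] [] = productOne refl
      go (U ∷ Us) ((at , _) ∷ ats) = productOne-++ (proj₁ at) (go Us ats)

  𝖫⇒factorization : ∀ {G₀ : Pred Carrier ℓ} {A k} → 𝖫 G₀ A k → All G₀ A × Factorization A k
  𝖫⇒factorization {G₀ = G₀} (Us , refl , at , p) =
    let over , f = go Us at in ↭.All-resp-↭ (↭-sym p) over , factorization-↭ (↭-sym p) f
    where
    go : ∀ Us → All (𝓐 G₀) Us → All G₀ (concat Us) × Factorization (concat Us) (length Us)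
    go [] [] = [] , [] , refl , [] , ↭-refl
    go (U ∷ Us) (at ∷ ats) =
      let overU , atU = 𝓐⇒atom at
          over , f = go Us ats
      in All.++⁺ overU over , factorization-++ (factorization-atom atU) f

  factorization⇒𝖫 : ∀ {G₀ : Pred Carrier ℓ} {A k} → All G₀ A → Factorization A k → 𝖫 G₀ A k
  factorization⇒𝖫 {G₀ = G₀} over (Us , eq , at , p) = Us , eq ,
    All.zipWith (λ (o , at , _) → atom⇒𝓐 o at) (All.concat⁻ {xss = Us} (↭.All-resp-↭ p over) , at) , p

  all-concat-replicate : ∀ {G₀ : Pred Carrier ℓ} {A} n → All G₀ A → All G₀ (concat (replicate n A))
  all-concat-replicate n over = All.concat⁺ (All.replicate⁺ n over)

  -- The minimal distance as a divisor of all length differences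

  DividesDistances : Pred Carrier ℓ → ℕ → Set _
  DividesDistances G₀ d = ∀ {A} k e → All G₀ A → Factorization A k → Factorization A (k + e) → d ∣ e

  -- The differences of factorization lengths over G₀ form a subgroup of ℤ, whose
  -- positive generator is min Δ(G₀).
  minΔ⇒ : ∀ {G₀ : Pred Carrier ℓ} {d} → IsMin (Δ G₀) d →
          0 < d × DividesDistances G₀ d ×
          ∃[ A ] ∃[ k ] (All G₀ A × Factorization A k × Factorization A (k + d))
  minΔ⇒ {G₀ = G₀} {d} ((A , (overA , _) , 0<d , k , k∈L , interval) , d-min) =
    0<d , divisible , A , k , overA , proj₂ (𝖫⇒factorization k∈L) , fₖ₊ₔ
    where
    fₖ₊ₔ : Factorization A (k + d)
    fₖ₊ₔ = proj₂ (𝖫⇒factorization (proj₁ (proj₂ interval (inj₂ refl))))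

    -- A length `y` strictly between would give the smaller difference `y ∸ l`, excluded by
    -- induction. So `l` and `l + x` are adjacent lengths, and `x` is a distance below the minimum.
    no-smaller : ∀ {B} x l → Acc _<_ x → All G₀ B → Factorization B l → Factorization B (l + x) →
                 0 < x → ¬ x < d
    no-smaller {B} x l (acc rec) overB f g 0<x x<d =
      <⇒≱ x<d (d-min x (B , (overB , factorization⇒productOne f) , 0<x , l , factorization⇒𝖫 overB f ,
        (λ {y} (y∈L , l≤y , y≤l+x) → gap y y∈L l≤y y≤l+x) ,
        λ { (inj₁ refl) → factorization⇒𝖫 overB f , ≤-refl , m≤m+n l x
          ; (inj₂ refl) → factorization⇒𝖫 overB g , m≤m+n l x , ≤-refl }))
      where
      gap : ∀ y → 𝖫 G₀ B y → l ≤ y → y ≤ l + x → l ≡ y ⊎ l + x ≡ y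
      gap y y∈L l≤y y≤l+x with m≤n⇒m<n∨m≡n l≤y | m≤n⇒m<n∨m≡n y≤l+x
      ... | inj₂ eq | _ = inj₁ eq
      ... | inj₁ _ | inj₂ eq = inj₂ (sym eq)
      ... | inj₁ l<y | inj₁ y<l+x =
        contradiction (<-trans y∸l<x x<d)
          (no-smaller (y ∸ l) l (rec y∸l<x) overB f
            (factorization-≡ (sym (m+[n∸m]≡n l≤y)) (proj₂ (𝖫⇒factorization y∈L)))
            (m<n⇒0<n∸m l<y))
        where
        y∸l<x : y ∸ l < x
        y∸l<x = +-cancelˡ-< l _ _ (subst (_< l + x) (sym (m+[n∸m]≡n l≤y)) y<l+x)

    instance _ = >-nonZero 0<d

    divisible : DividesDistances G₀ d
    divisible {B} l e overB f g = divides q (trans e≡ (cong (_+ q * d) r≡0))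
      where
      q = e / d
      r = e % d
      e≡ : e ≡ r + q * d
      e≡ = m≡m%n+[m/n]*n e d
      -- Multiply `B` by `q` copies of `A`, once with `k + d` and once with `k` atoms each: the
      -- lengths `l + q * (k + d)` and `l + e + q * k` differ by the remainder `r` alone.
      both = All.++⁺ overB (all-concat-replicate q overA)
      f′ = factorization-++ f (factorization-replicate q fₖ₊ₔ)
      g′ = factorization-++ g (factorization-replicate q (proj₂ (𝖫⇒factorization k∈L)))
      rearrange : ∀ l r q d k → l + (r + q * d) + q * k ≡ l + q * (k + d) + r
      rearrange = solve-∀
      r≡0 : r ≡ 0
      r≡0 with r in eq
      ... | zero  = refl
      ... | suc r′ = contradiction (subst (_< d) eq (m%n<n e d))
        (no-smaller (suc r′) (l + q * (k + d)) (<-wellFounded _) both f′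
          (factorization-≡ (trans (cong (λ e → l + e + q * k) (trans e≡ (cong (_+ q * d) eq)))
                                  (rearrange l (suc r′) q d k)) g′)
          (s≤s z≤n))

  -- Divisibility leaves no room for a length strictly between `k` and `k + d`, and makes every
  -- other distance at least `d`.
  minΔ⇐ : ∀ {G₀ : Pred Carrier ℓ} {d A k} → 0 < d → DividesDistances G₀ d →
          All G₀ A → Factorization A k → Factorization A (k + d) → IsMin (Δ G₀) d
  minΔ⇐ {G₀ = G₀} {d} {A} {k} 0<d divisible over f g =
    (A , (over , factorization⇒productOne f) , 0<d , k , factorization⇒𝖫 over f ,
      (λ {y} (y∈L , k≤y , y≤k+d) → gap y y∈L k≤y y≤k+d) ,
      λ { (inj₁ refl) → factorization⇒𝖫 over f , ≤-refl , m≤m+n k d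
        ; (inj₂ refl) → factorization⇒𝖫 over g , m≤m+n k d , ≤-refl }) ,
    λ { x (B , _ , 0<x , l , l∈L , _ , interval) →
        let overB , fB = 𝖫⇒factorization l∈L
            gB = proj₂ (𝖫⇒factorization (proj₁ (interval (inj₂ refl))))
        in ∣⇒≤ {{>-nonZero 0<x}} (divisible l x overB fB gB) }
    where
    gap : ∀ y → 𝖫 G₀ A y → k ≤ y → y ≤ k + d → k ≡ y ⊎ k + d ≡ y
    gap y y∈L k≤y y≤k+d
      with divides q eq ← divisible k (y ∸ k) over f
             (factorization-≡ (sym (m+[n∸m]≡n k≤y)) (proj₂ (𝖫⇒factorization y∈L)))
      with q
    ... | zero  = inj₁ (≤-antisym k≤y (m∸n≡0⇒m≤n eq))
    ... | suc q = inj₂ (≤-antisym (subst (k + d ≤_) (m+[n∸m]≡n k≤y)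
                          (+-monoʳ-≤ k (subst (d ≤_) (sym eq) (m≤m+n d _)))) y≤k+d)

  -- Atoms and the Davenport constant

  cut : ∀ S i j → i < j → j ≤ length S → prod (take i S) ≡ prod (take j S) →
        ∃[ A ] ∃[ B ] ∃[ C ] (S ≡ A ++ B ++ C × length A ≡ i × B ≢ [] × prod B ≡ ε)
  cut (g ∷ S) zero (suc j) _ j≤S eq =
    [] , take (suc j) (g ∷ S) , drop (suc j) (g ∷ S) , sym (take++drop≡id (suc j) (g ∷ S)) ,
    refl , (λ ()) , sym eq
  cut (g ∷ S) (suc i) (suc j) (s≤s i<j) (s≤s j≤S) eq
    with A , B , C , refl , refl , ne , one ← cut S i j i<j j≤S (∙-cancelˡ g _ _ eq)
    = g ∷ A , B , C , refl , refl , ne , one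

  -- Since `B` is contiguous, deleting it leaves the product of the word unchanged without any
  -- commutativity; `A ≢ []` keeps the remainder nonempty.
  ordered-split : ∀ A B C → A ≢ [] → B ≢ [] → prod B ≡ ε → prod (A ++ B ++ C) ≡ ε → Splits (A ++ B ++ C)
  ordered-split A B C neA neB one eq =
    B , A ++ C , productOne one , neB , productOne AC≡ε , neA ∘ ++-conicalˡ A C , ↭.shifts A B
    where
    open ≡-Reasoning
    AC≡ε : prod (A ++ C) ≡ ε
    AC≡ε = begin
      prod (A ++ C)              ≡⟨ prod-++ A C ⟩
      prod A ∙ prod C            ≡⟨ cong (prod A ∙_) (identityˡ _) ⟨
      prod A ∙ (ε ∙ prod C)      ≡⟨ cong (λ x → prod A ∙ (x ∙ prod C)) one ⟨
      prod A ∙ (prod B ∙ prod C) ≡⟨ cong (prod A ∙_) (prod-++ B C) ⟨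
      prod A ∙ prod (B ++ C)     ≡⟨ prod-++ A (B ++ C) ⟨
      prod (A ++ B ++ C)         ≡⟨ eq ⟩
      ε                          ∎

  -- Two equal prefix products enclose a block of product one. `0 < i` leaves out the empty prefix,
  -- whose product agrees with that of the whole of `S`.
  prefixes-distinct : ∀ {S i j} → OrderedAtom S → 0 < i → i < j → j ≤ length S →
                      prod (take i S) ≢ prod (take j S)
  prefixes-distinct {S} {i} {j} ((_ , _ , ¬s) , one) 0<i i<j j≤S eq
    with A , B , C , refl , refl , neB , B≡ε ← cut S i j i<j j≤S eq
    = ¬s (ordered-split A B C (λ { refl → n≮n 0 0<i }) neB B≡ε one)

  -- Stated for any `N` values that contain the prefix products, so as to apply to `G` and to the
  -- subgroup of rotations alike.
  atom-length≤ : ∀ {S N} (f : Fin N → Carrier) → OrderedAtom S →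
                 (∀ i → ∃[ j ] f j ≡ prod (take i S)) → length S ≤ N
  atom-length≤ {S} f at covered = ≮⇒≥ λ N<S →
    let i , j , i<j , eq = Fin.pigeonhole N<S λ i → proj₁ (covered (suc (toℕ i)))
    in prefixes-distinct at (s≤s z≤n) (s≤s i<j) (Fin.toℕ<n j)
         (trans (sym (proj₂ (covered (suc (toℕ i)))))
                (trans (cong f eq) (proj₂ (covered (suc (toℕ j))))))

  atom-length≤∣G∣ : ∀ {S} → Atom S → length S ≤ ∣G∣
  atom-length≤∣G∣ at with T , p , ordered ← orderedAtom at =
    subst (_≤ ∣G∣) (sym (↭.↭-length p)) (atom-length≤ element ordered λ i → _ , element-index _)

  -- Together with `z` the prefix products are more than `∣G∣` points; as they are distinct among
  -- themselves, the collision involves `z`.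
  prefixes-exhaust : ∀ {S} → OrderedAtom S → ∣G∣ ≤ length S →
                     ∀ z → ∃[ i ] (0 < i × i ≤ length S × prod (take i S) ≡ z)
  prefixes-exhaust {S} at G≤S z with collision points (s≤s G≤S)
    where
    points : Fin (suc (length S)) → Carrier
    points zero    = z
    points (suc i) = prod (take (suc (toℕ i)) S)
  ... | zero  , suc j , _ , eq = suc (toℕ j) , s≤s z≤n , Fin.toℕ<n j , sym eq
  ... | suc i , suc j , s≤s i<j , eq =
    contradiction eq (prefixes-distinct at (s≤s z≤n) (s≤s i<j) (Fin.toℕ<n j))

  productOne-[] : ∀ {g} → ProductOne [ g ] → g ≡ ε
  productOne-[] (T , p , eq) rewrite ↭.↭-singleton-inv (↭-sym p) = trans (sym (identityʳ _)) eq

  atom-[ε] : Atom [ ε ]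
  atom-[ε] = productOne (identityʳ ε) , (λ ()) , λ where
    ([] , T , _ , neS , _) → neS refl
    (_ ∷ S , [] , _ , _ , _ , neT , _) → neT refl
    (g ∷ S , h ∷ T , _ , _ , _ , _ , p) →
      contradiction (suc-injective (trans (↭.↭-length p) (cong suc (length-++ S))))
        (λ eq → contradiction (trans eq (+-suc (length S) (length T))) λ ())

  abstract
    davenport : ∃[ D ] IsDavenport U D
    davenport = greatest (λ k → map′ to from (∃List? atom? k)) (1 , [ ε ] , atom⇒𝓐 (tt ∷ []) atom-[ε] , refl)
                  ∣G∣ λ { _ (S , at , refl) → atom-length≤∣G∣ (proj₂ (𝓐⇒atom at)) }
      where
      to : ∀ {k} → (∃[ S ] (length S ≡ k × Atom S)) → ∃[ S ] (S ∈ 𝓐 U × length S ≡ k)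
      to (S , eq , at) = S , atom⇒𝓐 (All.universal (λ _ → tt) S) at , eq
      from : ∀ {k} → (∃[ S ] (S ∈ 𝓐 U × length S ≡ k)) → ∃[ S ] (length S ≡ k × Atom S)
      from (S , at , eq) = S , eq , proj₂ (𝓐⇒atom at)

  atom-length≤D : ∀ {D S} → IsDavenport U D → Atom S → length S ≤ D
  atom-length≤D {S = S} (_ , D-max) at = D-max _ (S , atom⇒𝓐 (All.universal (λ _ → tt) S) at , refl)

  D≤∣G∣ : ∀ {D} → IsDavenport U D → D ≤ ∣G∣
  D≤∣G∣ ((_ , at , refl) , _) = atom-length≤∣G∣ (proj₂ (𝓐⇒atom at))

  all-≡⇒replicate : ∀ {g : Carrier} {S} → All (_≡ g) S → S ≡ replicate (length S) g
  all-≡⇒replicate []          = refl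
  all-≡⇒replicate (refl ∷ eqs) = cong (_ ∷_) (all-≡⇒replicate eqs)

  0<length : ∀ {S : Sequence} → S ≢ [] → 0 < length S
  0<length {[]}    ne = contradiction refl ne
  0<length {_ ∷ _} _  = s≤s z≤n

  atom-power : ∀ {g k} → IsOrder g k → Atom (replicate k g)
  atom-power {g} {k} ((0<k , gᵏ≡ε) , k-min) =
    productOne (trans (prod-replicate k g) gᵏ≡ε) ,
    (λ eq → <⇒≢ 0<k (trans (cong length (sym eq)) (length-replicate k))) , irreducible
    where
    irreducible : ¬ Splits (replicate k g)
    irreducible (S , T , (S′ , q , S≡ε) , neS , _ , neT , p) =
      <⇒≱ (subst (length S <_) lengths (m<m+n _ (0<length neT)))
          (k-min _ (0<length neS , trans (sym (prod-replicate (length S) g)) (trans (cong prod (sym S′≡)) S≡ε)))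
      where
      S′≡ : S′ ≡ replicate (length S) g
      S′≡ = trans (all-≡⇒replicate (↭.All-resp-↭ q (All.++⁻ˡ S (↭.All-resp-↭ p (All.replicate⁺ k refl)))))
                  (cong (λ n → replicate n g) (sym (↭.↭-length q)))
      lengths : length S + length T ≡ k
      lengths = trans (sym (length-++ S)) (trans (sym (↭.↭-length p)) (length-replicate k))

  ord≤D : ∀ {D} → IsDavenport U D → ∀ g → ord g ≤ D
  ord≤D dav g = subst (_≤ _) (length-replicate (ord g)) (atom-length≤D dav (atom-power (proj₂ (order g))))

  ε∈atom : ∀ {A} → Atom A → ε ∈ˡ A → length A ≡ 1
  ε∈atom at ε∈A with B , p , (_ , _ , ¬s) , one ← orderedAtom at
    with as , bs , refl ← ∈-∃++ (↭.∈-resp-↭ p ε∈A)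
    with ≢[]? (as ++ bs)
  ... | yes ne = contradiction
    ([ ε ] , as ++ bs , productOne (identityʳ ε) , (λ ()) , productOne AB≡ε , ne , ↭.shift ε as bs) ¬s
    where
    AB≡ε : prod (as ++ bs) ≡ ε
    AB≡ε = trans (prod-++ as bs) (trans (cong (prod as ∙_) (sym (identityˡ _)))
             (trans (sym (prod-++ as (ε ∷ bs))) one))
  ... | no ¬ne = trans (↭.↭-length p) (trans (↭.↭-length (↭.shift ε as bs)) (cong suc (length≡0 ¬ne)))
    where
    length≡0 : ∀ {S : Sequence} → ¬ (S ≢ []) → length S ≡ 0
    length≡0 {[]}    _   = refl
    length≡0 {_ ∷ _} ¬ne = contradiction (λ ()) ¬ne

  -- In a splitting of at most three terms one part is a single term, which is product-one only if
  -- it is `ε`.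
  atom-length≤3 : ∀ {A} → ProductOne A → A ≢ [] → ε ∉ˡ A → length A ≤ 3 → Atom A
  atom-length≤3 {A} one ne ε∉A A≤3 = one , ne , irreducible
    where
    irreducible : ¬ Splits A
    irreducible ([] , _ , _ , neS , _) = neS refl
    irreducible (_ , [] , _ , _ , _ , neT , _) = neT refl
    irreducible (x ∷ [] , T , pS , _ , _ , _ , p) =
      ε∉A (↭.∈-resp-↭ (↭-sym p) (here (sym (productOne-[] pS))))
    irreducible (x ∷ y ∷ S , z ∷ [] , _ , _ , pT , _ , p) =
      ε∉A (↭.∈-resp-↭ (↭-sym p) (∈-++⁺ʳ (x ∷ y ∷ S) (here (sym (productOne-[] pT)))))
    irreducible (x ∷ y ∷ S , z ∷ w ∷ T , _ , _ , _ , _ , p) =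
      contradiction (≤-trans (s≤s (s≤s (≤-trans (s≤s (s≤s z≤n)) (m≤n+m _ (length S)))))
        (≤-trans (≤-reflexive (sym (trans (↭.↭-length p) (length-++ (x ∷ y ∷ S))))) A≤3))
        (λ { (s≤s (s≤s (s≤s ()))) })

  2≤atom : ∀ {A} → Atom A → ε ∉ˡ A → 2 ≤ length A
  2≤atom {[]} (_ , ne , _) _ = contradiction refl ne
  2≤atom {g ∷ []} (one , _) ε∉A = contradiction (here (sym (productOne-[] one))) ε∉A
  2≤atom {_ ∷ _ ∷ _} _ _ = s≤s (s≤s z≤n)

  -- Cross numbers

  abstract
    ord-∣! : ∀ g → ord g ∣ ∣G∣ !
    ord-∣! g = ∣-trans (n∣n! (0<ord g)) (m≤n⇒m!∣n! (ord≤∣G∣ g))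
      where
      n∣n! : ∀ {n} → 0 < n → n ∣ n !
      n∣n! {suc n} _ = m∣m*n (n !)

  -- The cross number Σ 1/ord(g), multiplied by ∣G∣! so as to be a natural number.
  κ : Carrier → ℕ
  κ g = _∣_.quotient (ord-∣! g)

  ord*κ : ∀ g → ord g * κ g ≡ ∣G∣ !
  ord*κ g = trans (*-comm (ord g) (κ g)) (sym (_∣_.equality (ord-∣! g)))

  open Weight κ renaming
    ( weight to cross; weight-++ to cross-++; weight-↭ to cross-↭; weight-replicate to cross-replicate
    ; weight-concat-replicate to cross-concat-replicate; light to light-cross; heavy to heavy-cross)

  cross-power : ∀ g → cross (replicate (ord g) g) ≡ ∣G∣ !
  cross-power g = trans (cross-replicate (ord g) g) (ord*κ g)

  concat-map-∷ : ∀ (g : Carrier) Ts → concat (map (g ∷_) Ts) ↭ replicate (length Ts) g ++ concat Ts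
  concat-map-∷ g [] = ↭-refl
  concat-map-∷ g (T ∷ Ts) = prep g (↭-trans (↭.++⁺ˡ T (concat-map-∷ g Ts)) (↭.shifts T (replicate (length Ts) g)))

  -- Here the order of the atoms matters: with `g` in front, each tail has product `g ⁻¹` on the
  -- nose.
  prod-tails : ∀ {g} Ts → All (λ T → prod (g ∷ T) ≡ ε) Ts → prod (concat Ts) ≡ (g ⁻¹) ^ length Ts
  prod-tails [] [] = refl
  prod-tails {g} (T ∷ Ts) (eq ∷ eqs) =
    trans (prod-++ T _) (cong₂ _∙_ (inverseʳ-unique g (prod T) eq) (prod-tails Ts eqs))

  -- `foldr (λ x _ → x) ε` is the first term of a list; the default `ε` concerns the empty list
  -- only, which `A ≢ []` excludes.
  tails : ∀ {g} As → All (λ A → A ≢ [] × foldr (λ x _ → x) ε A ≡ g) As → ∃[ Ts ] As ≡ map (g ∷_) Ts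
  tails [] [] = [] , refl
  tails ([] ∷ As) ((ne , _) ∷ _) = contradiction refl ne
  tails ((_ ∷ T) ∷ As) ((_ , refl) ∷ hs) with Ts , refl ← tails As hs = T ∷ Ts , refl

  tails-nonempty : ∀ {g} Ts → All (λ T → OrderedAtom (g ∷ T)) Ts → 1 < length Ts → ord g ≡ length Ts →
                     concat Ts ≢ []
  tails-nonempty {g} (T ∷ Ts) ((_ , one) ∷ _) 1<n eq e = n≮n 1 (≤-trans 1<n (subst (_≤ 1) eq
    (proj₂ (proj₂ (order g)) 1 (s≤s z≤n , trans (identityʳ g)
      (trans (sym (identityʳ g)) (trans (cong (λ S → g ∙ prod S) (sym (++-conicalˡ T (concat Ts) e))) one))))))

  -- There are `∣G∣` possible first terms, so one of them, `g`, begins more than `∣G∣ ≥ ord g`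
  -- atoms; exactly `ord g` of these are taken.
  common-term : ∀ Us → All OrderedAtom Us → ∣G∣ * ∣G∣ < length Us →
                ∃[ g ] ∃[ Ts ] ∃[ rest ] (ord g ≡ length Ts ×
                  All (λ T → OrderedAtom (g ∷ T)) Ts × All OrderedAtom rest × Us ↭ map (g ∷_) Ts ++ rest)
  common-term Us atoms C<Us
    with g , hits , rest , heads , G<hits , p ← crowded _≟_ (foldr (λ x _ → x) ε) (tabulate element) Us
           (All.universal (λ U → subst (_∈ˡ tabulate element) (element-index _) (∈-tabulate⁺ (index _))) Us)
           ∣G∣ (subst (λ n → n * ∣G∣ < length Us) (sym (length-tabulate element)) C<Us)
    = collect (take (ord g) hits) (drop (ord g) hits ++ rest)
        (trans (length-take (ord g) hits) (m≤n⇒m⊓n≡m (≤-trans (ord≤∣G∣ g) (<⇒≤ G<hits))))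
        (All.take⁺ (ord g) heads)
        (↭-trans p (↭-reflexive (trans (cong (_++ rest) (sym (take++drop≡id (ord g) hits)))
                                       (++-assoc (take (ord g) hits) _ rest))))
    where
    collect : ∀ {g} As rest → length As ≡ ord g → All (λ A → foldr (λ x _ → x) ε A ≡ g) As →
              Us ↭ As ++ rest → _
    collect {g} As rest len heads p
      with atoms′ ← ↭.All-resp-↭ p atoms
      with Ts , refl ← tails As (All.zipWith (λ (((_ , ne , _) , _) , h) → ne , h) (All.++⁻ˡ As atoms′ , heads))
      = g , Ts , rest , sym (trans (sym (length-map (g ∷_) Ts)) len) ,
        All.map⁻ (All.++⁻ˡ As atoms′) , All.++⁻ʳ As atoms′ , p

  module _ {G₀ : Pred Carrier ℓ} {d} (divisible : DividesDistances G₀ d) where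

    -- Replacing g T₁, …, g Tₙ, where n = ord(g), by gⁿ and a factorization of
    -- T₁ ⋯ Tₙ, which has product g⁻ⁿ = 1.
    exchange : ∀ {g} Ts → ord g ≡ length Ts → All (λ T → OrderedAtom (g ∷ T)) Ts →
               All G₀ (replicate (ord g) g ++ concat Ts) →
               2 + d ≤ ord g ⊎ (∃[ Vs ] (All OrderedAtom Vs × concat Ts ↭ concat Vs × ord g ≤ suc (length Vs)))
    exchange {g} Ts n≡ atoms over = decide (factorization (concat Ts) (productOne Ts≡ε))
      where
      n = ord g
      open ≡-Reasoning
      Ts≡ε : prod (concat Ts) ≡ ε
      Ts≡ε = begin
        prod (concat Ts)      ≡⟨ prod-tails Ts (All.map proj₂ atoms) ⟩
        (g ⁻¹) ^ length Ts    ≡⟨ cong ((g ⁻¹) ^_) n≡ ⟨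
        (g ⁻¹) ^ n            ≡⟨ ⁻¹-^ g n ⟩
        (g ^ n) ⁻¹            ≡⟨ cong _⁻¹ (g^ord≡ε g) ⟩
        ε ⁻¹                  ≡⟨ ε⁻¹≈ε ⟩
        ε                     ∎

      -- `n` atoms turn into `1 + R`. A strict decrease is a positive multiple of `d`, and it is at
      -- most `n - 2` because `R` is positive.
      shrinking : ∀ R → Factorization (concat Ts) R → 0 < R → suc R < n → 2 + d ≤ n
      shrinking R f 0<R 1+R<n = ≤-trans (s≤s (s≤s d≤e))
        (≤-trans (+-monoˡ-≤ e (s≤s 0<R)) (≤-reflexive (m+[n∸m]≡n (<⇒≤ 1+R<n))))
        where
        e = n ∸ suc R
        d≤e : d ≤ e
        d≤e = ∣⇒≤ {{>-nonZero (m<n⇒0<n∸m 1+R<n)}} (divisible (suc R) e over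
          (factorization-++ (factorization-atom (atom-power (proj₂ (order g)))) f)
          (map (g ∷_) Ts ,
           trans (length-map (g ∷_) Ts) (trans (sym n≡) (sym (m+[n∸m]≡n (<⇒≤ 1+R<n)))) ,
           All.map⁺ atoms ,
           ↭-trans (↭-reflexive (cong (λ k → replicate k g ++ concat Ts) n≡)) (↭-sym (concat-map-∷ g Ts))))

      decide : ∃ (Factorization (concat Ts)) →
               2 + d ≤ n ⊎ (∃[ Vs ] (All OrderedAtom Vs × concat Ts ↭ concat Vs × n ≤ suc (length Vs)))
      decide (R , Vs , len , Vs-atoms , p) with suc (length Vs) ℕ.<? n
      ... | no ≮ = inj₂ (Vs , Vs-atoms , p , ≮⇒≥ ≮)
      ... | yes lt with Vs
      ... | V ∷ Vs′ = inj₁ (shrinking (suc (length Vs′)) (V ∷ Vs′ , refl , Vs-atoms , p) (s≤s z≤n) lt)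
      ... | [] = contradiction (↭.↭-empty-inv p) (tails-nonempty Ts atoms (subst (1 <_) n≡ lt) n≡)

    -- As long as more than ∣G∣² atoms are left, some element g occurs in ord(g)
    -- of them.  An exchange does not decrease the number of atoms, unless
    -- d ≤ ord(g) - 2.
    length≤cross : ∀ Us → Acc _<_ (length (concat Us)) → All G₀ (concat Us) → All OrderedAtom Us →
                   (∃[ g ] 2 + d ≤ ord g) ⊎
                   (length Us * ∣G∣ ! ≤ cross (concat Us) + ∣G∣ * ∣G∣ * ∣G∣ !)
    length≤cross Us (acc rec) over atoms with ∣G∣ * ∣G∣ ℕ.<? length Us
    ... | no C≮Us = inj₂ (≤-trans (*-monoˡ-≤ (∣G∣ !) (≮⇒≥ C≮Us)) (m≤n+m _ (cross (concat Us))))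
    ... | yes C<Us with g , Ts , rest , n≡ , Ts-atoms , rest-atoms , p ← common-term Us atoms C<Us =
      step (exchange Ts n≡ Ts-atoms
             (subst (λ k → All G₀ (replicate k g ++ concat Ts)) (sym n≡)
                    (↭.All-resp-↭ (concat-map-∷ g Ts) (All.++⁻ˡ (concat (map (g ∷_) Ts)) over′)))
           )
      where
      Us↭ : concat Us ↭ concat (map (g ∷_) Ts) ++ concat rest
      Us↭ = ↭-trans (concat-↭ p) (↭-reflexive (sym (concat-++ (map (g ∷_) Ts) rest)))
      over′ = ↭.All-resp-↭ Us↭ over
      step : 2 + d ≤ ord g ⊎ (∃[ Vs ] (All OrderedAtom Vs × concat Ts ↭ concat Vs × ord g ≤ suc (length Vs))) →
             _
      step (inj₁ long) = inj₁ (g , long)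
      -- The power of `g` is set aside: the cross number drops by exactly one unit `∣G∣ !`, and
      -- `ord g` atoms are replaced by at least `ord g - 1`. So the inequality for the remaining
      -- atoms gives the one for `Us`.
      step (inj₂ (Vs , Vs-atoms , Ts↭Vs , n≤)) = Sum.map₂ bound
        (length≤cross (Vs ++ rest) (rec shorter) (All.++⁻ʳ (replicate (ord g) g) (↭.All-resp-↭ Us↭Vs over))
                      (All.++⁺ Vs-atoms rest-atoms))
        where
        Us↭Vs : concat Us ↭ replicate (ord g) g ++ concat (Vs ++ rest)
        Us↭Vs = begin
          concat Us ↭⟨ Us↭ ⟩
          concat (map (g ∷_) Ts) ++ concat rest ↭⟨ ↭.++⁺ʳ (concat rest) (concat-map-∷ g Ts) ⟩
          (replicate (length Ts) g ++ concat Ts) ++ concat rest ≡⟨ ++-assoc (replicate (length Ts) g) _ _ ⟩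
          replicate (length Ts) g ++ concat Ts ++ concat rest
            ↭⟨ ↭.++⁺ˡ (replicate (length Ts) g) (↭.++⁺ʳ (concat rest) Ts↭Vs) ⟩
          replicate (length Ts) g ++ concat Vs ++ concat rest
            ≡⟨ cong₂ (λ k S → replicate k g ++ S) (sym n≡) (concat-++ Vs rest) ⟩
          replicate (ord g) g ++ concat (Vs ++ rest) ∎
          where open PermutationReasoning
        shorter : length (concat (Vs ++ rest)) < length (concat Us)
        shorter = subst (length (concat (Vs ++ rest)) <_)
          (sym (trans (↭.↭-length Us↭Vs) (trans (length-++ (replicate (ord g) g)) (cong (_+ _) (length-replicate (ord g))))))
          (m<n+m _ (0<ord g))
        open ≤-Reasoning
        lengthUs : length Us ≤ 1 + length (Vs ++ rest)
        lengthUs = begin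
          length Us                                ≡⟨ trans (↭.↭-length p) (length-++ (map (g ∷_) Ts)) ⟩
          length (map (g ∷_) Ts) + length rest     ≡⟨ cong (_+ length rest) (trans (length-map (g ∷_) Ts) (sym n≡)) ⟩
          ord g + length rest                      ≤⟨ +-monoˡ-≤ (length rest) n≤ ⟩
          1 + (length Vs + length rest)            ≡⟨ cong suc (length-++ Vs) ⟨
          1 + length (Vs ++ rest)                  ∎
        crossUs : cross (concat Us) ≡ ∣G∣ ! + cross (concat (Vs ++ rest))
        crossUs = trans (cross-↭ Us↭Vs) (trans (cross-++ (replicate (ord g) g) _)
          (cong (_+ cross (concat (Vs ++ rest))) (cross-power g)))
        bound : length (Vs ++ rest) * ∣G∣ ! ≤ cross (concat (Vs ++ rest)) + ∣G∣ * ∣G∣ * ∣G∣ ! →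
                length Us * ∣G∣ ! ≤ cross (concat Us) + ∣G∣ * ∣G∣ * ∣G∣ !
        bound le = begin
          length Us * ∣G∣ !                                 ≤⟨ *-monoˡ-≤ (∣G∣ !) lengthUs ⟩
          ∣G∣ ! + length (Vs ++ rest) * ∣G∣ !               ≤⟨ +-monoʳ-≤ (∣G∣ !) le ⟩
          ∣G∣ ! + (cross (concat (Vs ++ rest)) + ∣G∣ * ∣G∣ * ∣G∣ !)
            ≡⟨ +-assoc (∣G∣ !) _ _ ⟨
          ∣G∣ ! + cross (concat (Vs ++ rest)) + ∣G∣ * ∣G∣ * ∣G∣ !
            ≡⟨ cong (_+ ∣G∣ * ∣G∣ * ∣G∣ !) crossUs ⟨
          cross (concat Us) + ∣G∣ * ∣G∣ * ∣G∣ !             ∎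

    -- Each copy of `V` falls short of `∣G∣ !` by at least 1, so `1 + ∣G∣ * ∣G∣ * ∣G∣ !` copies fall
    -- short by more than the error term of `length≤cross`.
    small-cross⇒longOrder : ∀ {V} → All G₀ V → OrderedAtom V → cross V < ∣G∣ ! → ∃[ g ] 2 + d ≤ ord g
    small-cross⇒longOrder {V} over at V<E
      with length≤cross (replicate (suc (∣G∣ * ∣G∣ * ∣G∣ !)) V) (<-wellFounded _)
             (all-concat-replicate (suc (∣G∣ * ∣G∣ * ∣G∣ !)) over) (All.replicate⁺ (suc (∣G∣ * ∣G∣ * ∣G∣ !)) at)
    ... | inj₁ long = long
    ... | inj₂ le = contradiction le (<⇒≱ exceeded)
      where
      E = ∣G∣ !
      N = suc (∣G∣ * ∣G∣ * ∣G∣ !)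
      exceeded : cross (concat (replicate N V)) + ∣G∣ * ∣G∣ * ∣G∣ ! < length (replicate N V) * E
      exceeded = begin-strict
        cross (concat (replicate N V)) + ∣G∣ * ∣G∣ * ∣G∣ !  ≡⟨ cong (_+ ∣G∣ * ∣G∣ * ∣G∣ !) (cross-concat-replicate N V) ⟩
        N * cross V + ∣G∣ * ∣G∣ * ∣G∣ !                     <⟨ +-monoʳ-< (N * cross V) (n<1+n (∣G∣ * ∣G∣ * ∣G∣ !)) ⟩
        N * cross V + N                         ≡⟨ trans (+-comm (N * cross V) N) (sym (*-suc N (cross V))) ⟩
        N * suc (cross V)                       ≤⟨ *-monoʳ-≤ N V<E ⟩
        N * E                                   ≡⟨ cong (_* E) (length-replicate N) ⟨
        length (replicate N V) * E              ∎
        where open ≤-Reasoning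

  -- U = g₁ ⋯ gₘ is complemented in g₁^{n₁} ⋯ gₘ^{nₘ}, where nᵢ = ord(gᵢ), by the
  -- sequence with product gₘ^{nₘ-1} ⋯ g₁^{n₁-1} = (g₁ ⋯ gₘ)⁻¹.
  complement : Sequence → Sequence
  complement []      = []
  complement (g ∷ S) = complement S ++ replicate (ord g ∸ 1) g

  powers : Sequence → Sequence
  powers S = concat (map (λ g → replicate (ord g) g) S)

  suc-pred-ord : ∀ g → suc (ord g ∸ 1) ≡ ord g
  suc-pred-ord g = m+[n∸m]≡n (0<ord g)

  prod-complement : ∀ S → prod (complement S) ≡ prod S ⁻¹
  prod-complement [] = sym ε⁻¹≈ε
  prod-complement (g ∷ S) = begin
    prod (complement S ++ replicate (ord g ∸ 1) g) ≡⟨ prod-++ (complement S) _ ⟩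
    prod (complement S) ∙ prod (replicate (ord g ∸ 1) g)
      ≡⟨ cong₂ _∙_ (prod-complement S) (trans (prod-replicate (ord g ∸ 1) g) last) ⟩
    prod S ⁻¹ ∙ g ⁻¹                               ≡⟨ ⁻¹-anti-homo-∙ g (prod S) ⟨
    (g ∙ prod S) ⁻¹                                ∎
    where
    open ≡-Reasoning
    last : g ^ (ord g ∸ 1) ≡ g ⁻¹
    last = inverseʳ-unique g _ (trans (cong (g ^_) (suc-pred-ord g)) (g^ord≡ε g))

  powers-↭ : ∀ S → powers S ↭ S ++ complement S
  powers-↭ [] = ↭-refl
  powers-↭ (g ∷ S) rewrite sym (suc-pred-ord g) =
    prep g (↭-trans (↭.++-comm (replicate (ord g ∸ 1) g) (powers S))
      (↭-trans (↭.++⁺ʳ _ (powers-↭ S)) (↭-reflexive (++-assoc S (complement S) _))))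

  cross-powers : ∀ S → cross (powers S) ≡ length S * ∣G∣ !
  cross-powers [] = refl
  cross-powers (g ∷ S) = trans (cross-++ (replicate (ord g) g) (powers S)) (cong₂ _+_ (cross-power g) (cross-powers S))

  factorization-powers : ∀ S → Factorization (powers S) (length S)
  factorization-powers [] = [] , refl , [] , ↭-refl
  factorization-powers (g ∷ S) =
    factorization-++ (factorization-atom (atom-power (proj₂ (order g)))) (factorization-powers S)

  all-complement : ∀ {G₀ : Pred Carrier ℓ} {S} → All G₀ S → All G₀ (complement S)
  all-complement [] = []
  all-complement (g∈G₀ ∷ over) = All.++⁺ (all-complement over) (All.replicate⁺ _ g∈G₀)

  module _ {G₀ : Pred Carrier ℓ} {d} (divisible : DividesDistances G₀ d) where

    -- The sequence `S ++ complement S` has factorizations of lengths `1 + l` and `length S`, whence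
    -- the inequality. The number `l` is recorded because the case of equality needs `l ≡ 1`.
    LongAtom : Set _
    LongAtom = ∃[ S ] ∃[ l ] (All G₀ S × OrderedAtom S × ε ∉ˡ S × 0 < l ×
                 Factorization (complement S) l × d + suc l ≤ length S)

    private
      light-atom : ∀ {A k} → All G₀ A → Factorization A k → cross A < k * ∣G∣ ! → ∃[ g ] 2 + d ≤ ord g
      light-atom over (Vs , refl , Vs-atoms , p) lt
        with V , V∈Vs , V<E ← Membership.find (light-cross (∣G∣ !) Vs (subst (_< _) (cross-↭ p) lt))
        = small-cross⇒longOrder divisible
            (All.lookup (All.concat⁻ {xss = Vs} (↭.All-resp-↭ p over)) V∈Vs) (All.lookup Vs-atoms V∈Vs) V<E

      heavy-atom : ∀ {A k} → All G₀ A → Factorization A k → k * ∣G∣ ! < cross A →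
                   ∃[ S ] (All G₀ S × OrderedAtom S × ∣G∣ ! < cross S)
      heavy-atom over (Us , refl , Us-atoms , p) lt
        with S , S∈Us , E<S ← Membership.find (heavy-cross (∣G∣ !) Us (subst (_ <_) (cross-↭ p) lt))
        = S , All.lookup (All.concat⁻ {xss = Us} (↭.All-resp-↭ p over)) S∈Us , All.lookup Us-atoms S∈Us , E<S

      cross-complement : ∀ S → cross S + cross (complement S) ≡ length S * ∣G∣ !
      cross-complement S =
        trans (sym (cross-++ S (complement S))) (trans (sym (cross-↭ (powers-↭ S))) (cross-powers S))

      complement≢[] : ∀ S → ε ∉ˡ S → S ≢ [] → complement S ≢ []
      complement≢[] [] _ ne = contradiction refl ne
      complement≢[] (g ∷ S) ε∉ _ eq = ε∉ (here (sym (ord≡1⇒≡ε g (m∸n≡0⇒m≤n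
        (trans (sym (length-replicate (ord g ∸ 1))) (cong length (++-conicalʳ (complement S) _ eq)))))))

    longAtom : ∀ S l → All G₀ S → OrderedAtom S → suc l < length S → Factorization (complement S) l → LongAtom
    longAtom S l over at@((_ , ne , _) , _) 1+l<m f =
      S , l , over , at , ε∉S , 0<l l f , f ,
      subst (d + suc l ≤_) (m∸n+n≡m (<⇒≤ 1+l<m)) (+-monoˡ-≤ (suc l)
        (∣⇒≤ {{>-nonZero (m<n⇒0<n∸m 1+l<m)}} (divisible (suc l) (length S ∸ suc l)
          (All.++⁺ over (all-complement over))
          (factorization-++ (factorization-atom (proj₁ at)) f)
          (factorization-≡ (sym (m+[n∸m]≡n (<⇒≤ 1+l<m))) (factorization-↭ (powers-↭ S) (factorization-powers S))))))
      where
      ε∉S : ε ∉ˡ S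
      ε∉S ε∈S = <⇒≱ 1+l<m (≤-trans (≤-reflexive (ε∈atom (proj₁ at) ε∈S)) (s≤s z≤n))
      0<l : ∀ l → Factorization (complement S) l → 0 < l
      0<l (suc _) _ = s≤s z≤n
      0<l zero ([] , _ , _ , p) = contradiction (↭.↭-empty-inv p) (complement≢[] S ε∉S ne)

    -- The cross number of `A`, in units of `∣G∣ !`, is either below `k + e`, and then the longer
    -- factorization has an atom of cross number below 1, or above `k`, and then the shorter one has
    -- an atom `S` of cross number above 1. In the latter case `complement S` has cross number below
    -- `length S - 1`; unless its factorization contains an atom of cross number below 1, this
    -- forces `1 + l < length S`.
    longOrder⊎longAtom : ∀ {A} k e → 0 < e → All G₀ A → Factorization A k → Factorization A (k + e) →
                         (∃[ g ] 2 + d ≤ ord g) ⊎ LongAtom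
    longOrder⊎longAtom {A} k e 0<e over f f′ with cross A ℕ.<? (k + e) * ∣G∣ !
    ... | yes A<l = inj₁ (light-atom over f′ A<l)
    ... | no A≮l = atom (heavy-atom over f (<-≤-trans (*-monoˡ-< (∣G∣ !) (m<m+n k 0<e)) (≮⇒≥ A≮l)))
      where
      instance _ = ∣G∣ !≢0
      atom : ∃[ S ] (All G₀ S × OrderedAtom S × ∣G∣ ! < cross S) → _
      atom (S , S-over , S-atom , E<S)
        with l , g ← factorization (complement S) (productOne (trans (prod-complement S)
                       (trans (cong _⁻¹ (proj₂ S-atom)) ε⁻¹≈ε)))
        with cross (complement S) ℕ.<? l * ∣G∣ !
      ... | yes lt = inj₁ (light-atom (all-complement S-over) g lt)
      ... | no ≮ = inj₂ (longAtom S l S-over S-atom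
        (*-cancelʳ-< (∣G∣ !) (suc l) (length S) (≤-<-trans (+-monoʳ-≤ (∣G∣ !) (≮⇒≥ ≮))
          (<-≤-trans (+-monoˡ-< (cross (complement S)) E<S) (≤-reflexive (cross-complement S))))) g)

  -- The upper bound D(G) - 2 and the case of equality

  Δ*≤D∸2 : ∀ {D d} → IsDavenport U D → d ∈ Δ* → d ≤ D ∸ 2
  Δ*≤D∸2 {D} {d} dav@(_ , D-max) (G₀ , _ , min)
    with 0<d , divisible , A , k , over , f , f′ ← minΔ⇒ min
    with longOrder⊎longAtom divisible k d 0<d over f f′
  ... | inj₁ (g , long) = ∸-monoˡ-≤ 2 (≤-trans long (ord≤D dav g))
  ... | inj₂ (S , l , _ , (at , _) , _ , 0<l , _ , d+1+l≤S) =
    ∸-monoˡ-≤ 2 (≤-trans (≤-reflexive (+-comm 2 d))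
      (≤-trans (+-monoʳ-≤ d (s≤s 0<l)) (≤-trans d+1+l≤S (atom-length≤D dav at))))

  -- Cyclic subgroups and the case of equality

  IsPower : Carrier → Pred Carrier a
  IsPower g h = ∃[ i ] g ^ i ≡ h

  ^-% : ∀ {g k} → IsOrder g k → ∀ i → ∃[ j ] (j < k × g ^ j ≡ g ^ i)
  ^-% {g} {k} o@((_ , gᵏ≡ε) , _) i = i % k , m%n<n i k , sym (begin
    g ^ i                            ≡⟨ cong (g ^_) (m≡m%n+[m/n]*n i k) ⟩
    g ^ (i % k + i / k * k)          ≡⟨ ^-+ g (i % k) _ ⟩
    g ^ (i % k) ∙ g ^ (i / k * k)    ≡⟨ cong (g ^ (i % k) ∙_) (^-* g (i / k) k) ⟨
    g ^ (i % k) ∙ (g ^ k) ^ (i / k)  ≡⟨ cong (λ x → g ^ (i % k) ∙ x ^ (i / k)) gᵏ≡ε ⟩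
    g ^ (i % k) ∙ ε ^ (i / k)        ≡⟨ cong (g ^ (i % k) ∙_) (ε^ (i / k)) ⟩
    g ^ (i % k) ∙ ε                  ≡⟨ identityʳ _ ⟩
    g ^ (i % k)                      ∎)
    where
    open ≡-Reasoning
    instance _ = order≢0 o

  isPower? : ∀ g → Decidable (IsPower g)
  isPower? g h = map′ (λ (i , _ , eq) → i , eq)
    (λ (i , eq) → let j , j<k , eq′ = ^-% (proj₂ (order g)) i in j , j<k , trans eq′ eq)
    (anyUpTo? (λ i → g ^ i ≟ h) (ord g))

  isPower-∙ : ∀ {g h h′} → IsPower g h → IsPower g h′ → IsPower g (h ∙ h′)
  isPower-∙ {g} (i , refl) (j , refl) = i + j , ^-+ g i j

  isPower-⁻¹ : ∀ {g h} → IsPower g h → IsPower g (h ⁻¹)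
  isPower-⁻¹ {g} (i , refl) = i * (ord g ∸ 1) , inverseʳ-unique (g ^ i) _ (begin
    g ^ i ∙ g ^ (i * (ord g ∸ 1))  ≡⟨ ^-+ g i _ ⟨
    g ^ (i + i * (ord g ∸ 1))      ≡⟨ cong (g ^_) (trans (sym (*-suc i _)) (cong (i *_) (suc-pred-ord g))) ⟩
    g ^ (i * ord g)                ≡⟨ ^-* g i (ord g) ⟨
    (g ^ ord g) ^ i                ≡⟨ cong (_^ i) (g^ord≡ε g) ⟩
    ε ^ i                          ≡⟨ ε^ i ⟩
    ε                              ∎)
    where open ≡-Reasoning

  isPower-cancelʳ : ∀ {g h h′} → IsPower g (h ∙ h′) → IsPower g h′ → IsPower g h
  isPower-cancelʳ {g} {h} {h′} p q = subst (IsPower g)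
    (trans (assoc h h′ _) (trans (cong (h ∙_) (inverseʳ h′)) (identityʳ h)))
    (isPower-∙ p (isPower-⁻¹ q))

  isPower-cancelˡ : ∀ {g h h′} → IsPower g (h ∙ h′) → IsPower g h → IsPower g h′
  isPower-cancelˡ {g} {h} {h′} p q = subst (IsPower g)
    (trans (sym (assoc _ h h′)) (trans (cong (_∙ h′) (inverseˡ h)) (identityˡ h′)))
    (isPower-∙ (isPower-⁻¹ q) p)

  -- For `h` outside ⟨g⟩ the sequence g^{ord(g)-1} h (h⁻¹g) is an atom, so a cyclic subgroup of
  -- order D(G) is all of G. Only its last two terms lie outside ⟨g⟩. A product with exactly one
  -- factor outside a subgroup lies outside, so one part of a splitting would contain neither of
  -- them and be a power of `g` with fewer than `ord g` terms.
  module _ (g h : Carrier) (h∉⟨g⟩ : ¬ IsPower g h) where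

    private
      outside : Carrier → ℕ
      outside u with isPower? g u
      ... | yes _ = 0
      ... | no  _ = 1

      open Weight outside

      outside-yes : ∀ {u} → IsPower g u → outside u ≡ 0
      outside-yes {u} p with isPower? g u
      ... | yes _ = refl
      ... | no ¬p = contradiction p ¬p

      outside-no : ∀ {u} → ¬ IsPower g u → outside u ≡ 1
      outside-no {u} ¬p with isPower? g u
      ... | yes p = contradiction p ¬p
      ... | no _  = refl

      none-outside : ∀ S → weight S ≡ 0 → All (IsPower g) S
      none-outside [] _ = []
      none-outside (u ∷ S) eq with isPower? g u
      ... | yes p = p ∷ none-outside S eq

      isPower-prod : ∀ {S} → All (IsPower g) S → IsPower g (prod S)
      isPower-prod []       = 0 , refl
      isPower-prod (p ∷ ps) = isPower-∙ p (isPower-prod ps)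

      one-outside : ∀ S → weight S ≡ 1 → ¬ IsPower g (prod S)
      one-outside (u ∷ S) eq p with isPower? g u
      ... | yes q = one-outside S eq (isPower-cancelˡ p q)
      ... | no ¬q = ¬q (isPower-cancelʳ p (isPower-prod (none-outside S (suc-injective eq))))

      two : Sequence
      two = h ∷ h ⁻¹ ∙ g ∷ []

      h⁻¹g∉⟨g⟩ : ¬ IsPower g (h ⁻¹ ∙ g)
      h⁻¹g∉⟨g⟩ p = h∉⟨g⟩ (subst (IsPower g) (⁻¹-involutive h) (isPower-⁻¹ (isPower-cancelʳ p (1 , identityʳ g))))

      A : Sequence
      A = replicate (ord g ∸ 1) g ++ two

      A≡ε : prod A ≡ ε
      A≡ε = begin
        prod A                                       ≡⟨ prod-++ (replicate (ord g ∸ 1) g) two ⟩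
        prod (replicate (ord g ∸ 1) g) ∙ (h ∙ (h ⁻¹ ∙ g ∙ ε))
          ≡⟨ cong₂ _∙_ (prod-replicate (ord g ∸ 1) g) (cong (h ∙_) (identityʳ _)) ⟩
        g ^ (ord g ∸ 1) ∙ (h ∙ (h ⁻¹ ∙ g))           ≡⟨ cong (g ^ (ord g ∸ 1) ∙_) (sym (assoc h _ g)) ⟩
        g ^ (ord g ∸ 1) ∙ (h ∙ h ⁻¹ ∙ g)             ≡⟨ cong (λ x → g ^ (ord g ∸ 1) ∙ (x ∙ g)) (inverseʳ h) ⟩
        g ^ (ord g ∸ 1) ∙ (ε ∙ g)                    ≡⟨ cong (g ^ (ord g ∸ 1) ∙_) (identityˡ g) ⟩
        g ^ (ord g ∸ 1) ∙ g                          ≡⟨ ^-suc g (ord g ∸ 1) ⟨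
        g ^ suc (ord g ∸ 1)                          ≡⟨ cong (g ^_) (suc-pred-ord g) ⟩
        g ^ ord g                                    ≡⟨ g^ord≡ε g ⟩
        ε                                            ∎
        where open ≡-Reasoning

      terms : All (λ u → u ≡ g ⊎ ¬ IsPower g u) A
      terms = All.++⁺ (All.replicate⁺ (ord g ∸ 1) (inj₁ refl)) (inj₂ h∉⟨g⟩ ∷ inj₂ h⁻¹g∉⟨g⟩ ∷ [])

      weightA : weight A ≡ 2
      weightA = trans (weight-++ (replicate (ord g ∸ 1) g) two) (cong₂ _+_
        (trans (weight-replicate (ord g ∸ 1) g) (trans (cong ((ord g ∸ 1) *_) (outside-yes (1 , identityʳ g))) (*-zeroʳ (ord g ∸ 1))))
        (cong₂ _+_ (outside-no h∉⟨g⟩) (cong (_+ 0) (outside-no h⁻¹g∉⟨g⟩))))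

      weight≤length : ∀ S → weight S ≤ length S
      weight≤length [] = z≤n
      weight≤length (u ∷ S) with isPower? g u
      ... | yes _ = m≤n⇒m≤1+n (weight≤length S)
      ... | no  _ = s≤s (weight≤length S)

      lengthA : length A ≡ ord g + 1
      lengthA = trans (length-++ (replicate (ord g ∸ 1) g))
        (trans (cong (_+ 2) (length-replicate (ord g ∸ 1)))
          (trans (+-suc (ord g ∸ 1) 1) (cong (_+ 1) (suc-pred-ord g))))

      no-power-part : ∀ {S T} → ProductOne S → S ≢ [] → A ↭ S ++ T → weight S ≢ 0
      no-power-part {S} {T} (S′ , q , S≡ε) neS p S≡0 = <⇒≱ tooShort
        (proj₂ (proj₂ (order g)) (length S) (0<length neS ,
          trans (sym (prod-replicate (length S) g)) (trans (cong prod (sym S′≡)) S≡ε)))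
        where
        all-g : ∀ {S} → All (λ u → u ≡ g ⊎ ¬ IsPower g u) S → All (IsPower g) S → All (_≡ g) S
        all-g [] [] = []
        all-g (inj₁ eq ∷ ts) (_ ∷ ps) = eq ∷ all-g ts ps
        all-g (inj₂ ¬p ∷ _) (p ∷ _) = contradiction p ¬p
        S′≡ : S′ ≡ replicate (length S) g
        S′≡ = trans (all-≡⇒replicate (↭.All-resp-↭ q (all-g (All.++⁻ˡ S (↭.All-resp-↭ p terms)) (none-outside S S≡0))))
                    (cong (λ n → replicate n g) (sym (↭.↭-length q)))
        2≤T : 2 ≤ length T
        2≤T = subst (_≤ length T) (trans (cong (_+ weight T) (sym S≡0))
          (trans (sym (weight-++ S T)) (trans (sym (weight-↭ p)) weightA))) (weight≤length T)
        tooShort : length S < ord g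
        tooShort = +-cancelʳ-≤ 1 _ _ (begin
          suc (length S) + 1   ≡⟨ trans (+-comm _ 1) (+-comm 2 (length S)) ⟩
          length S + 2         ≤⟨ +-monoʳ-≤ (length S) 2≤T ⟩
          length S + length T  ≡⟨ trans (sym (length-++ S)) (trans (sym (↭.↭-length p)) lengthA) ⟩
          ord g + 1            ∎)
          where open ≤-Reasoning

      irreducible : ¬ Splits A
      irreducible (S , T , pS@(S′ , q , S≡ε) , neS , pT , neT , p)
        with weight S in eqS | weight T in eqT
           | trans (sym (weight-++ S T)) (trans (sym (weight-↭ p)) weightA)
      ... | 0 | _ | _ = no-power-part pS neS p eqS
      ... | suc _ | 0 | _ = no-power-part pT neT (↭-trans p (↭.++-comm S T)) eqT
      ... | 1 | suc _ | _ = one-outside S′ (trans (sym (weight-↭ q)) eqS) (0 , sym S≡ε)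
      ... | suc (suc m) | suc n | eq =
        contradiction (trans (sym (+-suc m n)) (suc-injective (suc-injective eq))) λ ()

    long-atom-outside : ∃[ S ] (Atom S × length S ≡ ord g + 1)
    long-atom-outside = A , (productOne A≡ε , ne , irreducible) , lengthA
      where
      ne : A ≢ []
      ne eq = contradiction (++-conicalʳ (replicate (ord g ∸ 1) g) _ eq) λ ()

  powers⇒cyclic : ∀ g → (∀ h → IsPower g h) → IsCyclic
  powers⇒cyclic g all = g , λ {h} _ → subst (_∈ ⟨ ｛ g ｝ ⟩) (proj₂ (all h)) (power (proj₁ (all h)))
    where
    power : ∀ i → g ^ i ∈ ⟨ ｛ g ｝ ⟩
    power zero    = identity
    power (suc i) = product (generator refl) (power i)

  D≤ord⇒cyclic : ∀ {D} → IsDavenport U D → ∀ g → D ≤ ord g → IsCyclic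
  D≤ord⇒cyclic dav g D≤k with ∀? (isPower? g)
  ... | inj₁ all = powers⇒cyclic g all
  ... | inj₂ (h , h∉) with S , at , eq ← long-atom-outside g h h∉ =
    contradiction (≤-trans (atom-length≤D dav at) D≤k) (<⇒≱ (subst (ord g <_) (trans (+-comm 1 _) (sym eq)) ≤-refl))

  -- Each term `g ≢ ε` contributes `ord g ∸ 1 ≥ 1` terms to the complement, so the lengths can agree
  -- only if all orders are 2.
  length≤length-complement : ∀ S → ε ∉ˡ S → length S ≤ length (complement S)
  involutions : ∀ S → ε ∉ˡ S → length (complement S) ≤ length S → All (λ g → IsOrder g 2) S

  2≤ord : ∀ {g} → g ≢ ε → 2 ≤ ord g
  2≤ord {g} g≢ε = ≰⇒> λ k≤1 → g≢ε (ord≡1⇒≡ε g k≤1)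

  length-complement : ∀ g S → length (complement (g ∷ S)) ≡ length (complement S) + (ord g ∸ 1)
  length-complement g S = trans (length-++ (complement S)) (cong (length (complement S) +_) (length-replicate (ord g ∸ 1)))

  length≤length-complement [] _ = z≤n
  length≤length-complement (g ∷ S) ε∉ = subst₂ _≤_ (+-comm (length S) 1) (sym (length-complement g S))
    (+-mono-≤ (length≤length-complement S (ε∉ ∘ there)) (∸-monoˡ-≤ 1 (2≤ord λ { refl → ε∉ (here refl) })))

  involutions [] _ _ = []
  involutions (g ∷ S) ε∉ le =
    subst (IsOrder g) (≤-antisym k≤2 2≤k) (proj₂ (order g)) ∷
    involutions S (ε∉ ∘ there) (+-cancelʳ-≤ 1 _ _ (begin
      length (complement S) + 1             ≤⟨ +-monoʳ-≤ (length (complement S)) (∸-monoˡ-≤ 1 2≤k) ⟩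
      length (complement S) + (ord g ∸ 1)   ≤⟨ le′ ⟩
      1 + length S                          ≡⟨ +-comm 1 _ ⟩
      length S + 1                          ∎))
    where
    open ≤-Reasoning
    2≤k : 2 ≤ ord g
    2≤k = 2≤ord λ { refl → ε∉ (here refl) }
    le′ : length (complement S) + (ord g ∸ 1) ≤ 1 + length S
    le′ = subst (_≤ 1 + length S) (length-complement g S) le
    k≤2 : ord g ≤ 2
    k≤2 = subst (_≤ 2) (suc-pred-ord g) (s≤s (+-cancelˡ-≤ (length S) _ _ (begin
      length S + (ord g ∸ 1)               ≤⟨ +-monoˡ-≤ (ord g ∸ 1) (length≤length-complement S (ε∉ ∘ there)) ⟩
      length (complement S) + (ord g ∸ 1)  ≤⟨ le′ ⟩
      1 + length S                         ≡⟨ +-comm 1 _ ⟩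
      length S + 1                         ∎)))

  InvolutionAtom : Pred Carrier ℓ → Pred Sequence _
  InvolutionAtom G₀ S = All G₀ S × OrderedAtom S × All (λ g → IsOrder g 2) S

  extremal : ∀ {G₀ : Pred Carrier ℓ} {D d} → IsDavenport U D → D ≤ 2 + d → IsMin (Δ G₀) d →
             IsCyclic ⊎ (∃[ S ] (InvolutionAtom G₀ S × length S ≡ D))
  extremal {D = D} {d} dav D≤2+d min
    with 0<d , divisible , A , k , over , f , f′ ← minΔ⇒ min
    with longOrder⊎longAtom divisible k d 0<d over f f′
  ... | inj₁ (g , long) = inj₁ (D≤ord⇒cyclic dav g (≤-trans D≤2+d long))
  ... | inj₂ (S , l , S-over , at , ε∉S , 0<l , f″ , d+1+l≤S) =
    inj₂ (S , (S-over , at , involutions S ε∉S complement≤S) , S≡D)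
    where
    S≡D : length S ≡ D
    S≡D = ≤-antisym (atom-length≤D dav (proj₁ at)) (≤-trans D≤2+d
      (≤-trans (≤-trans (≤-reflexive (+-comm 2 d)) (+-monoʳ-≤ d (s≤s 0<l))) d+1+l≤S))
    l≡1 : l ≡ 1
    l≡1 = ≤-antisym (ℕ.s≤s⁻¹ (+-cancelˡ-≤ d _ _ (≤-trans d+1+l≤S
      (≤-trans (≤-reflexive S≡D) (≤-trans D≤2+d (≤-reflexive (+-comm 2 d))))))) 0<l
    -- A complement that is a single atom has at most `D` terms, and `D` is the length of `S`.
    single : ∀ {k} → k ≡ 1 → Factorization (complement S) k → length (complement S) ≤ length S
    single refl (W ∷ [] , _ , (W-atom , _) ∷ [] , p) = begin
      length (complement S)   ≡⟨ ↭.↭-length (↭-trans p (↭-reflexive (++-identityʳ W))) ⟩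
      length W                ≤⟨ atom-length≤D dav W-atom ⟩
      D                       ≡⟨ S≡D ⟨
      length S                ∎
      where open ≤-Reasoning
    complement≤S : length (complement S) ≤ length S
    complement≤S = single l≡1 f″

  -- Subgroups generated by a set

  module Span {X : Pred Carrier 0ℓ} (X? : Decidable X) where

    InSpan : Pred Carrier a
    InSpan h = ∃[ L ] (All X L × prod L ≡ h)

    shorter : ∀ A B C → B ≢ [] → length (A ++ C) < length (A ++ B ++ C)
    shorter A B C neB = subst₂ _<_ (sym (length-++ A)) (sym (trans (length-++ A) (cong (length A +_) (length-++ B))))
      (+-monoʳ-< (length A) (m<n+m (length C) (0<length neB)))

    -- A word longer than `∣G∣` repeats a prefix product and hence contains a block of product one,
    -- which is dropped. Thus membership in the span is a bounded search.
    shorten : ∀ L → Acc _<_ (length L) → All X L → ∃[ L′ ] (length L′ ≤ ∣G∣ × All X L′ × prod L′ ≡ prod L)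
    shorten L (acc rec) over with length L ℕ.≤? ∣G∣
    ... | yes le = L , le , over , refl
    ... | no ≰
      with i , j , i<j , eq ← collision (λ i → prod (take (toℕ i) L)) (≰⇒> ≰)
      with A , B , C , refl , _ , neB , B≡ε ← cut L (toℕ i) (toℕ j) i<j (<⇒≤ (Fin.toℕ<n j)) eq
      with L′ , le , over′ , eq′ ← shorten (A ++ C) (rec (shorter A B C neB))
             (All.++⁺ (All.++⁻ˡ A over) (All.++⁻ʳ B (All.++⁻ʳ A over)))
      = L′ , le , over′ , trans eq′ (trans (prod-++ A C) (sym (trans (prod-++ A (B ++ C))
          (cong (prod A ∙_) (trans (prod-++ B C) (trans (cong (_∙ prod C) B≡ε) (identityˡ _)))))))

    inSpan? : Decidable InSpan
    inSpan? h = map′ (λ (L , _ , over , eq) → L , over , eq)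
      (λ (L , over , eq) → let L′ , le , over′ , eq′ = shorten L (<-wellFounded _) over
                           in L′ , le , over′ , trans eq′ eq)
      (∃List≤? (λ L → All.all? X? L ×-dec (prod L ≟ h)) ∣G∣)

    -- `True` brings the subgroup down to level `0ℓ`, as required of `G₁`.
    Generated : Pred Carrier 0ℓ
    Generated h = True (inSpan? h)

    X⊆Generated : X ⊆ Generated
    X⊆Generated {g} g∈X = fromWitness ([ g ] , g∈X ∷ [] , identityʳ g)

    generated-isSubgroup : IsSubgroup Generated
    generated-isSubgroup = fromWitness ([] , [] , refl) , closed-∙ , closed-⁻¹
      where
      closed-∙ : ∀ {g h} → g ∈ Generated → h ∈ Generated → g ∙ h ∈ Generated
      closed-∙ g∈ h∈ = let L , over , eq = toWitness g∈
                           M , over′ , eq′ = toWitness h∈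
                       in fromWitness (L ++ M , All.++⁺ over over′ , trans (prod-++ L M) (cong₂ _∙_ eq eq′))
      closed-⁻¹ : ∀ {g} → g ∈ Generated → g ⁻¹ ∈ Generated
      closed-⁻¹ {g} g∈ = let L , over , eq = toWitness g∈ in
        fromWitness (concat (replicate (ord g ∸ 1) L) , all-concat-replicate (ord g ∸ 1) over ,
          trans (prod-concat-replicate (ord g ∸ 1) L) (trans (cong (_^ (ord g ∸ 1)) eq)
            (inverseʳ-unique g _ (trans (cong (g ^_) (suc-pred-ord g)) (g^ord≡ε g)))))

    Generated⊆⟨X⟩ : Generated ⊆ ⟨ X ⟩
    Generated⊆⟨X⟩ h∈ with L , over , refl ← toWitness h∈ = go over
      where
      go : ∀ {L} → All X L → prod L ∈ ⟨ X ⟩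
      go []           = identity
      go (g∈X ∷ over) = product (generator g∈X) (go over)

    ⟨X⟩⊆Generated : ⟨ X ⟩ ⊆ Generated
    ⟨X⟩⊆Generated (generator g∈X) = X⊆Generated g∈X
    ⟨X⟩⊆Generated identity = proj₁ generated-isSubgroup
    ⟨X⟩⊆Generated (product p q) = proj₁ (proj₂ generated-isSubgroup) (⟨X⟩⊆Generated p) (⟨X⟩⊆Generated q)
    ⟨X⟩⊆Generated (inverse p) = proj₂ (proj₂ generated-isSubgroup) (⟨X⟩⊆Generated p)

  -- The subgroup generated by the terms of `S` still contains the atom `S` of length `D`, and its
  -- atoms are atoms of `G`.
  involution-subgroup : ∀ {G₀ : Pred Carrier ℓ} {D S} → IsDavenport U D → InvolutionAtom G₀ S → length S ≡ D →
    ∃[ G₁ ] (Decidable {ℓ = 0ℓ} G₁ × IsSubgroup G₁ × IsDavenport G₁ D × GeneratedByInvolutions G₁)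
  involution-subgroup {D = D} {S} dav (_ , (at , _) , invs) eq =
    Generated , (λ h → T? _) , generated-isSubgroup ,
    ((S , atom⇒𝓐 (All.tabulate λ g∈S → X⊆Generated (fromWitness g∈S)) at , eq) ,
     λ { _ (T , T-atom , refl) → atom-length≤D dav (proj₂ (𝓐⇒atom T-atom)) }) ,
    (λ g → True (Any.any? (g ≟_) S)) , (λ g g∈S → All.lookup invs (toWitness g∈S)) ,
    Generated⊆⟨X⟩ , ⟨X⟩⊆Generated
    where
    open Span {X = λ g → True (Any.any? (g ≟_) S)} (λ g → T? _)

  -- Sequences over two elements

  -- A factorization into `k` atoms makes the weight congruent to `k * c` modulo `c * d`. As the
  -- weight depends on the sequence only, `c * d` divides `c * e`, and `c` cancels.
  weight⇒dividesDistances : ∀ {G₀ : Pred Carrier ℓ} (w : Carrier → ℕ) c d → 0 < c →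
    (∀ S → All G₀ S → Atom S → ∃[ q ] Weight.weight w S ≡ c + q * (c * d)) → DividesDistances G₀ d
  weight⇒dividesDistances {G₀ = G₀} w c d 0<c atom-weight {A} k e over f f′ =
    finish (total over f) (total over f′)
    where
    open Weight w
    open ≡-Reasoning
    instance _ = >-nonZero 0<c
    rearrange : ∀ k c Q′ d e → k * c + c * (Q′ * d + e) ≡ (k + e) * c + Q′ * (c * d)
    rearrange = solve-∀
    swap : ∀ Q c d → Q * (c * d) ≡ c * (Q * d)
    swap = solve-∀
    collect : ∀ k q Q c d → (c + q * (c * d)) + (k * c + Q * (c * d)) ≡ c + k * c + (q + Q) * (c * d)
    collect = solve-∀
    go : ∀ Us → All G₀ (concat Us) → All OrderedAtom Us →
         ∃[ Q ] weight (concat Us) ≡ length Us * c + Q * (c * d)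
    go [] _ _ = 0 , refl
    go (V ∷ Us) over ((at , _) ∷ ats)
      with q , eq ← atom-weight V (All.++⁻ˡ V over) at | Q , eq′ ← go Us (All.++⁻ʳ V over) ats
      = q + Q , trans (weight-++ V (concat Us)) (trans (cong₂ _+_ eq eq′) (collect (length Us) q Q c d))
    total : ∀ {A l} → All G₀ A → Factorization A l → ∃[ Q ] weight A ≡ l * c + Q * (c * d)
    total over (Us , refl , ats , p) with Q , eq ← go Us (↭.All-resp-↭ p over) ats = Q , trans (weight-↭ p) eq
    finish : ∃[ Q ] weight A ≡ k * c + Q * (c * d) → ∃[ Q ] weight A ≡ (k + e) * c + Q * (c * d) → d ∣ e
    finish (Q , eq) (Q′ , eq′) = ∣m+n∣m⇒∣n {d} {Q′ * d} {e}
      (divides Q (*-cancelˡ-≡ _ _ c (+-cancelˡ-≡ (k * c) _ _ (begin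
        k * c + c * (Q′ * d + e)        ≡⟨ rearrange k c Q′ d e ⟩
        (k + e) * c + Q′ * (c * d)      ≡⟨ trans (sym eq′) eq ⟩
        k * c + Q * (c * d)             ≡⟨ cong (k * c +_) (swap Q c d) ⟩
        k * c + c * (Q * d)             ∎)))) (n∣m*n Q′)

  -- `True` places this subset at level `0ℓ`, where `Δ*` looks for `G₀`.
  Pair : Carrier → Carrier → Pred Carrier 0ℓ
  Pair x y u = True ((u ≟ x) ⊎-dec (u ≟ y))

  -- Products depend on the order of the letters, so words over two letters are coded by lists of
  -- Booleans, whose `trues` and `falses` become the exponents after sorting.
  decode : Carrier → Carrier → List Bool → Sequence
  decode x y = map λ b → if b then x else y

  trues falses : List Bool → ℕ
  trues [] = 0
  trues (true ∷ C) = suc (trues C)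
  trues (false ∷ C) = trues C
  falses [] = 0
  falses (true ∷ C) = falses C
  falses (false ∷ C) = suc (falses C)

  infix 8 _^^_
  _^^_ : Carrier → ℕ → Sequence
  x ^^ k = replicate k x

  encode : ∀ {x y S} → All (λ u → u ≡ x ⊎ u ≡ y) S → ∃[ C ] S ≡ decode x y C
  encode [] = [] , refl
  encode (inj₁ refl ∷ us) with C , refl ← encode us = true ∷ C , refl
  encode (inj₂ refl ∷ us) with C , refl ← encode us = false ∷ C , refl

  decode-↭ : ∀ x y C → decode x y C ↭ x ^^ trues C ++ y ^^ falses C
  decode-↭ x y [] = ↭-refl
  decode-↭ x y (true ∷ C) = prep x (decode-↭ x y C)
  decode-↭ x y (false ∷ C) = ↭-trans (prep y (decode-↭ x y C)) (↭-sym (↭.shift y (x ^^ trues C) _))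

  sort-pair : ∀ {x y S} → All (λ u → u ≡ x ⊎ u ≡ y) S → ∃₂ λ i j → S ↭ x ^^ i ++ y ^^ j
  sort-pair us with C , refl ← encode us = trues C , falses C , decode-↭ _ _ C

  replicate-+ : ∀ i j (x : Carrier) → x ^^ (i + j) ≡ x ^^ i ++ x ^^ j
  replicate-+ zero    j x = refl
  replicate-+ (suc i) j x = cong (x ∷_) (replicate-+ i j x)

  pair-++ : ∀ x y i j i′ j′ → x ^^ (i + i′) ++ y ^^ (j + j′) ↭ (x ^^ i ++ y ^^ j) ++ (x ^^ i′ ++ y ^^ j′)
  pair-++ x y i j i′ j′ = begin
    x ^^ (i + i′) ++ y ^^ (j + j′)              ≡⟨ cong₂ _++_ (replicate-+ i i′ x) (replicate-+ j j′ y) ⟩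
    (x ^^ i ++ x ^^ i′) ++ (y ^^ j ++ y ^^ j′)  ≡⟨ ++-assoc (x ^^ i) _ _ ⟩
    x ^^ i ++ x ^^ i′ ++ y ^^ j ++ y ^^ j′      ↭⟨ ↭.++⁺ˡ (x ^^ i) (↭.shifts (x ^^ i′) (y ^^ j)) ⟩
    x ^^ i ++ y ^^ j ++ x ^^ i′ ++ y ^^ j′      ≡⟨ ++-assoc (x ^^ i) _ _ ⟨
    (x ^^ i ++ y ^^ j) ++ (x ^^ i′ ++ y ^^ j′)  ∎
    where open PermutationReasoning

  concat-replicate-pair : ∀ x y i j m → concat (replicate m (x ^^ i ++ y ^^ j)) ↭ x ^^ (m * i) ++ y ^^ (m * j)
  concat-replicate-pair x y i j zero = ↭-refl
  concat-replicate-pair x y i j (suc m) =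
    ↭-trans (↭.++⁺ˡ (x ^^ i ++ y ^^ j) (concat-replicate-pair x y i j m)) (↭-sym (pair-++ x y i j (m * i) (m * j)))

  prod-pair : ∀ x y i j → prod (x ^^ i ++ y ^^ j) ≡ x ^ i ∙ y ^ j
  prod-pair x y i j = trans (prod-++ (x ^^ i) (y ^^ j)) (cong₂ _∙_ (prod-replicate i x) (prod-replicate j y))

  pair-nonempty : ∀ {x y} i j → 0 < i + j → x ^^ i ++ y ^^ j ≢ []
  pair-nonempty zero    (suc j) _ ()
  pair-nonempty (suc i) j       _ ()

  pair-splits : ∀ {x y} i j i′ j′ → ProductOne (x ^^ i ++ y ^^ j) → ProductOne (x ^^ i′ ++ y ^^ j′) →
                0 < i + j → 0 < i′ + j′ → Splits (x ^^ (i + i′) ++ y ^^ (j + j′))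
  pair-splits i j i′ j′ p q 0<ij 0<i′j′ =
    _ , _ , p , pair-nonempty i j 0<ij , q , pair-nonempty i′ j′ 0<i′j′ , pair-++ _ _ i j i′ j′

  weight-pair : ∀ w x y i j → Weight.weight w (x ^^ i ++ y ^^ j) ≡ i * w x + j * w y
  weight-pair w x y i j = trans (weight-++ (x ^^ i) (y ^^ j)) (cong₂ _+_ (weight-replicate i x) (weight-replicate j y))
    where open Weight w

  mark : Carrier → Carrier → ℕ
  mark x u = if does (u ≟ x) then 1 else 0

  mark-≡ : ∀ x → mark x x ≡ 1
  mark-≡ x with x ≟ x
  ... | yes _ = refl
  ... | no ne = contradiction refl ne

  mark-≢ : ∀ {x u} → u ≢ x → mark x u ≡ 0
  mark-≢ {x} {u} ne with u ≟ x
  ... | yes eq = contradiction eq ne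
  ... | no _ = refl

  pair-injective : ∀ {x y i j k l} → x ≢ y → x ^^ i ++ y ^^ j ↭ x ^^ k ++ y ^^ l → i ≡ k × j ≡ l
  pair-injective {x} {y} {i} {j} {k} {l} x≢y p =
    subst₂ _≡_ (first i j) (first k l) (Weight.weight-↭ (mark x) p) ,
    subst₂ _≡_ (second i j) (second k l) (Weight.weight-↭ (mark y) p)
    where
    first : ∀ i j → Weight.weight (mark x) (x ^^ i ++ y ^^ j) ≡ i
    first i j = trans (weight-pair (mark x) x y i j) (trans (cong₂ _+_
      (trans (cong (i *_) (mark-≡ x)) (*-identityʳ i))
      (trans (cong (j *_) (mark-≢ (x≢y ∘ sym))) (*-zeroʳ j))) (+-identityʳ i))
    second : ∀ i j → Weight.weight (mark y) (x ^^ i ++ y ^^ j) ≡ j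
    second i j = trans (weight-pair (mark y) x y i j) (cong₂ _+_
      (trans (cong (i *_) (mark-≢ x≢y)) (*-zeroʳ i))
      (trans (cong (j *_) (mark-≡ y)) (*-identityʳ j)))

  splits-pair : ∀ {x y i j} → x ≢ y → Splits (x ^^ i ++ y ^^ j) →
    ∃[ i₁ ] ∃[ j₁ ] ∃[ i₂ ] ∃[ j₂ ] (i₁ + i₂ ≡ i × j₁ + j₂ ≡ j × 0 < i₁ + j₁ × 0 < i₂ + j₂ ×
      ProductOne (x ^^ i₁ ++ y ^^ j₁) × ProductOne (x ^^ i₂ ++ y ^^ j₂))
  splits-pair {x} {y} {i} {j} x≢y (S , T , pS , neS , pT , neT , p)
    with over ← ↭.All-resp-↭ p (All.++⁺ {P = λ u → u ≡ x ⊎ u ≡ y} (All.replicate⁺ i (inj₁ refl)) (All.replicate⁺ j (inj₂ refl)))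
    with i₁ , j₁ , p₁ ← sort-pair (All.++⁻ˡ S over) | i₂ , j₂ , p₂ ← sort-pair (All.++⁻ʳ S over)
    with refl , refl ← pair-injective {i = i} {j} {i₁ + i₂} {j₁ + j₂} x≢y
           (↭-trans p (↭-trans (↭.++⁺ p₁ p₂) (↭-sym (pair-++ x y i₁ j₁ i₂ j₂))))
    = i₁ , j₁ , i₂ , j₂ , refl , refl , positive i₁ j₁ p₁ neS , positive i₂ j₂ p₂ neT ,
      productOne-↭ p₁ pS , productOne-↭ p₂ pT
    where
    positive : ∀ {S} i j → S ↭ x ^^ i ++ y ^^ j → S ≢ [] → 0 < i + j
    positive zero zero p ne = contradiction (↭.↭-empty-inv p) ne
    positive zero (suc j) _ _ = s≤s z≤n
    positive (suc i) j _ _ = s≤s z≤n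

  -- The distances ord(g) - 2 and 1

  inverse-pair-atom : ∀ {g} → g ≢ ε → Atom (g ∷ g ⁻¹ ∷ [])
  inverse-pair-atom {g} g≢ε = atom-length≤3 (productOne (trans (cong (g ∙_) (identityʳ _)) (inverseʳ g))) (λ ())
    (λ { (here eq) → g≢ε (sym eq)
       ; (there (there ()))
       ; (there (here eq)) → g≢ε (trans (sym (⁻¹-involutive g)) (trans (cong _⁻¹ (sym eq)) ε⁻¹≈ε)) })
    (s≤s (s≤s z≤n))

  order-⁻¹ : ∀ {g k} → IsOrder g k → IsOrder (g ⁻¹) k
  order-⁻¹ {g} {k} ((0<k , gᵏ≡ε) , k-min) =
    (0<k , trans (⁻¹-^ g k) (trans (cong _⁻¹ gᵏ≡ε) ε⁻¹≈ε)) , λ x (0<x , eq) →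
      k-min x (0<x , trans (sym (⁻¹-involutive _)) (trans (cong _⁻¹ (trans (sym (⁻¹-^ g x)) eq)) ε⁻¹≈ε))

  Δ*-intro : ∀ {d A k} {G₀ : Pred Carrier 0ℓ} → Decidable G₀ → 0 < d → DividesDistances G₀ d →
             All G₀ A → Factorization A k → Factorization A (k + d) → d ∈ Δ*
  Δ*-intro {G₀ = G₀} G₀? 0<d divisible over f f′ = G₀ , G₀? , minΔ⇐ 0<d divisible over f f′

  inverse-pair-factorization : ∀ {g} → g ≢ ε → ∀ k → Factorization (g ^^ k ++ (g ⁻¹) ^^ k) k
  inverse-pair-factorization {g} g≢ε zero = [] , refl , [] , ↭-refl
  inverse-pair-factorization {g} g≢ε (suc k) =
    factorization-↭ (prep g (↭-sym (↭.shift (g ⁻¹) (g ^^ k) _)))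
      (factorization-++ (factorization-atom (inverse-pair-atom g≢ε)) (inverse-pair-factorization g≢ε k))

  pair-terms : ∀ {x y S} → All (Pair x y) S → All (λ u → u ≡ x ⊎ u ≡ y) S
  pair-terms = All.map toWitness

  module _ {g k} (g-order : IsOrder g k) (3≤k : 3 ≤ k) where

    private
      0<k = proj₁ (proj₁ g-order)

      g^i≢ε : ∀ i → 0 < i → i < k → g ^ i ≢ ε
      g^i≢ε i 0<i i<k eq = <⇒≱ i<k (proj₂ g-order i (0<i , eq))

      g≢ε : g ≢ ε
      g≢ε g≡ε = g^i≢ε 1 (s≤s z≤n) (≤-trans (s≤s (s≤s z≤n)) 3≤k) (trans (identityʳ g) g≡ε)

      g≢g⁻¹ : g ⁻¹ ≢ g
      g≢g⁻¹ eq = g^i≢ε 2 (s≤s z≤n) 3≤k (trans (cong (g ∙_) (trans (identityʳ g) (sym eq))) (inverseʳ g))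

      -- Here c = k and d = k - 2: the atoms gᵏ and g g⁻¹ have weight k, and (g⁻¹)ᵏ has weight k (k
      -- - 1) = k + k (k - 2). The difference k - 2 itself occurs in gᵏ (g⁻¹)ᵏ = (g g⁻¹)ᵏ.
      w : Carrier → ℕ
      w u = if does (u ≟ g) then 1 else k ∸ 1

      w-g : w g ≡ 1
      w-g with g ≟ g
      ... | yes _ = refl
      ... | no ne = contradiction refl ne

      w-g⁻¹ : w (g ⁻¹) ≡ k ∸ 1
      w-g⁻¹ with g ⁻¹ ≟ g
      ... | yes eq = contradiction eq g≢g⁻¹
      ... | no _ = refl

      prod-decode : ∀ C → prod (decode g (g ⁻¹) C) ≡ g ^ trues C ∙ (g ⁻¹) ^ falses C
      prod-decode [] = sym (identityʳ ε)
      prod-decode (true ∷ C) = trans (cong (g ∙_) (prod-decode C)) (sym (assoc g _ _))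
      prod-decode (false ∷ C) = begin
        g ⁻¹ ∙ prod (decode g (g ⁻¹) C)              ≡⟨ cong (g ⁻¹ ∙_) (prod-decode C) ⟩
        g ⁻¹ ∙ (g ^ trues C ∙ (g ⁻¹) ^ falses C)     ≡⟨ assoc _ _ _ ⟨
        g ⁻¹ ∙ g ^ trues C ∙ (g ⁻¹) ^ falses C       ≡⟨ cong (_∙ (g ⁻¹) ^ falses C) (commute-^ (trans (inverseˡ g) (sym (inverseʳ g))) (trues C)) ⟩
        g ^ trues C ∙ g ⁻¹ ∙ (g ⁻¹) ^ falses C       ≡⟨ assoc _ _ _ ⟩
        g ^ trues C ∙ (g ⁻¹ ∙ (g ⁻¹) ^ falses C)     ∎
        where
        open ≡-Reasoning

      -- If both letters occur, one pair g g⁻¹ can be removed, so the atom is this pair. Otherwise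
      -- it is a power of one letter, whose exponent is a multiple of k and hence k.
      atom-weight : ∀ S → All (Pair g (g ⁻¹)) S → Atom S → ∃[ q ] Weight.weight w S ≡ k + q * (k * (k ∸ 2))
      atom-weight S over at
        with T , p , (_ , _ , ¬s) , T≡ε ← orderedAtom at
        with C , refl ← encode (pair-terms {x = g} {g ⁻¹} (↭.All-resp-↭ p over))
        = go (trues C) (falses C) (↭-trans p (decode-↭ g (g ⁻¹) C)) (trans (sym (prod-decode C)) T≡ε)
        where
        weight≡ : ∀ {i j} → S ↭ g ^^ i ++ (g ⁻¹) ^^ j → Weight.weight w S ≡ i + j * (k ∸ 1)
        weight≡ {i} {j} p = trans (Weight.weight-↭ w p) (trans (weight-pair w g (g ⁻¹) i j)
          (cong₂ _+_ (trans (cong (i *_) w-g) (*-identityʳ i)) (cong (j *_) w-g⁻¹)))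
        ¬splits : ∀ i j → S ↭ g ^^ i ++ (g ⁻¹) ^^ j → ¬ Splits (g ^^ i ++ (g ⁻¹) ^^ j)
        ¬splits i j p s = proj₂ (proj₂ at) (splits-↭ (↭-sym p) s)
        multiple≡1 : ∀ i → k ∣ i → 0 < i → (∀ j → j + k ≡ i → ¬ (0 < j)) → i ≡ k
        multiple≡1 i k∣i 0<i none = ≤-antisym (≮⇒≥ λ k<i → none (i ∸ k) (m∸n+n≡m (<⇒≤ k<i)) (m<n⇒0<n∸m k<i))
                                            (∣⇒≤ {{>-nonZero 0<i}} k∣i)
        ⁻-order = order-⁻¹ g-order
        k-2+1 : ∀ k → 2 ≤ k → k * (k ∸ 1) ≡ k + 1 * (k * (k ∸ 2))
        k-2+1 (suc zero) (s≤s ())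
        k-2+1 (suc (suc k)) _ = lemma k
          where
          lemma : ∀ k → suc (suc k) * suc k ≡ suc (suc k) + 1 * (suc (suc k) * k)
          lemma = solve-∀
        removable : ∀ i j → g ^ suc i ∙ (g ⁻¹) ^ suc j ≡ ε → 0 < i + j → Splits (g ^^ suc i ++ (g ⁻¹) ^^ suc j)
        removable i j eq 0<i+j = pair-splits {g} {g ⁻¹} 1 1 i j (proj₁ (inverse-pair-atom g≢ε))
          (productOne (trans (prod-pair g (g ⁻¹) i j) rest≡ε)) (s≤s z≤n) 0<i+j
          where
          open ≡-Reasoning
          rest≡ε : g ^ i ∙ (g ⁻¹) ^ j ≡ ε
          rest≡ε = begin
            g ^ i ∙ (g ⁻¹) ^ j                ≡⟨ cong (g ^ i ∙_) (identityˡ _) ⟨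
            g ^ i ∙ (ε ∙ (g ⁻¹) ^ j)          ≡⟨ cong (λ x → g ^ i ∙ (x ∙ (g ⁻¹) ^ j)) (inverseʳ g) ⟨
            g ^ i ∙ (g ∙ g ⁻¹ ∙ (g ⁻¹) ^ j)   ≡⟨ cong (g ^ i ∙_) (assoc _ _ _) ⟩
            g ^ i ∙ (g ∙ (g ⁻¹) ^ suc j)      ≡⟨ assoc _ _ _ ⟨
            g ^ i ∙ g ∙ (g ⁻¹) ^ suc j        ≡⟨ cong (_∙ (g ⁻¹) ^ suc j) (^-suc g i) ⟨
            g ^ suc i ∙ (g ⁻¹) ^ suc j        ≡⟨ eq ⟩
            ε                                 ∎
        go : ∀ i j → S ↭ g ^^ i ++ (g ⁻¹) ^^ j → g ^ i ∙ (g ⁻¹) ^ j ≡ ε → _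
        go zero zero p _ = contradiction (↭.↭-empty-inv p) (proj₁ (proj₂ at))
        go (suc i) zero p eq = 0 , trans (weight≡ {suc i} {0} p) (cong (_+ 0) i≡k)
          where
          gⁱ≡ε = trans (sym (identityʳ _)) eq
          i≡k : suc i ≡ k
          i≡k = multiple≡1 (suc i) (order-∣ g-order _ gⁱ≡ε) (s≤s z≤n) λ j j+k≡i 0<j →
            ¬splits (suc i) 0 p (subst (λ i → Splits (g ^^ i ++ [])) j+k≡i (pair-splits {g} {g ⁻¹} j 0 k 0
              (productOne (trans (prod-pair g (g ⁻¹) j 0) (trans (identityʳ _)
                (trans (sym (trans (^-+ g j k) (trans (cong (g ^ j ∙_) (proj₂ (proj₁ g-order))) (identityʳ _))))
                       (trans (cong (g ^_) j+k≡i) gⁱ≡ε)))))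
              (productOne (trans (prod-pair g (g ⁻¹) k 0) (trans (identityʳ _) (proj₂ (proj₁ g-order)))))
              (≤-trans 0<j (m≤m+n j 0)) (≤-trans 0<k (m≤m+n k 0))))
        go zero (suc j) p eq = 1 , trans (weight≡ {0} {suc j} p)
          (trans (cong (_* (k ∸ 1)) j≡k) (k-2+1 k (≤-trans (s≤s (s≤s z≤n)) 3≤k)))
          where
          gʲ≡ε = trans (sym (identityˡ _)) eq
          j≡k : suc j ≡ k
          j≡k = multiple≡1 (suc j) (order-∣ ⁻-order _ gʲ≡ε) (s≤s z≤n) λ i i+k≡j 0<i →
            ¬splits 0 (suc j) p (subst (λ j → Splits ((g ⁻¹) ^^ j)) i+k≡j (pair-splits {g} {g ⁻¹} 0 i 0 k
              (productOne (trans (prod-replicate i (g ⁻¹))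
                (trans (sym (trans (^-+ (g ⁻¹) i k) (trans (cong ((g ⁻¹) ^ i ∙_) (proj₂ (proj₁ ⁻-order))) (identityʳ _))))
                       (trans (cong ((g ⁻¹) ^_) i+k≡j) gʲ≡ε))))
              (productOne (trans (prod-replicate k (g ⁻¹)) (proj₂ (proj₁ ⁻-order)))) 0<i 0<k))
        go (suc i) (suc j) p eq = cancel i j p eq
          where
          cancel : ∀ i j → S ↭ g ^^ suc i ++ (g ⁻¹) ^^ suc j → g ^ suc i ∙ (g ⁻¹) ^ suc j ≡ ε → _
          cancel zero zero p _ = 0 , trans (weight≡ {1} {1} p)
            (trans (cong suc (+-identityʳ _)) (trans (m+[n∸m]≡n 0<k) (sym (+-identityʳ k))))
          cancel zero (suc j) p eq = contradiction (removable zero (suc j) eq (s≤s z≤n)) (¬splits 1 (2 + j) p)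
          cancel (suc i) j p eq = contradiction (removable (suc i) j eq (s≤s z≤n)) (¬splits (2 + i) (suc j) p)

    order∸2∈Δ* : k ∸ 2 ∈ Δ*
    order∸2∈Δ* = Δ*-intro {A = g ^^ k ++ (g ⁻¹) ^^ k} {2} {Pair g (g ⁻¹)} (λ u → T? _) (m<n⇒0<n∸m 3≤k)
      (weight⇒dividesDistances w k (k ∸ 2) 0<k atom-weight)
      (All.++⁺ (All.replicate⁺ k (fromWitness (inj₁ refl))) (All.replicate⁺ k (fromWitness (inj₂ refl))))
      (factorization-++ (factorization-atom (atom-power g-order)) (factorization-atom (atom-power (order-⁻¹ g-order))))
      (factorization-≡ (sym (m+[n∸m]≡n (≤-trans (s≤s (s≤s z≤n)) 3≤k))) (inverse-pair-factorization g≢ε k))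

  ∃-avoiding : 3 ≤ ∣G∣ → ∀ x y → ∃[ h ] (h ≢ x × h ≢ y)
  ∃-avoiding 3≤∣G∣ x y with ∀? (λ h → (x ≟ h) ⊎-dec (y ≟ h))
  ... | inj₂ (h , ¬both) = h , (λ eq → ¬both (inj₁ (sym eq))) , (λ eq → ¬both (inj₂ (sym eq)))
  ... | inj₁ covered = contradiction 3≤∣G∣ (≤⇒≯ (∣G∣≤-image {2} f onto))
    where
    f : Fin 2 → Carrier
    f zero    = x
    f (suc _) = y
    onto : ∀ h → ∃[ i ] f i ≡ h
    onto h with covered h
    ... | inj₁ eq = zero , eq
    ... | inj₂ eq = suc zero , eq

  -- (g h (gh)⁻¹) (h⁻¹ g⁻¹ gh) = (g g⁻¹) (h h⁻¹) (gh (gh)⁻¹).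
  1∈Δ* : 3 ≤ ∣G∣ → 1 ∈ Δ*
  1∈Δ* 3≤∣G∣
    with g , g≢ε , _ ← ∃-avoiding 3≤∣G∣ ε ε
    -- `h ≢ g ⁻¹` ensures `g ∙ h ≢ ε`, so both triples avoid `ε` and are atoms by their length.
    -- Divisibility by 1 is automatic, so `G₀` can be all of `G`.
    with h , h≢ε , h≢g⁻¹ ← ∃-avoiding 3≤∣G∣ ε (g ⁻¹)
    = Δ*-intro {A = S ++ T} {2} {U} (λ _ → yes tt) (s≤s z≤n) (λ k e _ _ _ → divides e (sym (*-identityʳ e)))
        (All.universal (λ _ → tt) (S ++ T))
        (factorization-++ (factorization-atom S-atom) (factorization-atom T-atom))
        (factorization-↭ (↭-sym rearranged)
          (factorization-++ (factorization-atom (inverse-pair-atom g≢ε))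
            (factorization-++ (factorization-atom (inverse-pair-atom h≢ε)) (factorization-atom (inverse-pair-atom gh≢ε)))))
    where
    S T : Sequence
    S = g ∷ h ∷ (g ∙ h) ⁻¹ ∷ []
    T = h ⁻¹ ∷ g ⁻¹ ∷ g ∙ h ∷ []
    gh≢ε : g ∙ h ≢ ε
    gh≢ε eq = h≢g⁻¹ (inverseʳ-unique g h eq)
    ⁻¹≢ε : ∀ {x} → x ≢ ε → x ⁻¹ ≢ ε
    ⁻¹≢ε ne eq = ne (trans (sym (⁻¹-involutive _)) (trans (cong _⁻¹ eq) ε⁻¹≈ε))
    S-atom : Atom S
    S-atom = atom-length≤3 (productOne (trans (sym (assoc g h _)) (trans (cong (g ∙ h ∙_) (identityʳ _)) (inverseʳ _))))
      (λ ()) (λ { (here eq) → g≢ε (sym eq) ; (there (here eq)) → h≢ε (sym eq)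
                ; (there (there (here eq))) → ⁻¹≢ε gh≢ε (sym eq)
                ; (there (there (there ()))) }) ≤-refl
    T-atom : Atom T
    T-atom = atom-length≤3 (productOne (trans (sym (assoc _ _ _)) (trans (cong₂ _∙_ (sym (⁻¹-anti-homo-∙ g h)) (identityʳ _)) (inverseˡ _))))
      (λ ()) (λ { (here eq) → ⁻¹≢ε h≢ε (sym eq) ; (there (here eq)) → ⁻¹≢ε g≢ε (sym eq)
                ; (there (there (here eq))) → gh≢ε (sym eq)
                ; (there (there (there ()))) }) ≤-refl
    rearranged : S ++ T ↭ g ∷ g ⁻¹ ∷ h ∷ h ⁻¹ ∷ g ∙ h ∷ (g ∙ h) ⁻¹ ∷ []
    rearranged = prep g (↭-trans (↭.shift (g ⁻¹) (h ∷ (g ∙ h) ⁻¹ ∷ h ⁻¹ ∷ []) (g ∙ h ∷ []))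
      (prep (g ⁻¹) (prep h (↭-trans (_↭_.swap _ _ ↭-refl) (prep (h ⁻¹) (_↭_.swap _ _ ↭-refl))))))

  -- Atoms consisting of involutions

  involution-∙ : ∀ {g} → IsOrder g 2 → g ∙ g ≡ ε
  involution-∙ {g} ((_ , eq) , _) = trans (cong (g ∙_) (sym (identityʳ g))) eq

  involution-⁻¹ : ∀ {g} → IsOrder g 2 → g ⁻¹ ≡ g
  involution-⁻¹ {g} inv = sym (inverseʳ-unique g g (involution-∙ inv))

  involution-≢ε : ∀ {g} → IsOrder g 2 → g ≢ ε
  involution-≢ε (_ , min) refl = contradiction (min 1 (s≤s z≤n , identityʳ ε)) λ { (s≤s ()) }

  involution : ∀ {g} → g ∙ g ≡ ε → g ≢ ε → IsOrder g 2
  involution {g} eq ne = (s≤s z≤n , trans (cong (g ∙_) (identityʳ g)) eq) , λ where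
    zero (() , _)
    (suc zero) (_ , g≡ε) → contradiction (trans (sym (identityʳ g)) g≡ε) ne
    (suc (suc x)) _ → s≤s (s≤s z≤n)

  squares : ∀ {S} → All (λ g → IsOrder g 2) S → Factorization (S ++ S) (length S)
  squares [] = [] , refl , [] , ↭-refl
  squares {g ∷ S} (inv ∷ invs) = factorization-↭ (prep g (↭-sym (↭.shift g S S)))
    (factorization-++ (factorization-atom (atom-power inv)) (squares invs))

  ∉-involutions : ∀ {S} → All (λ g → IsOrder g 2) S → ε ∉ˡ S
  ∉-involutions invs ε∈S = involution-≢ε (All.lookup invs ε∈S) refl

  ∈⇒length≤ : ∀ {U : Sequence} {Us} → U ∈ˡ Us → length U ≤ length (concat Us)
  ∈⇒length≤ {Us = V ∷ Us} (here refl) = subst (length V ≤_) (sym (length-++ V)) (m≤m+n _ _)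
  ∈⇒length≤ {U} {V ∷ Us} (there U∈Us) =
    subst (length U ≤_) (sym (length-++ V)) (≤-trans (∈⇒length≤ U∈Us) (m≤n+m _ (length V)))

  module _ {G₀ : Pred Carrier ℓ} {d} (divisible : DividesDistances G₀ d) where

    -- S S is also the product of the squares of the terms of S, so 2 and `length S` are lengths of
    -- the same sequence.
    involution-atom-length : ∀ {S} → All G₀ S → All (λ g → IsOrder g 2) S → Atom S →
                             ∃[ e ] (length S ≡ 2 + e × d ∣ e)
    involution-atom-length {S} over invs at = e , length≡ ,
      divisible 2 e (All.++⁺ over over) (factorization-++ (factorization-atom at) (factorization-atom at))
        (factorization-≡ length≡ (squares invs))
      where
      e = length S ∸ 2
      length≡ : length S ≡ 2 + e
      length≡ = sym (m+[n∸m]≡n (2≤atom at (∉-involutions invs)))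

    -- An atom of involutions has length 2 or at least `2 + d`; the latter does not fit into `S`, so
    -- every atom has two terms.
    short-involutions : ∀ {S} → All G₀ S → All (λ g → IsOrder g 2) S → ProductOne S → length S < 2 + d →
                        ∃[ k ] (Factorization S k × k * 2 ≡ length S)
    short-involutions {S} over invs one S<2+d
      with k , Us , refl , atoms , p ← factorization S one
      = length Us , (Us , refl , atoms , p) ,
        trans (sym (lengths Us (All.tabulate λ U∈Us → length≡2 U∈Us))) (sym (↭.↭-length p))
      where
      length≡2 : ∀ {U} → U ∈ˡ Us → length U ≡ 2
      length≡2 {U} U∈Us
        with e , eq , d∣e ← involution-atom-length (All.lookup (All.concat⁻ {xss = Us} (↭.All-resp-↭ p over)) U∈Us)
               (All.lookup (All.concat⁻ {xss = Us} (↭.All-resp-↭ p invs)) U∈Us) (proj₁ (All.lookup atoms U∈Us))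
        with e
      ... | zero = eq
      ... | suc _ = contradiction (≤-trans (s≤s (≤-trans (∈⇒length≤ U∈Us) (≤-reflexive (sym (↭.↭-length p))))) S<2+d)
        (≤⇒≯ (≤-trans (s≤s (s≤s (∣⇒≤ d∣e))) (≤-reflexive (sym eq))))
      lengths : ∀ Us → All (λ U → length U ≡ 2) Us → length (concat Us) ≡ length Us * 2
      lengths [] [] = refl
      lengths (U ∷ Us) (eq ∷ eqs) = trans (length-++ U) (cong₂ _+_ eq (lengths Us eqs))

    -- An atom of two involutions is a square. The atom containing the only `z` is not one, so it
    -- has at least `2 + d` terms.
    single-occurrence : ∀ {z S} → All G₀ (z ∷ S) → All (λ g → IsOrder g 2) (z ∷ S) → prod (z ∷ S) ≡ ε →
                        All (_≢ z) S → 2 + d ≤ length (z ∷ S)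
    single-occurrence {z} {S} over invs one S≢z
      with k , Us , _ , atoms , p ← factorization (z ∷ S) (productOne one)
      with U , z∈U , U∈Us ← ∈-concat⁻′ Us (↭.∈-resp-↭ p (here refl))
      with e , eq , d∣e ← involution-atom-length (All.lookup (All.concat⁻ {xss = Us} (↭.All-resp-↭ p over)) U∈Us)
             (All.lookup (All.concat⁻ {xss = Us} (↭.All-resp-↭ p invs)) U∈Us) (proj₁ (All.lookup atoms U∈Us))
      with e
    ... | suc _ = ≤-trans (s≤s (s≤s (∣⇒≤ d∣e))) (≤-trans (≤-reflexive (sym eq))
                    (≤-trans (∈⇒length≤ U∈Us) (≤-reflexive (sym (↭.↭-length p)))))
    ... | zero = contradiction twice (<⇒≱ once)
      where
      open Weight (mark z)
      weight-∈ : ∀ {Us} → U ∈ˡ Us → weight U ≤ weight (concat Us)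
      weight-∈ {V ∷ Us} (here refl) = subst (weight V ≤_) (sym (weight-++ V _)) (m≤m+n _ _)
      weight-∈ {V ∷ Us} (there U∈Us) =
        subst (weight U ≤_) (sym (weight-++ V _)) (≤-trans (weight-∈ U∈Us) (m≤n+m _ (weight V)))
      weight≡0 : ∀ {S} → All (_≢ z) S → weight S ≡ 0
      weight≡0 [] = refl
      weight≡0 (ne ∷ nes) = cong₂ _+_ (mark-≢ ne) (weight≡0 nes)
      once : weight (concat Us) < 2
      once = s≤s (≤-reflexive (trans (sym (weight-↭ p)) (cong₂ _+_ (mark-≡ z) (weight≡0 S≢z))))
      square : ∀ U → length U ≡ 2 → z ∈ˡ U → prod U ≡ ε → All (λ g → IsOrder g 2) U → weight U ≡ 2
      square (u ∷ v ∷ []) _ z∈U eq (inv-u ∷ inv-v ∷ []) = both z∈U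
        where
        u≡v : u ≡ v
        u≡v = trans (sym (involution-⁻¹ inv-u))
                (sym (inverseʳ-unique u v (trans (cong (u ∙_) (sym (identityʳ v))) eq)))
        both : z ∈ˡ u ∷ v ∷ [] → weight (u ∷ v ∷ []) ≡ 2
        both (here refl) = cong₂ _+_ (mark-≡ z) (cong (_+ 0) (trans (cong (mark z) (sym u≡v)) (mark-≡ z)))
        both (there (here refl)) = cong₂ _+_ (trans (cong (mark z) u≡v) (mark-≡ z)) (cong (_+ 0) (mark-≡ z))
      twice : 2 ≤ weight (concat Us)
      twice = ≤-trans (≤-reflexive (sym (square U eq z∈U (proj₂ (All.lookup atoms U∈Us))
                (All.lookup (All.concat⁻ {xss = Us} (↭.All-resp-↭ p invs)) U∈Us)))) (weight-∈ U∈Us)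

  -- Atoms of ∣G∣ involutions and the dihedral structure

  alternating : Carrier → Carrier → ℕ → Sequence
  alternating x y n = concat (replicate n (x ∷ y ∷ []))

  prod-alternating : ∀ x y n → prod (alternating x y n) ≡ (x ∙ y) ^ n
  prod-alternating x y n = trans (prod-concat-replicate n (x ∷ y ∷ [])) (cong (λ g → (x ∙ g) ^ n) (identityʳ y))

  alternating-↭ : ∀ x y n → alternating x y n ↭ x ^^ n ++ y ^^ n
  alternating-↭ x y zero = ↭-refl
  alternating-↭ x y (suc n) = prep x (↭-trans (prep y (alternating-↭ x y n)) (↭-sym (↭.shift y (x ^^ n) _)))

  alternates : ∀ {x y L} → All (λ u → u ≡ x ⊎ u ≡ y) L → (∀ A u B → x ∷ L ≢ A ++ u ∷ u ∷ B) →
               (∃[ n ] x ∷ L ≡ alternating x y n) ⊎ (∃[ n ] x ∷ L ≡ alternating x y n ∷ʳ x)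
  alternates {x} [] _ = inj₂ (0 , refl)
  alternates {x} (inj₁ refl ∷ _) distinct = contradiction refl (distinct [] x _)
  alternates (inj₂ refl ∷ []) _ = inj₁ (1 , refl)
  alternates {x} {y} (inj₂ refl ∷ inj₂ refl ∷ _) distinct = contradiction refl (distinct [ x ] y _)
  alternates {x} {y} (inj₂ refl ∷ inj₁ refl ∷ us) distinct =
    Sum.map (λ (n , eq) → suc n , cong (λ L → x ∷ y ∷ L) eq) (λ (n , eq) → suc n , cong (λ L → x ∷ y ∷ L) eq)
      (alternates us λ A u B eq → distinct (x ∷ y ∷ A) u B (cong (λ L → x ∷ y ∷ L) eq))

  power-factorization : ∀ {x k} → IsOrder x k → ∀ m → Factorization (x ^^ (m * k)) m
  power-factorization o zero = [] , refl , [] , ↭-refl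
  power-factorization {x} {k} o (suc m) = factorization-↭ (↭-reflexive (sym (replicate-+ k (m * k) x)))
    (factorization-++ (factorization-atom (atom-power o)) (power-factorization o m))

  prod∈⟨⟩ : ∀ {X : Pred Carrier ℓ} {L} → All ⟨ X ⟩ L → prod L ∈ ⟨ X ⟩
  prod∈⟨⟩ []       = identity
  prod∈⟨⟩ (p ∷ ps) = product p (prod∈⟨⟩ ps)

  module _ {G₀ : Pred Carrier ℓ} {d} (0<d : 0 < d) (divisible : DividesDistances G₀ d)
           (∣G∣≡ : ∣G∣ ≡ 2 + d) where

    -- The prefixes of S exhaust G, so every term z of S is the product of a prefix.
    -- If this prefix is neither the first term nor all but the last term, then
    -- S z z decomposes into two sequences of length < ∣G∣ with product one, whose
    -- atoms are squares.
    two-letters : ∀ x M y → InvolutionAtom G₀ (x ∷ M ∷ʳ y) → length M ≡ d →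
                  ∀ z → z ∈ˡ x ∷ M ∷ʳ y → z ≡ x ⊎ z ≡ y
    two-letters x M y (over , at@(_ , S≡ε) , invs) M≡d z z∈S = locate (prefixes-exhaust at G≤S z)
      where
      S = x ∷ M ∷ʳ y
      length-S : length S ≡ 2 + d
      length-S = cong suc (trans (length-++ M) (trans (+-comm (length M) 1) (cong suc M≡d)))
      G≤S : ∣G∣ ≤ length S
      G≤S = ≤-reflexive (trans ∣G∣≡ (sym length-S))
      inv-z = All.lookup invs z∈S

      -- Both `A ∷ʳ z` and `z ∷ B` are product-one and short, hence products of squares. So S z z
      -- factors as S · z² and into (4 + d) / 2 squares; then `d` divides `d / 2`, which is
      -- impossible for positive `d`.
      no-chord : ∀ A B → S ≡ A ++ B → prod A ≡ z → suc (length A) < 2 + d → suc (length B) < 2 + d → ⊥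
      no-chord A B eq A≡z A< B<
        with k , fA , 2k ← short-involutions divisible {A ∷ʳ z} (All.++⁺ (All.++⁻ˡ A (subst (All G₀) eq over)) (All.lookup over z∈S ∷ []))
               (All.++⁺ (All.++⁻ˡ A (subst (All _) eq invs)) (inv-z ∷ []))
               (productOne (trans (prod-++ A [ z ]) (trans (cong₂ _∙_ A≡z (identityʳ z)) (involution-∙ inv-z))))
               (subst (_< 2 + d) (sym (trans (length-++ A) (+-comm (length A) 1))) A<)
           | l , fB , 2l ← short-involutions divisible {z ∷ B} (All.lookup over z∈S ∷ All.++⁻ʳ A (subst (All G₀) eq over))
               (inv-z ∷ All.++⁻ʳ A (subst (All _) eq invs))
               (productOne (trans (cong (_∙ prod B) (sym A≡z)) (trans (sym (prod-++ A B)) (trans (cong prod (sym eq)) S≡ε))))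
               B<
        = contradiction (∣⇒≤ {{>-nonZero 0<e}} d∣e) (<⇒≱ e<d)
        where
        e = (k + l) ∸ 2
        Szz↭ : (A ∷ʳ z) ++ z ∷ B ↭ S ++ z ∷ z ∷ []
        Szz↭ = begin
          (A ∷ʳ z) ++ z ∷ B        ≡⟨ ++-assoc A [ z ] (z ∷ B) ⟩
          A ++ (z ∷ z ∷ []) ++ B   ↭⟨ ↭.++⁺ˡ A (↭.++-comm (z ∷ z ∷ []) B) ⟩
          A ++ B ++ z ∷ z ∷ []     ≡⟨ ++-assoc A B _ ⟨
          (A ++ B) ++ z ∷ z ∷ []   ≡⟨ cong (_++ z ∷ z ∷ []) eq ⟨
          S ++ z ∷ z ∷ []          ∎
          where open PermutationReasoning
        [k+l]*2≡ : (k + l) * 2 ≡ 2 + d + 2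
        [k+l]*2≡ = begin
          (k + l) * 2                        ≡⟨ *-distribʳ-+ 2 k l ⟩
          k * 2 + l * 2                      ≡⟨ cong₂ _+_ 2k 2l ⟩
          length (A ∷ʳ z) + length (z ∷ B)   ≡⟨ length-++ (A ∷ʳ z) ⟨
          length ((A ∷ʳ z) ++ z ∷ B)         ≡⟨ ↭.↭-length Szz↭ ⟩
          length (S ++ z ∷ z ∷ [])           ≡⟨ trans (length-++ S) (cong (_+ 2) length-S) ⟩
          2 + d + 2                          ∎
          where open ≡-Reasoning
        2<k+l : 2 < k + l
        2<k+l = *-cancelʳ-< 2 2 (k + l) (subst (4 <_) (sym [k+l]*2≡) (s≤s (s≤s (subst (3 ≤_) (+-comm 2 d) (s≤s (s≤s 0<d))))))
        0<e : 0 < e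
        0<e = m<n⇒0<n∸m 2<k+l
        k+l≡ : 2 + e ≡ k + l
        k+l≡ = m+[n∸m]≡n (<⇒≤ 2<k+l)
        e*2≡d : e * 2 ≡ d
        e*2≡d = +-cancelˡ-≡ 4 _ _ (trans (cong (_* 2) k+l≡) (trans [k+l]*2≡ (cong (2 +_) (+-comm d 2))))
        e<d : e < d
        e<d = subst (e <_) e*2≡d (subst (_< e * 2) (*-identityʳ e) (*-monoʳ-< e {{>-nonZero 0<e}} (s≤s (s≤s z≤n))))
        d∣e : d ∣ e
        d∣e = divisible 2 e (All.++⁺ over (All.lookup over z∈S ∷ All.lookup over z∈S ∷ []))
          (factorization-++ (factorization-atom (proj₁ at)) (factorization-atom (atom-power inv-z)))
          (factorization-≡ (sym k+l≡) (factorization-↭ Szz↭ (factorization-++ fA fB)))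

      take-init : ∀ M i → length M ≤ i → i < length (M ∷ʳ y) → take i (M ∷ʳ y) ≡ M
      take-init [] zero _ _ = refl
      take-init [] (suc i) _ (s≤s ())
      take-init (_ ∷ M) (suc i) (s≤s le) (s≤s lt) = cong (_ ∷_) (take-init M i le lt)

      locate : ∃[ i ] (0 < i × i ≤ length S × prod (take i S) ≡ z) → z ≡ x ⊎ z ≡ y
      locate (suc zero , _ , _ , eq) = inj₁ (trans (sym eq) (identityʳ x))
      locate (suc (suc i) , _ , i≤S , eq) with suc i ℕ.≟ length (M ∷ʳ y)
      ... | yes i≡ = contradiction (trans (sym eq) (trans (cong (λ i → prod (take i S)) (cong suc i≡))
                       (trans (cong prod (take-all S)) S≡ε))) (involution-≢ε inv-z)
        where
        take-all : ∀ (L : Sequence) → take (length L) L ≡ L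
        take-all []      = refl
        take-all (u ∷ L) = cong (u ∷_) (take-all L)
      ... | no i≢ with length M ℕ.≤? suc i
      ... | yes M≤i = inj₂ (trans z≡y⁻¹ (involution-⁻¹ (All.lookup invs (∈-++⁺ʳ (x ∷ M) (here refl)))))
        where
        prod-init : prod (x ∷ M) ≡ z
        prod-init = trans (cong (λ L → prod (x ∷ L)) (sym (take-init M (suc i) M≤i (≤∧≢⇒< (ℕ.s≤s⁻¹ i≤S) i≢)))) eq
        z≡y⁻¹ : z ≡ y ⁻¹
        z≡y⁻¹ = inverseˡ-unique z y (trans (cong₂ _∙_ (sym prod-init) (sym (identityʳ y)))
                  (trans (sym (prod-++ (x ∷ M) [ y ])) S≡ε))
      ... | no M≰i = ⊥-elim (no-chord (take (2 + i) S) (drop (2 + i) S) (sym (take++drop≡id (2 + i) S)) eq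
                       (s≤s (subst (_< suc d) (sym take-length) 2+i<1+d))
                       (s≤s (subst (_< suc d) (sym drop-length) (s≤s (m∸n≤m d i)))))
        where
        2+i<1+d : 2 + i < suc d
        2+i<1+d = s≤s (subst (2 + i ≤_) M≡d (≰⇒> M≰i))
        take-length : length (take (2 + i) S) ≡ 2 + i
        take-length = trans (length-take (2 + i) S) (m≤n⇒m⊓n≡m i≤S)
        drop-length : length (drop (2 + i) S) ≡ d ∸ i
        drop-length = trans (length-drop (2 + i) S) (cong (_∸ (2 + i)) length-S)

    dihedral-from-atom : ∀ S → InvolutionAtom G₀ S → length S ≡ ∣G∣ → ∃[ n ] (3 ≤ n × ¬ (2 ∣ n) × IsDihedral n)
    dihedral-from-atom S S-atom S≡G = ends S (initLast S) S-atom (trans S≡G ∣G∣≡)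
      where
      conclude : ∀ x M y n → InvolutionAtom G₀ (x ∷ M ∷ʳ y) → length (x ∷ M ∷ʳ y) ≡ 2 + d →
                 x ∷ M ∷ʳ y ≡ alternating x y n → ∃[ n ] (3 ≤ n × ¬ (2 ∣ n) × IsDihedral n)
      conclude x M y n (over , at@((_ , _ , ¬s) , S≡ε) , invs) S≡2+d eq =
        n , 3≤n , odd , trans ∣G∣≡ (trans (sym n*2≡) (*-comm n 2)) ,
        x ∙ y , y , (λ {h} _ → generates h) , xyⁿ≡ε , proj₂ (proj₁ inv-y) , relation
        where
        inv-x = All.lookup invs (here refl)
        inv-y = All.lookup invs (∈-++⁺ʳ (x ∷ M) (here refl))
        xyⁿ≡ε : (x ∙ y) ^ n ≡ ε
        xyⁿ≡ε = trans (sym (prod-alternating x y n)) (trans (cong prod (sym eq)) S≡ε)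
        n*2≡ : n * 2 ≡ 2 + d
        n*2≡ = trans (sym (length-alternating n)) (trans (cong length (sym eq)) S≡2+d)
          where
          length-alternating : ∀ n → length (alternating x y n) ≡ n * 2
          length-alternating zero = refl
          length-alternating (suc n) = cong (2 +_) (length-alternating n)
        1<n : 1 < n
        1<n = *-cancelʳ-< 2 1 n (subst (2 <_) (sym n*2≡) (s≤s (s≤s 0<d)))
        -- For even n the sequence xⁿyⁿ would be a product of n squares as well as an atom, and `d`
        -- would divide n - 1, which lies strictly between 0 and `d`.
        odd : ¬ (2 ∣ n)
        odd (divides q n≡) = <⇒≱ n∸1<d (∣⇒≤ {{>-nonZero (m<n⇒0<n∸m 1<n)}} (divisible 1 (n ∸ 1) over (factorization-atom (proj₁ at))
          (factorization-≡ (trans q+q≡n (sym (m+[n∸m]≡n (<⇒≤ 1<n))))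
            (factorization-↭ (↭-sym (↭-trans (↭-reflexive eq) (alternating-↭ x y n)))
              (factorization-++ (even-power inv-x) (even-power inv-y))))))
          where
          even-power : ∀ {u} → IsOrder u 2 → Factorization (u ^^ n) q
          even-power {u} inv = subst (λ k → Factorization (u ^^ k) q) (sym n≡) (power-factorization inv q)
          q+q≡n : q + q ≡ n
          q+q≡n = trans (cong (q +_) (sym (+-identityʳ q))) (trans (*-comm 2 q) (sym n≡))
          n∸1<d : n ∸ 1 < d
          n∸1<d = +-cancelˡ-< 2 _ _ (begin-strict
            2 + (n ∸ 1)   ≡⟨ cong suc (m+[n∸m]≡n (<⇒≤ 1<n)) ⟩
            1 + n         <⟨ +-monoˡ-< n 1<n ⟩
            n + n         ≡⟨ trans (cong (n +_) (sym (+-identityʳ n))) (*-comm 2 n) ⟩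
            n * 2         ≡⟨ n*2≡ ⟩
            2 + d         ∎)
            where open ≤-Reasoning
        3≤n : 3 ≤ n
        3≤n = ≤∧≢⇒< 1<n λ { refl → odd ∣-refl }
        y∈ : y ∈ ⟨ ｛ x ∙ y ｝ ∪ ｛ y ｝ ⟩
        y∈ = generator (inj₂ refl)
        x∈ : x ∈ ⟨ ｛ x ∙ y ｝ ∪ ｛ y ｝ ⟩
        x∈ = subst (_∈ ⟨ ｛ x ∙ y ｝ ∪ ｛ y ｝ ⟩)
          (trans (assoc x y y) (trans (cong (x ∙_) (involution-∙ inv-y)) (identityʳ x)))
          (product (generator (inj₁ refl)) y∈)
        generates : ∀ h → h ∈ ⟨ ｛ x ∙ y ｝ ∪ ｛ y ｝ ⟩
        generates h with i , _ , _ , refl ← prefixes-exhaust at (≤-reflexive (trans ∣G∣≡ (sym S≡2+d))) h =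
          prod∈⟨⟩ (All.take⁺ i (subst (All _) (sym eq) (All.concat⁺ (All.replicate⁺ n (x∈ ∷ y∈ ∷ [])))))
        relation : y ∙ (x ∙ y) ≡ (x ∙ y) ⁻¹ ∙ y
        relation = trans (sym (assoc y x y)) (cong (_∙ y) (sym (trans (⁻¹-anti-homo-∙ x y)
          (cong₂ _∙_ (involution-⁻¹ inv-y) (involution-⁻¹ inv-x)))))

      ends : ∀ S → InitLast S → InvolutionAtom G₀ S → length S ≡ 2 + d → ∃[ n ] (3 ≤ n × ¬ (2 ∣ n) × IsDihedral n)
      ends _ [] _ ()
      ends _ ([] ∷ʳ′ y) _ ()
      ends _ ((x ∷ M) ∷ʳ′ y) S-atom@(_ , ((_ , _ , ¬s) , S≡ε) , invs) S≡2+d =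
        finish (alternates (All.tabulate λ {u} u∈ → letters u (there u∈)) distinct)
        where
        letters = two-letters x M y S-atom (suc-injective (suc-injective
          (trans (cong suc (sym (trans (length-++ M) (+-comm (length M) 1)))) S≡2+d)))
        inverse-square : ∀ A {u} B → All (λ g → IsOrder g 2) (A ++ u ∷ u ∷ B) → prod (u ∷ u ∷ []) ≡ ε
        inverse-square A B invs = trans (cong (_ ∙_) (identityʳ _)) (involution-∙ (All.head (All.++⁻ʳ A invs)))
        -- Equal neighbours form a block of product one and split the atom. With `A` empty the
        -- remainder is `B`, nonempty because S has more than two terms.
        distinct : ∀ A u B → x ∷ M ∷ʳ y ≢ A ++ u ∷ u ∷ B
        distinct [] u B eq = ¬s (subst Splits (sym eq) (u ∷ u ∷ [] , B ,
            productOne uu≡ε , (λ ()) , productOne B≡ε , B≢[] , ↭-refl))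
          where
          uu≡ε = inverse-square [] B (subst (All _) eq invs)
          B≡ε : prod B ≡ ε
          B≡ε = trans (sym (identityˡ _)) (trans (cong (_∙ prod B) (sym uu≡ε))
            (trans (sym (prod-++ (u ∷ u ∷ []) B)) (trans (cong prod (sym eq)) S≡ε)))
          B≢[] : B ≢ []
          B≢[] refl = contradiction (trans (sym S≡2+d) (cong length eq)) λ e → <⇒≢ 0<d (sym (suc-injective (suc-injective e)))
        distinct A@(_ ∷ _) u B eq = ¬s (subst Splits (sym eq) (ordered-split A (u ∷ u ∷ []) B (λ ()) (λ ())
          (inverse-square A B (subst (All _) eq invs)) (trans (cong prod (sym eq)) S≡ε)))
        -- An alternating word of odd length ends with `x`, so `y` is `x`, and its first two letters
        -- would be equal neighbours.
        same-ends : ∀ n → y ≡ x → x ∷ M ∷ʳ y ≢ alternating x y n ∷ʳ x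
        same-ends zero _ eq = contradiction (trans (sym S≡2+d) (cong length eq)) λ ()
        same-ends (suc n) refl eq = distinct [] x (alternating x x n ∷ʳ x) eq
        finish : (∃[ n ] x ∷ M ∷ʳ y ≡ alternating x y n) ⊎ (∃[ n ] x ∷ M ∷ʳ y ≡ alternating x y n ∷ʳ x) → _
        finish (inj₁ (n , eq)) = conclude x M y n S-atom S≡2+d eq
        finish (inj₂ (n , eq)) = ⊥-elim (same-ends n (proj₂ (∷ʳ-injective (x ∷ M) (alternating x y n) eq)) eq)

  -- Dihedral relations

  twist-^ : ∀ {σ τ} → τ ∙ σ ≡ σ ⁻¹ ∙ τ → ∀ i → τ ∙ σ ^ i ≡ (σ ⁻¹) ^ i ∙ τ
  twist-^ {σ} {τ} rel zero = trans (identityʳ τ) (sym (identityˡ τ))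
  twist-^ {σ} {τ} rel (suc i) = begin
    τ ∙ (σ ∙ σ ^ i)               ≡⟨ assoc _ _ _ ⟨
    τ ∙ σ ∙ σ ^ i                 ≡⟨ cong (_∙ σ ^ i) rel ⟩
    σ ⁻¹ ∙ τ ∙ σ ^ i              ≡⟨ assoc _ _ _ ⟩
    σ ⁻¹ ∙ (τ ∙ σ ^ i)            ≡⟨ cong (σ ⁻¹ ∙_) (twist-^ rel i) ⟩
    σ ⁻¹ ∙ ((σ ⁻¹) ^ i ∙ τ)       ≡⟨ assoc _ _ _ ⟨
    σ ⁻¹ ∙ (σ ⁻¹) ^ i ∙ τ         ∎
    where open ≡-Reasoning

  -- The relations of a dihedral subgroup, without reference to all of `G`. Instances are the given
  -- generators, a rotation with a reflection of `G`, and the product of two reflections with one of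
  -- them.
  record DihedralPair (σ τ : Carrier) (n : ℕ) : Set a where
    field
      σ-order : IsOrder σ n
      odd     : ¬ (2 ∣ n)
      3≤n     : 3 ≤ n
      τ-order : IsOrder τ 2
      τσ≡σ⁻¹τ : τ ∙ σ ≡ σ ⁻¹ ∙ τ

    0<n : 0 < n
    0<n = proj₁ (proj₁ σ-order)

    ττ≡ε : τ ∙ τ ≡ ε
    ττ≡ε = involution-∙ τ-order

    τ-moves : ∀ i → τ ∙ σ ^ i ≡ (σ ⁻¹) ^ i ∙ τ
    τ-moves = twist-^ τσ≡σ⁻¹τ

    τ-moves⁻¹ : ∀ i → τ ∙ (σ ⁻¹) ^ i ≡ σ ^ i ∙ τ
    τ-moves⁻¹ i = begin
      τ ∙ (σ ⁻¹) ^ i                ≡⟨ identityʳ _ ⟨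
      τ ∙ (σ ⁻¹) ^ i ∙ ε            ≡⟨ cong (τ ∙ (σ ⁻¹) ^ i ∙_) ττ≡ε ⟨
      τ ∙ (σ ⁻¹) ^ i ∙ (τ ∙ τ)      ≡⟨ assoc _ _ _ ⟩
      τ ∙ ((σ ⁻¹) ^ i ∙ (τ ∙ τ))    ≡⟨ cong (τ ∙_) (assoc _ _ _) ⟨
      τ ∙ ((σ ⁻¹) ^ i ∙ τ ∙ τ)      ≡⟨ cong (λ x → τ ∙ (x ∙ τ)) (τ-moves i) ⟨
      τ ∙ (τ ∙ σ ^ i ∙ τ)           ≡⟨ cong (τ ∙_) (assoc _ _ _) ⟩
      τ ∙ (τ ∙ (σ ^ i ∙ τ))         ≡⟨ assoc _ _ _ ⟨
      τ ∙ τ ∙ (σ ^ i ∙ τ)           ≡⟨ cong (_∙ (σ ^ i ∙ τ)) ττ≡ε ⟩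
      ε ∙ (σ ^ i ∙ τ)               ≡⟨ identityˡ _ ⟩
      σ ^ i ∙ τ                     ∎
      where open ≡-Reasoning

    -- The exponents of σ and σ⁻¹ are kept apart instead of being cancelled: moving τ across swaps
    -- them, and `P + Q` still counts the letters σ of the word.
    normal : ℕ → ℕ → ℕ → Carrier
    normal P Q r = σ ^ P ∙ (σ ⁻¹) ^ Q ∙ τ ^ r

    σ-normal : ∀ P Q r → σ ∙ normal P Q r ≡ normal (suc P) Q r
    σ-normal P Q r = trans (sym (assoc _ _ _)) (cong (_∙ τ ^ r) (sym (assoc _ _ _)))

    τ-normal : ∀ P Q r → τ ∙ normal P Q r ≡ normal Q P (suc r)
    τ-normal P Q r = begin
      τ ∙ (σ ^ P ∙ (σ ⁻¹) ^ Q ∙ τ ^ r)           ≡⟨ assoc _ _ _ ⟨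
      τ ∙ (σ ^ P ∙ (σ ⁻¹) ^ Q) ∙ τ ^ r           ≡⟨ cong (_∙ τ ^ r) (assoc _ _ _) ⟨
      τ ∙ σ ^ P ∙ (σ ⁻¹) ^ Q ∙ τ ^ r             ≡⟨ cong (λ x → x ∙ (σ ⁻¹) ^ Q ∙ τ ^ r) (τ-moves P) ⟩
      (σ ⁻¹) ^ P ∙ τ ∙ (σ ⁻¹) ^ Q ∙ τ ^ r        ≡⟨ cong (_∙ τ ^ r) (assoc _ _ _) ⟩
      (σ ⁻¹) ^ P ∙ (τ ∙ (σ ⁻¹) ^ Q) ∙ τ ^ r      ≡⟨ cong (λ x → (σ ⁻¹) ^ P ∙ x ∙ τ ^ r) (τ-moves⁻¹ Q) ⟩
      (σ ⁻¹) ^ P ∙ (σ ^ Q ∙ τ) ∙ τ ^ r           ≡⟨ cong (_∙ τ ^ r) (assoc _ _ _) ⟨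
      (σ ⁻¹) ^ P ∙ σ ^ Q ∙ τ ∙ τ ^ r             ≡⟨ assoc _ _ _ ⟩
      (σ ⁻¹) ^ P ∙ σ ^ Q ∙ (τ ∙ τ ^ r)           ≡⟨ cong (_∙ (τ ∙ τ ^ r)) commute ⟩
      σ ^ Q ∙ (σ ⁻¹) ^ P ∙ (τ ∙ τ ^ r)           ∎
      where
      open ≡-Reasoning
      commute : (σ ⁻¹) ^ P ∙ σ ^ Q ≡ σ ^ Q ∙ (σ ⁻¹) ^ P
      commute = commute-^ (sym (commute-^ (trans (inverseʳ σ) (sym (inverseˡ σ))) P)) Q

    -- If σⁱ = τ, then n divides 2i; n being odd, it divides i, and τ would be `ε`.
    τ∉⟨σ⟩ : ¬ IsPower σ τ
    τ∉⟨σ⟩ (i , σⁱ≡τ) with divides q i*2≡ ← order-∣ σ-order (i * 2)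
             (trans (cong (σ ^_) (*-comm i 2)) (trans (sym (^-* σ 2 i)) (trans (cong (λ x → x ∙ (x ∙ ε)) σⁱ≡τ)
               (trans (cong (τ ∙_) (identityʳ τ)) ττ≡ε))))
      with euclidsLemma q n prime[2] (divides i (sym i*2≡))
    ... | inj₂ 2∣n = odd 2∣n
    ... | inj₁ (divides q′ refl) = involution-≢ε τ-order (trans (sym σⁱ≡τ)
      (trans (cong (σ ^_) (*-cancelʳ-≡ i (q′ * n) 2 (trans i*2≡ (swap q′ n))))
        (trans (sym (^-* σ q′ n)) (trans (cong (_^ q′) (proj₂ (proj₁ σ-order))) (ε^ q′)))))
      where
      swap : ∀ q n → q * 2 * n ≡ q * n * 2
      swap = solve-∀

    σ≢τ : σ ≢ τ
    σ≢τ eq = τ∉⟨σ⟩ (1 , trans (identityʳ σ) eq)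

    τ^even : ∀ k → τ ^ (k * 2) ≡ ε
    τ^even k = trans (sym (^-* τ k 2)) (trans (cong (_^ k) (proj₂ (proj₁ τ-order))) (ε^ k))

    normal≡ε : ∀ P Q r → normal P Q r ≡ ε → 2 ∣ r × σ ^ P ∙ (σ ⁻¹) ^ Q ≡ ε
    normal≡ε P Q r eq with parity r
    ... | inj₁ 2∣r@(divides k refl) = 2∣r , trans (sym (identityʳ _)) (trans (cong (σ ^ P ∙ (σ ⁻¹) ^ Q ∙_) (sym (τ^even k))) eq)
    ... | inj₂ (k , refl) = contradiction
      (subst (IsPower σ) (sym τ≡) (isPower-⁻¹ (isPower-∙ (P , refl) (subst (IsPower σ) (sym (⁻¹-^ σ Q)) (isPower-⁻¹ (Q , refl))))))
      τ∉⟨σ⟩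
      where
      τ≡ : τ ≡ (σ ^ P ∙ (σ ⁻¹) ^ Q) ⁻¹
      τ≡ = inverseʳ-unique _ τ (trans (cong (σ ^ P ∙ (σ ⁻¹) ^ Q ∙_)
        (trans (sym (identityʳ τ)) (cong (τ ∙_) (sym (τ^even k))))) eq)

    -- Either `P ≡ Q` and the sum is even, or n divides the nonzero difference of `P` and `Q`, which
    -- is at most their sum.
    balance : ∀ P Q → σ ^ P ∙ (σ ⁻¹) ^ Q ≡ ε → 2 ∣ P + Q ⊎ n ≤ P + Q
    balance P Q eq with ℕ.<-cmp P Q
    ... | tri≈ _ refl _ = inj₁ (divides P (trans (cong (P +_) (sym (+-identityʳ P))) (*-comm 2 P)))
    ... | tri< P<Q _ _ = inj₂ (≤-trans (difference P Q P<Q σ^P≡σ^Q) (m≤n+m Q P))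
      where
      σ^P≡σ^Q : σ ^ P ≡ σ ^ Q
      σ^P≡σ^Q = trans (inverseˡ-unique _ _ eq) (trans (cong _⁻¹ (⁻¹-^ σ Q)) (⁻¹-involutive _))
      difference : ∀ P Q → P < Q → σ ^ P ≡ σ ^ Q → n ≤ Q
      difference P Q P<Q eq = ≤-trans (∣⇒≤ {{>-nonZero (m<n⇒0<n∸m P<Q)}} (order-∣ σ-order (Q ∸ P)
        (∙-cancelˡ (σ ^ P) _ _ (trans (sym (^-+ σ P (Q ∸ P))) (trans (cong (σ ^_) (m+[n∸m]≡n (<⇒≤ P<Q)))
          (trans (sym eq) (sym (identityʳ _)))))))) (m∸n≤m Q P)
    ... | tri> _ _ Q<P = inj₂ (≤-trans (∣⇒≤ {{>-nonZero (m<n⇒0<n∸m Q<P)}} (order-∣ σ-order (P ∸ Q)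
        (∙-cancelˡ (σ ^ Q) _ _ (trans (sym (^-+ σ Q (P ∸ Q))) (trans (cong (σ ^_) (m+[n∸m]≡n (<⇒≤ Q<P)))
          (trans σ^P≡σ^Q (sym (identityʳ _)))))))) (≤-trans (m∸n≤m P Q) (m≤m+n P Q)))
      where
      σ^P≡σ^Q : σ ^ P ≡ σ ^ Q
      σ^P≡σ^Q = trans (inverseˡ-unique _ _ eq) (trans (cong _⁻¹ (⁻¹-^ σ Q)) (⁻¹-involutive _))

    -- The clause on `Q` records that no σ gets inverted in a word without τ; such a word is
    -- product-one only if n divides its length.
    prod-στ : ∀ C → ∃₂ λ P Q → P + Q ≡ trues C × (falses C ≡ 0 → Q ≡ 0) × prod (decode σ τ C) ≡ normal P Q (falses C)
    prod-στ [] = 0 , 0 , refl , (λ _ → refl) , sym (trans (identityʳ _) (identityˡ ε))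
    prod-στ (true ∷ C) with P , Q , eq , none , prod≡ ← prod-στ C =
      suc P , Q , cong suc eq , none , trans (cong (σ ∙_) prod≡) (σ-normal P Q (falses C))
    prod-στ (false ∷ C) with P , Q , eq , _ , prod≡ ← prod-στ C =
      Q , P , trans (+-comm Q P) eq , (λ ()) , trans (cong (τ ∙_) prod≡) (τ-normal P Q (falses C))

    productOne-στ⇒ : ∀ i j → ProductOne (σ ^^ i ++ τ ^^ j) → 2 ∣ j × (2 ∣ i ⊎ n ≤ i) × (j ≡ 0 → n ∣ i)
    productOne-στ⇒ i j (S , p , S≡ε)
      with C , refl ← encode (↭.All-resp-↭ p (All.++⁺ {P = λ u → u ≡ σ ⊎ u ≡ τ} (All.replicate⁺ i (inj₁ refl)) (All.replicate⁺ j (inj₂ refl))))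
      with refl , refl ← pair-injective {i = i} {j} {trues C} {falses C} σ≢τ (↭-trans p (decode-↭ σ τ C))
      with P , Q , P+Q≡ , none , prod≡ ← prod-στ C
      with 2∣j , balanced ← normal≡ε P Q (falses C) (trans (sym prod≡) S≡ε)
      = 2∣j , subst (λ i → 2 ∣ i ⊎ n ≤ i) P+Q≡ (balance P Q balanced) , only-σ
      where
      only-σ : falses C ≡ 0 → n ∣ trues C
      only-σ j≡0 with refl ← none j≡0 =
        subst (n ∣_) (trans (sym (+-identityʳ P)) P+Q≡) (order-∣ σ-order P (trans (sym (identityʳ _)) balanced))

    -- τ σᶜ τ σᶜ τ^{2e} = 1.
    productOne-στ : ∀ c e → ProductOne (σ ^^ (c + c) ++ τ ^^ (2 + e * 2))
    productOne-στ c e = productOne-↭ sorted (productOne word≡ε)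
      where
      word : Sequence
      word = τ ∷ σ ^^ c ++ τ ∷ σ ^^ c ++ τ ^^ (e * 2)
      sorted : word ↭ σ ^^ (c + c) ++ τ ^^ (2 + e * 2)
      sorted = begin
        τ ∷ σ ^^ c ++ τ ∷ σ ^^ c ++ τ ^^ (e * 2)        ↭⟨ prep τ (↭.shift τ (σ ^^ c) _) ⟩
        τ ∷ τ ∷ σ ^^ c ++ σ ^^ c ++ τ ^^ (e * 2)        ≡⟨ cong (λ L → τ ∷ τ ∷ L) (++-assoc (σ ^^ c) _ _) ⟨
        τ ∷ τ ∷ (σ ^^ c ++ σ ^^ c) ++ τ ^^ (e * 2)      ≡⟨ cong (λ L → τ ∷ τ ∷ L ++ τ ^^ (e * 2)) (replicate-+ c c σ) ⟨
        τ ∷ τ ∷ σ ^^ (c + c) ++ τ ^^ (e * 2)            ↭⟨ ↭.shifts (τ ∷ τ ∷ []) (σ ^^ (c + c)) ⟩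
        σ ^^ (c + c) ++ τ ^^ (2 + e * 2)                ∎
        where open PermutationReasoning
      word≡ε : prod word ≡ ε
      word≡ε = begin
        τ ∙ prod (σ ^^ c ++ τ ∷ σ ^^ c ++ τ ^^ (e * 2))
          ≡⟨ cong (τ ∙_) (trans (prod-++ (σ ^^ c) _) (cong₂ _∙_ (prod-replicate c σ) (cong (τ ∙_)
               (trans (prod-pair σ τ c (e * 2)) (trans (cong (σ ^ c ∙_) (τ^even e)) (identityʳ _)))))) ⟩
        τ ∙ (σ ^ c ∙ (τ ∙ σ ^ c))          ≡⟨ assoc _ _ _ ⟨
        τ ∙ σ ^ c ∙ (τ ∙ σ ^ c)            ≡⟨ cong₂ _∙_ (τ-moves c) refl ⟩
        (σ ⁻¹) ^ c ∙ τ ∙ (τ ∙ σ ^ c)       ≡⟨ assoc _ _ _ ⟩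
        (σ ⁻¹) ^ c ∙ (τ ∙ (τ ∙ σ ^ c))     ≡⟨ cong ((σ ⁻¹) ^ c ∙_) (assoc _ _ _) ⟨
        (σ ⁻¹) ^ c ∙ (τ ∙ τ ∙ σ ^ c)       ≡⟨ cong (λ x → (σ ⁻¹) ^ c ∙ (x ∙ σ ^ c)) ττ≡ε ⟩
        (σ ⁻¹) ^ c ∙ (ε ∙ σ ^ c)           ≡⟨ cong₂ _∙_ (⁻¹-^ σ c) (identityˡ _) ⟩
        (σ ^ c) ⁻¹ ∙ σ ^ c                 ≡⟨ inverseˡ _ ⟩
        ε                                  ∎
        where open ≡-Reasoning

    productOne-σⁿ : ProductOne (σ ^^ n ++ τ ^^ 0)
    productOne-σⁿ = productOne (trans (prod-pair σ τ n 0) (trans (identityʳ _) (proj₂ (proj₁ σ-order))))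

    -- Here c = 2 and d = 2: modulo 4 the atoms τ² and σ²ᶜτ² have weight 2, and so does σⁿ, of
    -- weight 2n, because n is odd.
    στ-weight : Carrier → ℕ
    στ-weight u = if does (u ≟ σ) then 2 else 1

    private
      weight-σ : στ-weight σ ≡ 2
      weight-σ with σ ≟ σ
      ... | yes _ = refl
      ... | no ne = contradiction refl ne

      weight-τ : στ-weight τ ≡ 1
      weight-τ with τ ≟ σ
      ... | yes eq = contradiction (sym eq) σ≢τ
      ... | no _ = refl

      module _ {S} (at : Atom S) where

        ¬splits : ∀ i j → S ↭ σ ^^ i ++ τ ^^ j → ¬ Splits (σ ^^ i ++ τ ^^ j)
        ¬splits i j p s = proj₂ (proj₂ at) (splits-↭ (↭-sym p) s)

        weight≡ : ∀ i j → S ↭ σ ^^ i ++ τ ^^ j → Weight.weight στ-weight S ≡ i * 2 + j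
        weight≡ i j p = trans (Weight.weight-↭ στ-weight p) (trans (weight-pair στ-weight σ τ i j)
          (cong₂ _+_ (cong (i *_) weight-σ) (trans (cong (j *_) weight-τ) (*-identityʳ j))))

        only-σ : ∀ i → S ↭ σ ^^ i ++ τ ^^ 0 → n ∣ i → ∃[ q ] i * 2 + 0 ≡ 2 + q * 4
        only-σ i p (divides zero refl) = contradiction (↭.↭-empty-inv p) (proj₁ (proj₂ at))
        only-σ i p (divides (suc zero) refl) with parity n
        ... | inj₁ 2∣n = contradiction 2∣n odd
        ... | inj₂ (q , refl) = q , arith q
          where
          arith : ∀ q → (1 + q * 2 + 0) * 2 + 0 ≡ 2 + q * 4
          arith = solve-∀
        only-σ i p (divides (suc (suc q)) refl) = contradiction
          (pair-splits {σ} {τ} n 0 (suc q * n) 0 productOne-σⁿ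
            (productOne (trans (prod-pair σ τ (suc q * n) 0) (trans (identityʳ _)
              (trans (sym (^-* σ (suc q) n)) (trans (cong (_^ suc q) (proj₂ (proj₁ σ-order))) (ε^ (suc q)))))))
            (≤-trans 0<n (m≤m+n n 0)) (≤-trans 0<n (≤-trans (m≤m+n n (q * n)) (m≤m+n _ 0))))
          (¬splits _ 0 p)

        -- With an even number of σ a further τ² could be split off, so only two τ occur. With an
        -- odd number, at least n, the atom σⁿ could be split off, leaving an even number of σ.
        mixed : ∀ i e → S ↭ σ ^^ i ++ τ ^^ (2 + e * 2) → 2 ∣ i ⊎ n ≤ i → ∃[ q ] i * 2 + (2 + e * 2) ≡ 2 + q * 4
        mixed i e p _ with parity i
        mixed i zero p _ | inj₁ (divides c refl) = c , arith c
          where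
          arith : ∀ c → c * 2 * 2 + 2 ≡ 2 + c * 4
          arith = solve-∀
        mixed i (suc e) p _ | inj₁ (divides c refl) = contradiction
          (pair-splits {σ} {τ} 0 2 (c * 2) (2 + e * 2) (productOne (trans (cong (τ ∙_) (identityʳ τ)) ττ≡ε))
            (subst (λ i → ProductOne (σ ^^ i ++ τ ^^ (2 + e * 2))) (double c) (productOne-στ c e))
            (s≤s z≤n) (≤-trans (s≤s z≤n) (m≤n+m (2 + e * 2) (c * 2))))
          (¬splits (c * 2) (2 + suc e * 2) p)
          where
          double : ∀ c → c + c ≡ c * 2
          double = solve-∀
        mixed i e p (inj₁ 2∣i) | inj₂ (c , refl) = contradiction 2∣i (odd-∤ c)
        mixed i e p (inj₂ n≤i) | inj₂ (c , refl) with parity n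
        ... | inj₁ 2∣n = contradiction 2∣n odd
        ... | inj₂ (h , refl) = contradiction
          (subst (λ i → Splits (σ ^^ i ++ τ ^^ (2 + e * 2))) i≡
            (pair-splits {σ} {τ} (1 + h * 2) 0 (c′ + c′) (2 + e * 2) productOne-σⁿ (productOne-στ c′ e)
              (s≤s z≤n) (≤-trans (s≤s z≤n) (m≤n+m (2 + e * 2) (c′ + c′)))))
          (¬splits (1 + c * 2) (2 + e * 2) p)
          where
          c′ = c ∸ h
          h≤c : h ≤ c
          h≤c = *-cancelʳ-≤ h c 2 (ℕ.s≤s⁻¹ n≤i)
          arith : ∀ h c′ → 1 + h * 2 + (c′ + c′) ≡ 1 + (h + c′) * 2
          arith = solve-∀
          i≡ : 1 + h * 2 + (c′ + c′) ≡ 1 + c * 2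
          i≡ = trans (arith h c′) (cong (λ x → 1 + x * 2) (m+[n∸m]≡n h≤c))

    στ-atom-weight : ∀ S → All (Pair σ τ) S → Atom S → ∃[ q ] Weight.weight στ-weight S ≡ 2 + q * (2 * 2)
    στ-atom-weight S over at
      with i , j , p ← sort-pair (pair-terms {σ} {τ} over)
      with productOne-στ⇒ i j (productOne-↭ p (proj₁ at))
    ... | divides zero refl , _ , none with q , eq ← only-σ at i p (none refl) = q , trans (weight≡ at i 0 p) eq
    ... | divides (suc e) refl , i-cases , _ with q , eq ← mixed at i e p i-cases = q , trans (weight≡ at i (2 + e * 2) p) eq

    στ-dividesDistances : DividesDistances (Pair σ τ) 2
    στ-dividesDistances = weight⇒dividesDistances στ-weight 2 2 (s≤s z≤n) στ-atom-weight

    -- Each part of a splitting contains an even number of τ, so one part would be a power of σ with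
    -- exponent 1 or 2, less than n.
    σ²τ²-atom : Atom (σ ^^ 2 ++ τ ^^ 2)
    σ²τ²-atom = productOne-στ 1 0 , (λ ()) , λ s →
      let i₁ , j₁ , i₂ , j₂ , i-eq , j-eq , 0<₁ , 0<₂ , one₁ , one₂ = splits-pair {i = 2} {2} σ≢τ s
      in irreducible i₁ j₁ i₂ j₂ i-eq j-eq 0<₁ 0<₂ one₁ one₂
      where
      powers-of-σ : ∀ i j i′ → i + i′ ≡ 2 → j ≡ 0 → 0 < i + j → (j ≡ 0 → n ∣ i) → ⊥
      powers-of-σ i _ i′ eq refl 0<i n∣i =
        <⇒≱ 3≤n (≤-trans (∣⇒≤ {{>-nonZero (≤-trans 0<i (≤-reflexive (+-identityʳ i)))}} (n∣i refl)) (≤-trans (m≤m+n i i′) (≤-reflexive eq)))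
      irreducible : ∀ i₁ j₁ i₂ j₂ → i₁ + i₂ ≡ 2 → j₁ + j₂ ≡ 2 → 0 < i₁ + j₁ → 0 < i₂ + j₂ →
                    ProductOne (σ ^^ i₁ ++ τ ^^ j₁) → ProductOne (σ ^^ i₂ ++ τ ^^ j₂) → ⊥
      irreducible i₁ zero i₂ j₂ i-eq _ 0<₁ _ one₁ _ =
        powers-of-σ i₁ 0 i₂ i-eq refl 0<₁ (proj₂ (proj₂ (productOne-στ⇒ i₁ 0 one₁)))
      irreducible i₁ (suc zero) i₂ j₂ _ _ _ _ one₁ _ with proj₁ (productOne-στ⇒ i₁ 1 one₁)
      ... | divides zero ()
      ... | divides (suc _) ()
      irreducible i₁ (suc (suc j₁)) i₂ j₂ i-eq j-eq _ 0<₂ _ one₂ =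
        powers-of-σ i₂ j₂ i₁ (trans (+-comm i₂ i₁) i-eq) j₂≡0 0<₂ (proj₂ (proj₂ (productOne-στ⇒ i₂ j₂ one₂)))
        where
        j₂≡0 : j₂ ≡ 0
        j₂≡0 = m+n≡0⇒n≡0 j₁ (suc-injective (suc-injective j-eq))

    -- (σ²τ²)ⁿ = (σⁿ)² (τ²)ⁿ has factorizations of lengths n and n + 2.
    σ²τ²-power : Sequence
    σ²τ²-power = concat (replicate n (σ ^^ 2 ++ τ ^^ 2))

    σ²τ²-power-over : ∀ {G₀ : Pred Carrier ℓ} → σ ∈ G₀ → τ ∈ G₀ → All G₀ σ²τ²-power
    σ²τ²-power-over σ∈ τ∈ = all-concat-replicate n (σ∈ ∷ σ∈ ∷ τ∈ ∷ τ∈ ∷ [])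

    σ²τ²-power-n : Factorization σ²τ²-power n
    σ²τ²-power-n = factorization-≡ (*-identityʳ n) (factorization-replicate n (factorization-atom σ²τ²-atom))

    σ²τ²-power-n+2 : Factorization σ²τ²-power (n + 2)
    σ²τ²-power-n+2 = factorization-≡ (+-comm 2 n) (factorization-↭ (↭-sym (concat-replicate-pair σ τ 2 2 n))
      (factorization-++ (factorization-↭ (↭-reflexive (cong (σ ^^_) (*-comm 2 n))) (power-factorization σ-order 2))
                        (power-factorization τ-order n)))

    2∈Δ* : 2 ∈ Δ*
    2∈Δ* = Δ*-intro {G₀ = Pair σ τ} (λ u → T? _) (s≤s z≤n) στ-dividesDistances
      (σ²τ²-power-over {G₀ = Pair σ τ} (fromWitness (inj₁ refl)) (fromWitness (inj₂ refl))) σ²τ²-power-n σ²τ²-power-n+2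

    ∣2 : ∀ {G₀ : Pred Carrier ℓ} {d} → DividesDistances G₀ d → σ ∈ G₀ → τ ∈ G₀ → d ∣ 2
    ∣2 divisible σ∈ τ∈ = divisible n 2 (σ²τ²-power-over σ∈ τ∈) σ²τ²-power-n σ²τ²-power-n+2

    -- Every letter, στ or τ, contributes one τ to the normal form, but only στ contributes a σ.
    prod-involutions : ∀ C → ∃₂ λ P Q → P + Q ≡ trues C × prod (decode (σ ∙ τ) τ C) ≡ normal P Q (trues C + falses C)
    prod-involutions [] = 0 , 0 , refl , sym (trans (identityʳ _) (identityˡ ε))
    prod-involutions (true ∷ C) with P , Q , eq , prod≡ ← prod-involutions C =
      suc Q , P , cong suc (trans (+-comm Q P) eq) ,
      trans (assoc σ τ _) (trans (cong (λ x → σ ∙ (τ ∙ x)) prod≡) (trans (cong (σ ∙_) (τ-normal P Q (trues C + falses C))) (σ-normal Q P (suc (trues C + falses C)))))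
    prod-involutions (false ∷ C) with P , Q , eq , prod≡ ← prod-involutions C =
      Q , P , trans (+-comm Q P) eq ,
      trans (cong (τ ∙_) prod≡) (trans (τ-normal P Q (trues C + falses C)) (cong (normal Q P) (sym (+-suc (trues C) (falses C)))))

    στ≢τ : σ ∙ τ ≢ τ
    στ≢τ eq = contradiction (proj₂ σ-order 1 (s≤s z≤n , trans (identityʳ σ) (∙-cancelʳ τ σ ε (trans eq (sym (identityˡ τ))))))
      (<⇒≱ (≤-trans (s≤s (s≤s z≤n)) 3≤n))

    productOne-involutions⇒ : ∀ i j → ProductOne ((σ ∙ τ) ^^ i ++ τ ^^ j) → 2 ∣ i + j × (2 ∣ i ⊎ n ≤ i)
    productOne-involutions⇒ i j (S , p , S≡ε)
      with C , refl ← encode (↭.All-resp-↭ p (All.++⁺ {P = λ u → u ≡ σ ∙ τ ⊎ u ≡ τ} (All.replicate⁺ i (inj₁ refl)) (All.replicate⁺ j (inj₂ refl))))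
      with refl , refl ← pair-injective {i = i} {j} {trues C} {falses C} στ≢τ (↭-trans p (decode-↭ (σ ∙ τ) τ C))
      with P , Q , P+Q≡ , prod≡ ← prod-involutions C
      with 2∣ , balanced ← normal≡ε P Q (trues C + falses C) (trans (sym prod≡) S≡ε)
      = 2∣ , subst (λ i → 2 ∣ i ⊎ n ≤ i) P+Q≡ (balance P Q balanced)

  -- Pairs of reflections

  record Reflections (x y : Carrier) (n : ℕ) : Set a where
    field
      x-order  : IsOrder x 2
      y-order  : IsOrder y 2
      xy-order : IsOrder (x ∙ y) n
      odd      : ¬ (2 ∣ n)
      3≤n      : 3 ≤ n

    xyy≡x : x ∙ y ∙ y ≡ x
    xyy≡x = trans (assoc x y y) (trans (cong (x ∙_) (involution-∙ y-order)) (identityʳ x))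

    [xy]⁻¹≡yx : (x ∙ y) ⁻¹ ≡ y ∙ x
    [xy]⁻¹≡yx = trans (⁻¹-anti-homo-∙ x y) (cong₂ _∙_ (involution-⁻¹ y-order) (involution-⁻¹ x-order))

    dihedralPair : DihedralPair (x ∙ y) y n
    dihedralPair = record
      { σ-order = xy-order ; odd = odd ; 3≤n = 3≤n ; τ-order = y-order
      ; τσ≡σ⁻¹τ = trans (sym (assoc y x y)) (cong (_∙ y) (sym [xy]⁻¹≡yx)) }

    open DihedralPair dihedralPair using (0<n; στ≢τ; productOne-involutions⇒)

    x≢y : x ≢ y
    x≢y eq = στ≢τ (trans xyy≡x eq)

    productOne⇒ : ∀ i j → ProductOne (x ^^ i ++ y ^^ j) → 2 ∣ i + j × (2 ∣ i ⊎ n ≤ i)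
    productOne⇒ i j = productOne-involutions⇒ i j ∘ subst (λ u → ProductOne (u ^^ i ++ y ^^ j)) (sym xyy≡x)

  -- The symmetry is used to obtain for the exponent of `y` what the normal form shows for the
  -- exponent of `x`.
  reflections-swap : ∀ {x y n} → Reflections x y n → Reflections y x n
  reflections-swap r = record
    { x-order = y-order ; y-order = x-order ; xy-order = subst (λ g → IsOrder g _) [xy]⁻¹≡yx (order-⁻¹ xy-order)
    ; odd = odd ; 3≤n = 3≤n }
    where open Reflections r

  module _ {x y n} (r : Reflections x y n) where
    open Reflections r
    open DihedralPair dihedralPair using (0<n)

    productOne-pair⇒ : ∀ i j → ProductOne (x ^^ i ++ y ^^ j) → 2 ∣ i + j × (2 ∣ i ⊎ n ≤ i) × (2 ∣ j ⊎ n ≤ j)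
    productOne-pair⇒ i j one = proj₁ (productOne⇒ i j one) , proj₂ (productOne⇒ i j one) ,
      proj₂ (Reflections.productOne⇒ (reflections-swap r) j i (productOne-↭ (↭.++-comm (x ^^ i) (y ^^ j)) one))

    productOne-even : ∀ k l → ProductOne (x ^^ (k * 2) ++ y ^^ (l * 2))
    productOne-even k l = productOne (trans (prod-pair x y (k * 2) (l * 2))
      (trans (cong₂ _∙_ (even-power x-order k) (even-power y-order l)) (identityˡ ε)))
      where
      even-power : ∀ {u} → IsOrder u 2 → ∀ k → u ^ (k * 2) ≡ ε
      even-power {u} o k = trans (sym (^-* u k 2)) (trans (cong (_^ k) (proj₂ (proj₁ o))) (ε^ k))

    productOne-xⁿyⁿ : ProductOne (x ^^ n ++ y ^^ n)
    productOne-xⁿyⁿ = productOne-↭ (alternating-↭ x y n)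
      (productOne (trans (prod-alternating x y n) (proj₂ (proj₁ xy-order))))

    -- As n is odd, one part of a splitting contains an odd number of `x`, hence also an odd number
    -- of `y`. Both numbers are then at least n, and nothing is left for the other part.
    xⁿyⁿ-atom : Atom (x ^^ n ++ y ^^ n)
    xⁿyⁿ-atom = productOne-xⁿyⁿ , pair-nonempty n n (≤-trans 0<n (m≤m+n n n)) , λ s →
      let i₁ , j₁ , i₂ , j₂ , i-eq , j-eq , 0<₁ , 0<₂ , one₁ , one₂ = splits-pair {i = n} {n} x≢y s
      in irreducible i₁ j₁ i₂ j₂ i-eq j-eq 0<₁ 0<₂ one₁ one₂
      where
      full : ∀ i₁ j₁ i₂ j₂ → i₁ + i₂ ≡ n → j₁ + j₂ ≡ n → 0 < i₂ + j₂ → ¬ (2 ∣ i₁) → ¬ ProductOne (x ^^ i₁ ++ y ^^ j₁)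
      full i₁ j₁ i₂ j₂ i-eq j-eq 0<₂ odd₁ one with productOne-pair⇒ i₁ j₁ one
      ... | _ , inj₁ 2∣i₁ , _ = odd₁ 2∣i₁
      ... | 2∣ , inj₂ _ , inj₁ 2∣j₁ = odd₁ (∣m+n∣m⇒∣n {2} {j₁} (subst (2 ∣_) (+-comm i₁ j₁) 2∣) 2∣j₁)
      ... | _ , inj₂ n≤i₁ , inj₂ n≤j₁ = <⇒≱ 0<₂ (≤-reflexive (cong₂ _+_ (rest≡0 i₁ i₂ n≤i₁ i-eq) (rest≡0 j₁ j₂ n≤j₁ j-eq)))
        where
        rest≡0 : ∀ i i′ → n ≤ i → i + i′ ≡ n → i′ ≡ 0
        rest≡0 i i′ n≤i eq = n≤0⇒n≡0 (+-cancelˡ-≤ i _ _ (≤-trans (≤-reflexive eq) (≤-trans n≤i (m≤m+n i 0))))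
      irreducible : ∀ i₁ j₁ i₂ j₂ → i₁ + i₂ ≡ n → j₁ + j₂ ≡ n → 0 < i₁ + j₁ → 0 < i₂ + j₂ →
                    ProductOne (x ^^ i₁ ++ y ^^ j₁) → ProductOne (x ^^ i₂ ++ y ^^ j₂) → ⊥
      irreducible i₁ j₁ i₂ j₂ i-eq j-eq 0<₁ 0<₂ one₁ one₂ with 2 ∣? i₁
      ... | no odd₁ = full i₁ j₁ i₂ j₂ i-eq j-eq 0<₂ odd₁ one₁
      ... | yes 2∣i₁ = full i₂ j₂ i₁ j₁ (trans (+-comm i₂ i₁) i-eq) (trans (+-comm j₂ j₁) j-eq) 0<₁
        (λ 2∣i₂ → odd (subst (2 ∣_) i-eq (∣m∣n⇒∣m+n 2∣i₁ 2∣i₂))) one₂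

    -- (xⁿyⁿ)² = (x²)ⁿ (y²)ⁿ has factorizations of lengths 2 and 2n.
    xⁿyⁿ-square : Sequence
    xⁿyⁿ-square = concat (replicate 2 (x ^^ n ++ y ^^ n))

    xⁿyⁿ-square-2 : Factorization xⁿyⁿ-square 2
    xⁿyⁿ-square-2 = factorization-replicate 2 (factorization-atom xⁿyⁿ-atom)

    xⁿyⁿ-square-2n : Factorization xⁿyⁿ-square (2 + (2 * n ∸ 2))
    xⁿyⁿ-square-2n = factorization-≡ lengths (factorization-↭ (↭-sym (concat-replicate-pair x y n n 2))
      (factorization-++ (squares-of x-order) (squares-of y-order)))
      where
      squares-of : ∀ {u} → IsOrder u 2 → Factorization (u ^^ (2 * n)) n
      squares-of {u} o = factorization-↭ (↭-reflexive (cong (u ^^_) (*-comm n 2))) (power-factorization o n)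
      lengths : n + n ≡ 2 + (2 * n ∸ 2)
      lengths = trans (cong (n +_) (sym (+-identityʳ n)))
        (sym (m+[n∸m]≡n (*-monoʳ-≤ 2 0<n)))

    xⁿyⁿ-square-over : ∀ {G₀ : Pred Carrier ℓ} → x ∈ G₀ → y ∈ G₀ → All G₀ xⁿyⁿ-square
    xⁿyⁿ-square-over x∈ y∈ = all-concat-replicate 2 (All.++⁺ (All.replicate⁺ n x∈) (All.replicate⁺ n y∈))

    ∣2n∸2 : ∀ {G₀ : Pred Carrier ℓ} {d} → DividesDistances G₀ d → x ∈ G₀ → y ∈ G₀ → d ∣ 2 * n ∸ 2
    ∣2n∸2 divisible x∈ y∈ = divisible 2 (2 * n ∸ 2) (xⁿyⁿ-square-over x∈ y∈) xⁿyⁿ-square-2 xⁿyⁿ-square-2n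

    -- Here n = 1 + 2h, c = 2 and d = 2n - 2 = 4h, so weights count modulo 8h: x² has weight 2, y²
    -- has 2 + 8h, and xⁿyⁿ has n (2 + 4h) = 2 + (1 + h) 8h. Weight 1 for both letters would give
    -- xⁿyⁿ weight 2 + 4h. The value at `ε` makes the atom `ε` fit in.
    xy-weight : ℕ → Carrier → ℕ
    xy-weight h u = if does (u ≟ x) then 1 else if does (u ≟ y) then 1 + h * 4 else 2

    private
      weight-x : ∀ h → xy-weight h x ≡ 1
      weight-x h with x ≟ x
      ... | yes _ = refl
      ... | no ne = contradiction refl ne

      weight-y : ∀ h → xy-weight h y ≡ 1 + h * 4
      weight-y h with y ≟ x | y ≟ y
      ... | yes eq | _ = contradiction (sym eq) x≢y
      ... | no _ | yes _ = refl
      ... | no _ | no ne = contradiction refl ne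

      weight-ε : ∀ h → xy-weight h ε ≡ 2
      weight-ε h with ε ≟ x | ε ≟ y
      ... | yes eq | _ = contradiction (sym eq) (involution-≢ε x-order)
      ... | no _ | yes eq = contradiction (sym eq) (involution-≢ε y-order)
      ... | no _ | no _ = refl

      module _ (h : ℕ) (n≡ : n ≡ 1 + h * 2) {S} (at : Atom S) where

        Claim : ℕ → ℕ → Set
        Claim i j = ∃[ q ] i * 1 + j * (1 + h * 4) ≡ 2 + q * (2 * (h * 4))

        splits⇒ : ∀ i j i′ j′ → S ↭ x ^^ (i + i′) ++ y ^^ (j + j′) → ProductOne (x ^^ i ++ y ^^ j) →
                  ProductOne (x ^^ i′ ++ y ^^ j′) → 0 < i + j → 0 < i′ + j′ → ⊥
        splits⇒ i j i′ j′ p one one′ 0<₁ 0<₂ =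
          proj₂ (proj₂ at) (splits-↭ (↭-sym p) (pair-splits {x} {y} i j i′ j′ one one′ 0<₁ 0<₂))

        both-even : ∀ k l → S ↭ x ^^ (k * 2) ++ y ^^ (l * 2) → Claim (k * 2) (l * 2)
        both-even zero zero p = contradiction (↭.↭-empty-inv p) (proj₁ (proj₂ at))
        both-even zero (suc zero) p = 1 , arith h
          where
          arith : ∀ h → 2 * (1 + h * 4) ≡ 2 + 1 * (2 * (h * 4))
          arith = solve-∀
        both-even (suc zero) zero p = 0 , refl
        both-even zero (suc (suc l)) p = ⊥-elim (splits⇒ 0 2 0 (suc l * 2) p (productOne-even 0 1) (productOne-even 0 (suc l)) (s≤s z≤n) (s≤s z≤n))
        both-even (suc zero) (suc l) p = ⊥-elim (splits⇒ 2 0 0 (suc l * 2) p (productOne-even 1 0) (productOne-even 0 (suc l)) (s≤s z≤n) (s≤s z≤n))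
        both-even (suc (suc k)) l p = ⊥-elim (splits⇒ 2 0 (suc k * 2) (l * 2) p (productOne-even 1 0) (productOne-even (suc k) l) (s≤s z≤n) (s≤s z≤n))

        both-odd : ∀ k l → S ↭ x ^^ (n + k * 2) ++ y ^^ (n + l * 2) → Claim (n + k * 2) (n + l * 2)
        both-odd zero zero p = 1 + h , trans (cong (λ n → (n + 0) * 1 + (n + 0) * (1 + h * 4)) n≡) (arith h)
          where
          arith : ∀ h → (1 + h * 2 + 0) * 1 + (1 + h * 2 + 0) * (1 + h * 4) ≡ 2 + (1 + h) * (2 * (h * 4))
          arith = solve-∀
        both-odd zero (suc l) p = ⊥-elim (splits⇒ n n 0 (suc l * 2) p productOne-xⁿyⁿ (productOne-even 0 (suc l)) (≤-trans 0<n (m≤m+n n n)) (s≤s z≤n))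
        both-odd (suc k) l p = ⊥-elim (splits⇒ n n (suc k * 2) (l * 2) p productOne-xⁿyⁿ (productOne-even (suc k) l) (≤-trans 0<n (m≤m+n n n)) (s≤s z≤n))

        beyond : ∀ k → n ≤ 1 + k * 2 → 1 + k * 2 ≡ n + (k ∸ h) * 2
        beyond k n≤ = sym (trans (cong (_+ (k ∸ h) * 2) n≡) (trans (arith h (k ∸ h))
          (cong (λ z → 1 + z * 2) (m+[n∸m]≡n (*-cancelʳ-≤ h k 2 (ℕ.s≤s⁻¹ (subst (_≤ 1 + k * 2) n≡ n≤)))))))
          where
          arith : ∀ h k → 1 + h * 2 + k * 2 ≡ 1 + (h + k) * 2
          arith = solve-∀

        claim : ∀ i j → S ↭ x ^^ i ++ y ^^ j → Claim i j
        claim i j p with productOne-pair⇒ i j (productOne-↭ p (proj₁ at)) | parity i | parity j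
        ... | _ | inj₁ (divides k refl) | inj₁ (divides l refl) = both-even k l p
        ... | 2∣ , _ | inj₁ 2∣i | inj₂ (l , refl) = contradiction (∣m+n∣m⇒∣n {2} {i} 2∣ 2∣i) (odd-∤ l)
        ... | 2∣ , _ | inj₂ (k , refl) | inj₁ 2∣j = contradiction (∣m+n∣m⇒∣n {2} {j} (subst (2 ∣_) (+-comm _ j) 2∣) 2∣j) (odd-∤ k)
        ... | _ , inj₁ 2∣i , _ | inj₂ (k , refl) | inj₂ _ = contradiction 2∣i (odd-∤ k)
        ... | _ , _ , inj₁ 2∣j | inj₂ _ | inj₂ (l , refl) = contradiction 2∣j (odd-∤ l)
        ... | _ , inj₂ n≤i , inj₂ n≤j | inj₂ (k , refl) | inj₂ (l , refl) =
          subst₂ Claim (sym (beyond k n≤i)) (sym (beyond l n≤j))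
            (both-odd (k ∸ h) (l ∸ h) (subst₂ (λ i j → S ↭ x ^^ i ++ y ^^ j) (beyond k n≤i) (beyond l n≤j) p))

      atom-weight : ∀ h → n ≡ 1 + h * 2 → ∀ S → All (λ u → u ≡ ε ⊎ u ≡ x ⊎ u ≡ y) S → Atom S →
                    ∃[ q ] Weight.weight (xy-weight h) S ≡ 2 + q * (2 * (h * 4))
      atom-weight h n≡ S over at with Any.any? (ε ≟_) S
      ... | yes ε∈S = 0 , only S ε∈S (ε∈atom at ε∈S)
        where
        only : ∀ S → ε ∈ˡ S → length S ≡ 1 → Weight.weight (xy-weight h) S ≡ 2
        only (_ ∷ []) (here refl) _ = cong (_+ 0) (weight-ε h)
      ... | no ε∉S = finish (sort-pair (All.tabulate letter))
        where
        letter : ∀ {u} → u ∈ˡ S → u ≡ x ⊎ u ≡ y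
        letter u∈S with All.lookup over u∈S
        ... | inj₁ refl = contradiction u∈S ε∉S
        ... | inj₂ xy = xy
        finish : (∃₂ λ i j → S ↭ x ^^ i ++ y ^^ j) → _
        finish (i , j , p) with q , eq ← claim h n≡ at i j p =
          q , trans (Weight.weight-↭ (xy-weight h) p) (trans (weight-pair (xy-weight h) x y i j)
                (trans (cong₂ (λ a b → i * a + j * b) (weight-x h) (weight-y h)) eq))

    2n∸2-dividesDistances : ∀ {G₀ : Pred Carrier ℓ} → (∀ {u} → u ∈ G₀ → u ≡ ε ⊎ u ≡ x ⊎ u ≡ y) →
                            DividesDistances G₀ (2 * n ∸ 2)
    2n∸2-dividesDistances covered with parity n
    ... | inj₁ 2∣n = contradiction 2∣n odd
    ... | inj₂ (h , n≡) = subst (DividesDistances _) (sym (trans (cong (λ n → 2 * n ∸ 2) n≡) (trans (cong (_∸ 2) (arith h)) refl)))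
      (weight⇒dividesDistances (xy-weight h) 2 (h * 4) (s≤s z≤n) λ S over at → atom-weight h n≡ S (All.map covered over) at)
      where
      arith : ∀ h → 2 * (1 + h * 2) ≡ 2 + h * 4
      arith = solve-∀

    2n∸2∈Δ* : 2 * n ∸ 2 ∈ Δ*
    2n∸2∈Δ* = Δ*-intro {G₀ = Pair x y} (λ u → T? _) (m<n⇒0<n∸m (≤-trans 3≤n (m≤m+n n _)))
      (2n∸2-dividesDistances (inj₂ ∘ toWitness)) (xⁿyⁿ-square-over {G₀ = Pair x y} (fromWitness (inj₁ refl)) (fromWitness (inj₂ refl)))
      xⁿyⁿ-square-2 xⁿyⁿ-square-2n

    -- Write z = (xy)ᵏ y with 2 ≤ k < n.  The relations z x (yx)ᵏ⁻¹ = 1, of length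
    -- 2k, and z y (xy)ⁿ⁻ᵏ = 1, of length 2(n-k)+2, each contain z once; if both are
    -- too long, then 2k = n + 1 and x z y z = 1.
    third-reflection : ∀ {G₀ : Pred Carrier ℓ} {d z} → DividesDistances G₀ d → x ∈ G₀ → y ∈ G₀ → z ∈ G₀ →
                       IsOrder z 2 → z ≢ x → z ≢ y → IsPower (x ∙ y) (z ∙ y) → d ≤ 2 ⊔ (n ∸ 2)
    third-reflection {G₀ = G₀} {d} {z} divisible x∈ y∈ z∈ z-order z≢x z≢y zy-power = position (^-% xy-order (proj₁ zy-power))
      where
      z≡ : ∀ {k} → (x ∙ y) ^ k ≡ z ∙ y → z ≡ (x ∙ y) ^ k ∙ y
      z≡ eq = sym (trans (cong (_∙ y) eq) (trans (assoc z y y) (trans (cong (z ∙_) (involution-∙ y-order)) (identityʳ z))))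

      length-alternating : ∀ u v m → length (alternating u v m) ≡ m * 2
      length-alternating u v zero = refl
      length-alternating u v (suc m) = cong (2 +_) (length-alternating u v m)

      all-alternating : ∀ {p} {P : Pred Carrier p} {u v} m → P u → P v → All P (alternating u v m)
      all-alternating m Pu Pv = all-concat-replicate m (Pu ∷ Pv ∷ [])

      first : ∀ k → (x ∙ y) ^ suc k ≡ z ∙ y → d ≤ k * 2
      first k eq = ℕ.s≤s⁻¹ (ℕ.s≤s⁻¹ (subst (2 + d ≤_) (cong (2 +_) (length-alternating y x k))
        (single-occurrence divisible (z∈ ∷ x∈ ∷ all-alternating k y∈ x∈) (z-order ∷ x-order ∷ all-alternating k y-order x-order)
          relation ((z≢x ∘ sym) ∷ all-alternating k (z≢y ∘ sym) (z≢x ∘ sym)))))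
        where
        open ≡-Reasoning
        relation : z ∙ (x ∙ prod (alternating y x k)) ≡ ε
        relation = begin
          z ∙ (x ∙ prod (alternating y x k))
            ≡⟨ cong₂ (λ u v → u ∙ (x ∙ v)) (trans (z≡ {suc k} eq) (cong (_∙ y) (^-suc (x ∙ y) k)))
                 (trans (prod-alternating y x k) (trans (cong (_^ k) (sym [xy]⁻¹≡yx)) (⁻¹-^ (x ∙ y) k))) ⟩
          (x ∙ y) ^ k ∙ (x ∙ y) ∙ y ∙ (x ∙ ((x ∙ y) ^ k) ⁻¹)
            ≡⟨ cong (_∙ (x ∙ ((x ∙ y) ^ k) ⁻¹)) (trans (assoc _ _ _) (cong ((x ∙ y) ^ k ∙_) xyy≡x)) ⟩
          (x ∙ y) ^ k ∙ x ∙ (x ∙ ((x ∙ y) ^ k) ⁻¹)      ≡⟨ assoc _ _ _ ⟩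
          (x ∙ y) ^ k ∙ (x ∙ (x ∙ ((x ∙ y) ^ k) ⁻¹))    ≡⟨ cong ((x ∙ y) ^ k ∙_) (assoc _ _ _) ⟨
          (x ∙ y) ^ k ∙ (x ∙ x ∙ ((x ∙ y) ^ k) ⁻¹)
            ≡⟨ cong (λ u → (x ∙ y) ^ k ∙ (u ∙ ((x ∙ y) ^ k) ⁻¹)) (involution-∙ x-order) ⟩
          (x ∙ y) ^ k ∙ (ε ∙ ((x ∙ y) ^ k) ⁻¹)          ≡⟨ cong ((x ∙ y) ^ k ∙_) (identityˡ _) ⟩
          (x ∙ y) ^ k ∙ ((x ∙ y) ^ k) ⁻¹                ≡⟨ inverseʳ _ ⟩
          ε                                             ∎

      second : ∀ k → k ≤ n → (x ∙ y) ^ k ≡ z ∙ y → d ≤ (n ∸ k) * 2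
      second k k≤n eq = ℕ.s≤s⁻¹ (ℕ.s≤s⁻¹ (subst (2 + d ≤_) (cong (2 +_) (length-alternating x y (n ∸ k)))
        (single-occurrence divisible (z∈ ∷ y∈ ∷ all-alternating (n ∸ k) x∈ y∈) (z-order ∷ y-order ∷ all-alternating (n ∸ k) x-order y-order)
          relation ((z≢y ∘ sym) ∷ all-alternating (n ∸ k) (z≢x ∘ sym) (z≢y ∘ sym)))))
        where
        open ≡-Reasoning
        relation : z ∙ (y ∙ prod (alternating x y (n ∸ k))) ≡ ε
        relation = begin
          z ∙ (y ∙ prod (alternating x y (n ∸ k)))   ≡⟨ assoc _ _ _ ⟨
          z ∙ y ∙ prod (alternating x y (n ∸ k))     ≡⟨ cong₂ _∙_ (sym eq) (prod-alternating x y (n ∸ k)) ⟩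
          (x ∙ y) ^ k ∙ (x ∙ y) ^ (n ∸ k)            ≡⟨ ^-+ (x ∙ y) k (n ∸ k) ⟨
          (x ∙ y) ^ (k + (n ∸ k))                    ≡⟨ cong ((x ∙ y) ^_) (m+[n∸m]≡n k≤n) ⟩
          (x ∙ y) ^ n                                ≡⟨ proj₂ (proj₁ xy-order) ⟩
          ε                                          ∎

      -- Since 2k = n + 1, (xy)²ᵏ = xy, so z y z = (xy)²ᵏ y = x.
      middle : ∀ k → k * 2 ≡ suc n → (x ∙ y) ^ k ≡ z ∙ y → d ≤ 2
      middle k 2k≡ eq = ℕ.s≤s⁻¹ (ℕ.s≤s⁻¹ (single-occurrence divisible {x} {z ∷ y ∷ z ∷ []} (x∈ ∷ z∈ ∷ y∈ ∷ z∈ ∷ [])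
        (x-order ∷ z-order ∷ y-order ∷ z-order ∷ []) relation (z≢x ∷ (x≢y ∘ sym) ∷ z≢x ∷ [])))
        where
        open ≡-Reasoning
        zyz≡x : z ∙ (y ∙ (z ∙ ε)) ≡ x
        zyz≡x = begin
          z ∙ (y ∙ (z ∙ ε))                       ≡⟨ assoc _ _ _ ⟨
          z ∙ y ∙ (z ∙ ε)                         ≡⟨ cong₂ _∙_ (sym eq) (trans (identityʳ z) (z≡ {k} eq)) ⟩
          (x ∙ y) ^ k ∙ ((x ∙ y) ^ k ∙ y)         ≡⟨ assoc _ _ _ ⟨
          (x ∙ y) ^ k ∙ (x ∙ y) ^ k ∙ y           ≡⟨ cong (_∙ y) (^-+ (x ∙ y) k k) ⟨
          (x ∙ y) ^ (k + k) ∙ y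
            ≡⟨ cong (λ m → (x ∙ y) ^ m ∙ y) (trans (trans (cong (k +_) (sym (+-identityʳ k))) (*-comm 2 k)) 2k≡) ⟩
          x ∙ y ∙ (x ∙ y) ^ n ∙ y                 ≡⟨ cong (λ u → x ∙ y ∙ u ∙ y) (proj₂ (proj₁ xy-order)) ⟩
          x ∙ y ∙ ε ∙ y                           ≡⟨ cong (_∙ y) (identityʳ _) ⟩
          x ∙ y ∙ y                               ≡⟨ xyy≡x ⟩
          x                                       ∎
        relation : x ∙ (z ∙ (y ∙ (z ∙ ε))) ≡ ε
        relation = trans (cong (x ∙_) zyz≡x) (involution-∙ x-order)

      position : ∃[ k ] (k < n × (x ∙ y) ^ k ≡ (x ∙ y) ^ proj₁ zy-power) → d ≤ 2 ⊔ (n ∸ 2)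
      position (zero , _ , eq) = contradiction (trans (z≡ {0} (trans eq (proj₂ zy-power))) (identityˡ y)) z≢y
      position (suc k , k<n , eq) with suc k * 2 ℕ.≤? n
      ... | yes le = ≤-trans (first k eq′) (≤-trans (∸-monoˡ-≤ 2 le) (m≤n⊔m 2 (n ∸ 2)))
        where eq′ = trans eq (proj₂ zy-power)
      ... | no ≰ with (2 + (n ∸ suc k) * 2) ℕ.≤? n
      ... | yes le = ≤-trans (second (suc k) (<⇒≤ k<n) (trans eq (proj₂ zy-power)))
                             (≤-trans (∸-monoˡ-≤ 2 le) (m≤n⊔m 2 (n ∸ 2)))
      ... | no ≰′ = ≤-trans (middle (suc k) (≤-antisym above (≰⇒> ≰)) (trans eq (proj₂ zy-power))) (m≤m⊔n 2 (n ∸ 2))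
        where
        m = n ∸ suc k
        -- The failed second bound reads `n ≤ 1 + m * 2`. Adding it to the identity for 2n leaves an
        -- upper bound that meets the lower one from the failed first bound.
        above : suc k * 2 ≤ suc n
        above = +-cancelʳ-≤ (m * 2) _ _ (begin
          suc k * 2 + m * 2   ≡⟨ *-distribʳ-+ 2 (suc k) m ⟨
          (suc k + m) * 2     ≡⟨ cong (_* 2) (m+[n∸m]≡n (<⇒≤ k<n)) ⟩
          n * 2               ≡⟨ trans (*-comm n 2) (cong (n +_) (+-identityʳ n)) ⟩
          n + n               ≤⟨ +-monoʳ-≤ n (ℕ.s≤s⁻¹ (≰⇒> ≰′)) ⟩
          n + suc (m * 2)     ≡⟨ +-suc n (m * 2) ⟩
          suc n + m * 2       ∎)
          where open ≤-Reasoning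

  -- Dihedral groups of order 2n with n odd

  module DihedralGroup {n σ τ} (3≤n : 3 ≤ n) (odd : ¬ (2 ∣ n)) (∣G∣≡2n : ∣G∣ ≡ 2 * n)
    (generates : U ⊆ ⟨ ｛ σ ｝ ∪ ｛ τ ｝ ⟩) (σⁿ≡ε : σ ^ n ≡ ε) (τ²≡ε : τ ^ 2 ≡ ε) (τσ≡σ⁻¹τ : τ ∙ σ ≡ σ ⁻¹ ∙ τ) where

    -- Reflections are the coset ⟨σ⟩τ. That the two classes cover G follows from the relations; that
    -- they are disjoint and that σ has order n comes afterwards, from counting.
    Rotation Reflection : Pred Carrier a
    Rotation = IsPower σ
    Reflection g = IsPower σ (g ∙ τ)

    private
      ττ≡ε : τ ∙ τ ≡ ε
      ττ≡ε = trans (cong (τ ∙_) (sym (identityʳ τ))) τ²≡ε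

      gττ≡g : ∀ g → g ∙ τ ∙ τ ≡ g
      gττ≡g g = trans (assoc g τ τ) (trans (cong (g ∙_) ττ≡ε) (identityʳ g))

      twist : ∀ {s} → Rotation s → τ ∙ s ≡ s ⁻¹ ∙ τ
      twist (i , refl) = trans (twist-^ τσ≡σ⁻¹τ i) (cong (_∙ τ) (⁻¹-^ σ i))

      gsτ≡ : ∀ g {s} → Rotation s → g ∙ s ∙ τ ≡ g ∙ τ ∙ s ⁻¹
      gsτ≡ g {s} rot = begin
        g ∙ s ∙ τ                ≡⟨ cong (λ x → x ∙ s ∙ τ) (gττ≡g g) ⟨
        g ∙ τ ∙ τ ∙ s ∙ τ        ≡⟨ cong (_∙ τ) (assoc _ _ _) ⟩
        g ∙ τ ∙ (τ ∙ s) ∙ τ      ≡⟨ cong (λ x → g ∙ τ ∙ x ∙ τ) (twist rot) ⟩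
        g ∙ τ ∙ (s ⁻¹ ∙ τ) ∙ τ   ≡⟨ cong (_∙ τ) (assoc _ _ _) ⟨
        g ∙ τ ∙ s ⁻¹ ∙ τ ∙ τ     ≡⟨ gττ≡g _ ⟩
        g ∙ τ ∙ s ⁻¹             ∎
        where open ≡-Reasoning

      gh≡ : ∀ g {h} → Reflection h → g ∙ h ≡ g ∙ τ ∙ (h ∙ τ) ⁻¹
      gh≡ g {h} ref = trans (trans (cong (g ∙_) (sym (gττ≡g h))) (sym (assoc g (h ∙ τ) τ))) (gsτ≡ g ref)

    rotation-reflection : ∀ {g h} → Rotation g → Reflection h → Reflection (g ∙ h)
    rotation-reflection {g} {h} rot ref = subst Rotation (sym (assoc g h τ)) (isPower-∙ rot ref)

    reflection-rotation : ∀ {g h} → Reflection g → Rotation h → Reflection (g ∙ h)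
    reflection-rotation {g} ref rot = subst Rotation (sym (gsτ≡ g rot)) (isPower-∙ ref (isPower-⁻¹ rot))

    reflection-reflection : ∀ {g h} → Reflection g → Reflection h → Rotation (g ∙ h)
    reflection-reflection {g} ref ref′ = subst Rotation (sym (gh≡ g ref′)) (isPower-∙ ref (isPower-⁻¹ ref′))

    reflection-∙ : ∀ {g} → Reflection g → g ∙ g ≡ ε
    reflection-∙ {g} ref = trans (gh≡ g ref) (inverseʳ _)

    rotation⊎reflection : ∀ g → Rotation g ⊎ Reflection g
    rotation⊎reflection g = classify (generates tt)
      where
      classify : ∀ {g} → g ∈ ⟨ ｛ σ ｝ ∪ ｛ τ ｝ ⟩ → Rotation g ⊎ Reflection g
      classify (generator (inj₁ refl)) = inj₁ (1 , identityʳ σ)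
      classify (generator (inj₂ refl)) = inj₂ (0 , sym ττ≡ε)
      classify identity = inj₁ (0 , refl)
      classify (product p q) with classify p | classify q
      ... | inj₁ r | inj₁ s = inj₁ (isPower-∙ r s)
      ... | inj₁ r | inj₂ s = inj₂ (rotation-reflection r s)
      ... | inj₂ r | inj₁ s = inj₂ (reflection-rotation r s)
      ... | inj₂ r | inj₂ s = inj₁ (reflection-reflection r s)
      classify (inverse {g} p) with classify p
      ... | inj₁ r = inj₁ (isPower-⁻¹ r)
      ... | inj₂ r = inj₂ (subst Reflection (inverseʳ-unique g g (reflection-∙ r)) r)

    -- The products σⁱτᵉ with i < ord(σ) and e < 2 exhaust G, so 2n ≤ 2 ord(σ).
    σ-order : IsOrder σ n
    σ-order = subst (IsOrder σ) (≤-antisym (proj₂ (proj₂ (order σ)) n (≤-trans (s≤s z≤n) 3≤n , σⁿ≡ε)) n≤k) (proj₂ (order σ))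
      where
      k = ord σ
      element-of : Fin k × Fin 2 → Carrier
      element-of (i , e) = σ ^ toℕ i ∙ τ ^ toℕ e
      hit : ∀ {g} j (j<k : j < k) e → σ ^ j ∙ τ ^ toℕ e ≡ g → ∃[ i ] element-of (Fin.remQuot 2 i) ≡ g
      hit j j<k e eq = Fin.combine (fromℕ< j<k) e ,
        trans (cong element-of (Fin.remQuot-combine (fromℕ< j<k) e))
              (trans (cong (λ m → σ ^ m ∙ τ ^ toℕ e) (Fin.toℕ-fromℕ< j<k)) eq)
      onto : ∀ g → ∃[ i ] element-of (Fin.remQuot 2 i) ≡ g
      onto g with rotation⊎reflection g
      ... | inj₁ (i , eq) with j , j<k , eq′ ← ^-% (proj₂ (order σ)) i =
        hit j j<k zero (trans (identityʳ _) (trans eq′ eq))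
      ... | inj₂ (i , eq) with j , j<k , eq′ ← ^-% (proj₂ (order σ)) i =
        hit j j<k (suc zero) (trans (cong₂ _∙_ (trans eq′ eq) (identityʳ τ)) (gττ≡g g))
      n≤k : n ≤ k
      n≤k = *-cancelʳ-≤ n k 2 (subst (_≤ k * 2) (trans ∣G∣≡2n (*-comm 2 n)) (∣G∣≤-image (element-of ∘ Fin.remQuot 2) onto))

    rotation-index : ∀ {g} → Rotation g → ∃[ i ] σ ^ toℕ {n} i ≡ g
    rotation-index (i , eq) with j , j<n , eq′ ← ^-% σ-order i =
      fromℕ< j<n , trans (cong (σ ^_) (Fin.toℕ-fromℕ< j<n)) (trans eq′ eq)

    τ≢ε : τ ≢ ε
    τ≢ε τ≡ε = <⇒≱ (m<m+n n (≤-trans (s≤s z≤n) (≤-trans 3≤n (m≤m+n n 0))))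
      (subst (_≤ n) ∣G∣≡2n (∣G∣≤-image (λ i → σ ^ toℕ {n} i) λ g → rotation-index (rotation g)))
      where
      rotation : ∀ g → Rotation g
      rotation g with rotation⊎reflection g
      ... | inj₁ r = r
      ... | inj₂ r = subst Rotation (trans (cong (g ∙_) τ≡ε) (identityʳ g)) r

    dihedralPair : DihedralPair σ τ n
    dihedralPair = record
      { σ-order = σ-order ; odd = odd ; 3≤n = 3≤n ; τ-order = involution ττ≡ε τ≢ε ; τσ≡σ⁻¹τ = τσ≡σ⁻¹τ }

    reflection-≢ε : ∀ {g} → Reflection g → g ≢ ε
    reflection-≢ε ref refl = DihedralPair.τ∉⟨σ⟩ dihedralPair (subst Rotation (identityˡ τ) ref)

    reflection-order : ∀ {g} → Reflection g → IsOrder g 2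
    reflection-order ref = involution (reflection-∙ ref) (reflection-≢ε ref)

    rotation-^n : ∀ {g} → Rotation g → g ^ n ≡ ε
    rotation-^n (i , refl) = trans (^-* σ n i) (trans (cong (σ ^_) (*-comm n i))
      (trans (sym (^-* σ i n)) (trans (cong (_^ i) σⁿ≡ε) (ε^ i))))

    rotation-order : ∀ {g} → Rotation g → g ≢ ε → ord g ∣ n × ¬ (2 ∣ ord g) × 3 ≤ ord g
    rotation-order {g} rot g≢ε = k∣n , k-odd , ≤∧≢⇒< (2≤ord g≢ε) λ 2≡k → k-odd (subst (2 ∣_) 2≡k ∣-refl)
      where
      k∣n = ord-∣ g n (rotation-^n rot)
      k-odd : ¬ (2 ∣ ord g)
      k-odd 2∣k = odd (∣-trans 2∣k k∣n)

    reflections : ∀ {x y} → Reflection x → Reflection y → x ≢ y → Reflections x y (ord (x ∙ y))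
    reflections {x} {y} ref-x ref-y x≢y = record
      { x-order = reflection-order ref-x ; y-order = reflection-order ref-y ; xy-order = proj₂ (order (x ∙ y))
      ; odd = proj₁ (proj₂ orders) ; 3≤n = proj₂ (proj₂ orders) }
      where
      orders = rotation-order (reflection-reflection ref-x ref-y) λ eq →
        x≢y (trans (inverseˡ-unique x y eq) (involution-⁻¹ (reflection-order ref-y)))

    -- Among the n rotations, `s` must collide with one of the n powers of ρ, which are pairwise
    -- distinct.
    rotation-generator : ∀ {ρ s} → Rotation ρ → IsOrder ρ n → Rotation s → IsPower ρ s
    rotation-generator {ρ} {s} rot-ρ (_ , n-min) rot-s = locate (Fin.pigeonhole ≤-refl (proj₁ ∘ label))
      where
      point : Fin (suc n) → Carrier
      point zero    = s
      point (suc i) = ρ ^ toℕ i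
      rotation-^ : ∀ i → Rotation (ρ ^ i)
      rotation-^ zero    = 0 , refl
      rotation-^ (suc i) = isPower-∙ rot-ρ (rotation-^ i)
      label : ∀ i → ∃[ j ] σ ^ toℕ {n} j ≡ point i
      label zero    = rotation-index rot-s
      label (suc i) = rotation-index (rotation-^ (toℕ i))
      same : ∀ {i j} → proj₁ (label i) ≡ proj₁ (label j) → point i ≡ point j
      same {i} {j} eq = trans (sym (proj₂ (label i))) (trans (cong (λ k → σ ^ toℕ k) eq) (proj₂ (label j)))
      locate : ∃₂ (λ i j → i Fin.< j × proj₁ (label i) ≡ proj₁ (label j)) → IsPower ρ s
      locate (zero , suc j , _ , eq) = toℕ j , sym (same {zero} {suc j} eq)
      locate (suc i , suc j , s≤s i<j , eq) = contradiction
        (n-min (toℕ j ∸ toℕ i) (m<n⇒0<n∸m i<j , ∙-cancelˡ (ρ ^ toℕ i) _ _ (trans (sym (^-+ ρ (toℕ i) _))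
          (trans (cong (ρ ^_) (m+[n∸m]≡n (<⇒≤ i<j))) (trans (sym (same {suc i} {suc j} eq)) (sym (identityʳ _)))))))
        (<⇒≱ (≤-<-trans (m∸n≤m (toℕ j) (toℕ i)) (Fin.toℕ<n j)))

    στ-reflections : Reflections (σ ∙ τ) τ n
    στ-reflections = record
      { x-order = reflection-order (rotation-reflection (1 , identityʳ σ) (0 , sym ττ≡ε))
      ; y-order = reflection-order (0 , sym ττ≡ε) ; xy-order = subst (λ g → IsOrder g n) (sym (gττ≡g σ)) σ-order
      ; odd = odd ; 3≤n = 3≤n }

    Δ*≤2n∸2 : ∀ {d} → d ∈ Δ* → d ≤ 2 * n ∸ 2
    Δ*≤2n∸2 d∈ with D , dav ← davenport =
      ≤-trans (Δ*≤D∸2 dav d∈) (∸-monoˡ-≤ 2 (≤-trans (D≤∣G∣ dav) (≤-reflexive ∣G∣≡2n)))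

    module _ {d} {G₀ : Pred Carrier 0ℓ} (G₀? : Decidable G₀) (min : IsMin (Δ G₀) d) where

      private
        0<d : 0 < d
        0<d = proj₁ (minΔ⇒ min)

        divisible : DividesDistances G₀ d
        divisible = proj₁ (proj₂ (minΔ⇒ min))

        d≤2n∸2 : d ≤ 2 * n ∸ 2
        d≤2n∸2 = Δ*≤2n∸2 (G₀ , G₀? , min)

      -- The weights make 2n - 2 a divisor of the difference `d`, and `d` is at most 2n - 2 anyway.
      two-reflections : ∀ {x y} → Reflections x y n → (∀ {u} → u ∈ G₀ → u ≡ ε ⊎ u ≡ x ⊎ u ≡ y) → 2 * n ∸ 2 ≡ d
      two-reflections r covered with _ , _ , A , k , over , f , f′ ← minΔ⇒ min =
        ≤-antisym (∣⇒≤ {{>-nonZero 0<d}} (2n∸2-dividesDistances r covered k d over f f′)) d≤2n∸2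

      -- The argument for D(G) - 2, with the n rotations containing all prefix products of an atom
      -- over `G₀`. The element of long order need not lie in `G₀`, so reflections, of order 2, are
      -- considered for it as well.
      only-rotations : (∀ {u} → u ∈ G₀ → Rotation u) → d ≤ n ∸ 2
      only-rotations rotation with _ , _ , A , k , over , f , f′ ← minΔ⇒ min
        with longOrder⊎longAtom divisible k d 0<d over f f′
      ... | inj₁ (g , long) = ∸-monoˡ-≤ 2 (≤-trans long ord≤n)
        where
        ord≤n : ord g ≤ n
        ord≤n with rotation⊎reflection g
        ... | inj₁ rot = proj₂ (proj₂ (order g)) n (≤-trans (s≤s z≤n) 3≤n , rotation-^n rot)
        ... | inj₂ ref = ≤-trans (proj₂ (proj₂ (order g)) 2 (proj₁ (reflection-order ref))) (<⇒≤ 3≤n)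
      ... | inj₂ (S , l , S-over , at , _ , 0<l , _ , d+1+l≤S) =
        ∸-monoˡ-≤ 2 (≤-trans (≤-reflexive (+-comm 2 d)) (≤-trans (+-monoʳ-≤ d (s≤s 0<l)) (≤-trans d+1+l≤S
          (atom-length≤ (λ i → σ ^ toℕ {n} i) at λ i → rotation-index (rotation-prod (All.take⁺ i S-over))))))
        where
        rotation-prod : ∀ {L} → All G₀ L → Rotation (prod L)
        rotation-prod []         = 0 , refl
        rotation-prod (g∈ ∷ over) = isPower-∙ (rotation g∈) (rotation-prod over)

      -- The product `t ∙ r` is a reflection, hence its own inverse; this is the dihedral relation
      -- for `r` and `t`, whose order ord(r) is odd.
      rotation-and-reflection : ∀ {r t} → r ∈ G₀ → t ∈ G₀ → Rotation r → r ≢ ε → Reflection t → d ≤ 2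
      rotation-and-reflection {r} {t} r∈ t∈ rot r≢ε ref =
        ∣⇒≤ (DihedralPair.∣2 pair {G₀ = G₀} divisible r∈ t∈)
        where
        orders = rotation-order rot r≢ε
        tr = reflection-rotation ref rot
        pair : DihedralPair r t (ord r)
        pair = record
          { σ-order = proj₂ (order r) ; odd = proj₁ (proj₂ orders) ; 3≤n = proj₂ (proj₂ orders)
          ; τ-order = reflection-order ref
          ; τσ≡σ⁻¹τ = trans (sym (involution-⁻¹ (reflection-order tr)))
              (trans (⁻¹-anti-homo-∙ t r) (cong (r ⁻¹ ∙_) (involution-⁻¹ (reflection-order ref)))) }

      -- The cases are: no reflection in `G₀`; a reflection together with a nontrivial rotation;
      -- otherwise only reflections and possibly `ε`. Of the latter there are at most one, or two
      -- whose product has order less than n, or two whose product generates the rotations, with or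
      -- without a third.
      bound : 2 * n ∸ 2 ≢ d → d ≤ 2 ⊔ (n ∸ 2)
      bound d≢ with ∃? (λ t → G₀? t ×-dec isPower? σ (t ∙ τ))
      ... | no none = ≤-trans (only-rotations λ {u} u∈ → rotation u u∈) (m≤n⊔m 2 (n ∸ 2))
        where
        rotation : ∀ u → u ∈ G₀ → Rotation u
        rotation u u∈ with rotation⊎reflection u
        ... | inj₁ rot = rot
        ... | inj₂ ref = contradiction (u , u∈ , ref) none
      ... | yes (x , x∈ , ref-x) with ∃? (λ r → G₀? r ×-dec ¬? (r ≟ ε) ×-dec isPower? σ r)
      ... | yes (r , r∈ , r≢ε , rot) = ≤-trans (rotation-and-reflection r∈ x∈ rot r≢ε ref-x) (m≤m⊔n 2 (n ∸ 2))
      ... | no no-rotation with ∃? (λ y → G₀? y ×-dec ¬? (y ≟ x) ×-dec isPower? σ (y ∙ τ))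
      ... | no no-second = contradiction (two-reflections one-reflection (λ {u} u∈ → covered u u∈)) d≢
        where
        xσ-reflection = reflection-rotation ref-x (1 , identityʳ σ)
        -- The second reflection is auxiliary and outside `G₀`; it serves to treat `G₀` inside {ε,
        -- x} as a set covered by two reflections.
        one-reflection : Reflections x (x ∙ σ) n
        one-reflection = record
          { x-order = reflection-order ref-x ; y-order = reflection-order xσ-reflection
          ; xy-order = subst (λ g → IsOrder g n) (sym (trans (sym (assoc x x σ))
              (trans (cong (_∙ σ) (reflection-∙ ref-x)) (identityˡ σ)))) σ-order
          ; odd = odd ; 3≤n = 3≤n }
        covered : ∀ u → u ∈ G₀ → u ≡ ε ⊎ u ≡ x ⊎ u ≡ x ∙ σ
        covered u u∈ with u ≟ ε | u ≟ x | rotation⊎reflection u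
        ... | yes eq | _ | _ = inj₁ eq
        ... | no _ | yes eq | _ = inj₂ (inj₁ eq)
        ... | no u≢ε | no _ | inj₁ rot = contradiction (u , u∈ , u≢ε , rot) no-rotation
        ... | no _ | no u≢x | inj₂ ref = contradiction (u , u∈ , u≢x , ref) no-second
      ... | yes (y , y∈ , y≢x , ref-y) with ord (x ∙ y) ℕ.≟ n
      ... | no k≢n = ≤-trans small (m≤n⊔m 2 (n ∸ 2))
        where
        r = reflections ref-x ref-y (y≢x ∘ sym)
        k = ord (x ∙ y)
        -- A proper divisor of n is at most n / 2, and `d` divides `2 * k ∸ 2`.
        2k≤n : 2 * k ≤ n
        2k≤n with ord-∣ (x ∙ y) n (rotation-^n (reflection-reflection ref-x ref-y))
        ... | divides zero eq = contradiction (subst (3 ≤_) eq 3≤n) λ ()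
        ... | divides (suc zero) eq = contradiction (sym (trans eq (+-identityʳ k))) k≢n
        ... | divides (suc (suc q)) eq = ≤-trans (*-monoˡ-≤ k (s≤s (s≤s (z≤n {q})))) (≤-reflexive (sym eq))
        small : d ≤ n ∸ 2
        small = ≤-trans (∣⇒≤ {{>-nonZero (m<n⇒0<n∸m (≤-trans (Reflections.3≤n r) (m≤m+n k _)))}}
          (∣2n∸2 r {G₀ = G₀} divisible x∈ y∈)) (∸-monoˡ-≤ 2 2k≤n)
      ... | yes k≡n with ∃? (λ z → G₀? z ×-dec ¬? (z ≟ x) ×-dec ¬? (z ≟ y) ×-dec isPower? σ (z ∙ τ))
      ... | no no-third = contradiction (two-reflections r (λ {u} u∈ → covered u u∈)) d≢
        where
        r = subst (Reflections x y) k≡n (reflections ref-x ref-y (y≢x ∘ sym))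
        covered : ∀ u → u ∈ G₀ → u ≡ ε ⊎ u ≡ x ⊎ u ≡ y
        covered u u∈ with u ≟ ε | u ≟ x | u ≟ y | rotation⊎reflection u
        ... | yes eq | _ | _ | _ = inj₁ eq
        ... | no _ | yes eq | _ | _ = inj₂ (inj₁ eq)
        ... | no _ | no _ | yes eq | _ = inj₂ (inj₂ eq)
        ... | no u≢ε | no _ | no _ | inj₁ rot = contradiction (u , u∈ , u≢ε , rot) no-rotation
        ... | no _ | no u≢x | no u≢y | inj₂ ref = contradiction (u , u∈ , u≢x , u≢y , ref) no-third
      ... | yes (z , z∈ , z≢x , z≢y , ref-z) =
        third-reflection r {G₀ = G₀} divisible x∈ y∈ z∈ (reflection-order ref-z) z≢x z≢y
          (rotation-generator (reflection-reflection ref-x ref-y) (Reflections.xy-order r) (reflection-reflection ref-z ref-y))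
        where
        r = subst (Reflections x y) k≡n (reflections ref-x ref-y (y≢x ∘ sym))

  -- Groups with maximum ∣G∣ - 2 and the dihedral case

  cyclic⇒isPower : ∀ {g h} → h ∈ ⟨ ｛ g ｝ ⟩ → IsPower g h
  cyclic⇒isPower (generator refl) = 1 , identityʳ _
  cyclic⇒isPower identity         = 0 , refl
  cyclic⇒isPower (product p q)    = isPower-∙ (cyclic⇒isPower p) (cyclic⇒isPower q)
  cyclic⇒isPower (inverse p)      = isPower-⁻¹ (cyclic⇒isPower p)

  generator-order : ∀ {g} → U ⊆ ⟨ ｛ g ｝ ⟩ → IsOrder g ∣G∣
  generator-order {g} generates = subst (IsOrder g) (≤-antisym (ord≤∣G∣ g) (∣G∣≤-image (λ i → g ^ toℕ {ord g} i) onto)) (proj₂ (order g))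
    where
    onto : ∀ h → ∃[ i ] g ^ toℕ {ord g} i ≡ h
    onto h with i , eq ← cyclic⇒isPower (generates {h} tt) with j , j<k , eq′ ← ^-% (proj₂ (order g)) i =
      fromℕ< j<k , trans (cong (g ^_) (Fin.toℕ-fromℕ< j<k)) (trans eq′ eq)

  Δ*≤∣G∣∸2 : ∀ {d} → d ∈ Δ* → d ≤ ∣G∣ ∸ 2
  Δ*≤∣G∣∸2 d∈ = ≤-trans (Δ*≤D∸2 (proj₂ davenport) d∈) (∸-monoˡ-≤ 2 (D≤∣G∣ (proj₂ davenport)))

  ≤2+∸2 : ∀ D → D ≤ 2 + (D ∸ 2)
  ≤2+∸2 D = m≤n+m∸n D 2

  max≡∣G∣∸2⇒ : 3 ≤ ∣G∣ → ∣G∣ ∸ 2 ∈ Δ* → IsCyclic ⊎ (∃[ n ] (3 ≤ n × ¬ (2 ∣ n) × IsDihedral n))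
  max≡∣G∣∸2⇒ 3≤∣G∣ d∈@(G₀ , _ , min) =
    Sum.map₂ (λ (S , S-atom , S≡D) → dihedral-from-atom 0<d (proj₁ (proj₂ (minΔ⇒ min))) ∣G∣≡ S S-atom (trans S≡D D≡∣G∣))
      (extremal dav (≤-trans (D≤∣G∣ dav) (≤2+∸2 ∣G∣)) min)
    where
    D = proj₁ davenport
    dav = proj₂ davenport
    0<d : 0 < ∣G∣ ∸ 2
    0<d = m<n⇒0<n∸m 3≤∣G∣
    ∣G∣≡ : ∣G∣ ≡ 2 + (∣G∣ ∸ 2)
    ∣G∣≡ = sym (m+[n∸m]≡n (<⇒≤ 3≤∣G∣))
    -- The positive element `∣G∣ ∸ 2` is at most `D ∸ 2`, so the truncated subtraction is a true one
    -- and `D ≡ ∣G∣` can be read off.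
    2<D : 2 < D
    2<D = m∸n≢0⇒n<m {D} {2} (m<n⇒n≢0 (≤-trans 0<d (Δ*≤D∸2 dav d∈)))
    D≡∣G∣ : D ≡ ∣G∣
    D≡∣G∣ = ≤-antisym (D≤∣G∣ dav) (subst₂ _≤_ (sym ∣G∣≡) (m+[n∸m]≡n (<⇒≤ 2<D)) (+-monoʳ-≤ 2 (Δ*≤D∸2 dav d∈)))

  max≡∣G∣∸2⇐ : 3 ≤ ∣G∣ → IsCyclic ⊎ (∃[ n ] (3 ≤ n × ¬ (2 ∣ n) × IsDihedral n)) → IsMax Δ* (∣G∣ ∸ 2)
  max≡∣G∣∸2⇐ 3≤∣G∣ (inj₁ (g , generates)) = order∸2∈Δ* (generator-order generates) 3≤∣G∣ , λ _ → Δ*≤∣G∣∸2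
  max≡∣G∣∸2⇐ 3≤∣G∣ (inj₂ (n , 3≤n , odd , ∣G∣≡2n , σ , τ , generates , σⁿ , τ² , rel)) =
    subst (_∈ Δ*) (cong (_∸ 2) (sym ∣G∣≡2n)) (2n∸2∈Δ* στ-reflections) , λ _ → Δ*≤∣G∣∸2
    where open DihedralGroup 3≤n odd ∣G∣≡2n generates σⁿ τ² rel

  dihedral-Δ* : ∀ n → 3 ≤ n → ¬ (2 ∣ n) → IsDihedral n →
    (｛ 1 ｝ ∪ ｛ 2 ｝ ∪ ｛ n ∸ 2 ｝ ∪ ｛ 2 * n ∸ 2 ｝) ⊆ Δ* × IsMax (Δ* ∖ ｛ 2 * n ∸ 2 ｝) (2 ⊔ (n ∸ 2))
  dihedral-Δ* n 3≤n odd (∣G∣≡2n , σ , τ , generates , σⁿ , τ² , rel) =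
    (λ { (inj₁ refl) → 1∈Δ* (≤-trans 3≤n (≤-trans (m≤m+n n _) (≤-reflexive (sym ∣G∣≡2n))))
       ; (inj₂ (inj₁ refl)) → two∈
       ; (inj₂ (inj₂ (inj₁ refl))) → n∸2∈
       ; (inj₂ (inj₂ (inj₂ refl))) → 2n∸2∈Δ* στ-reflections }) ,
    (max∈ , λ eq → <⇒≢ max< (sym eq)) ,
    λ { d ((G₀ , G₀? , min) , d≢) → bound G₀? min d≢ }
    where
    open DihedralGroup 3≤n odd ∣G∣≡2n generates σⁿ τ² rel
    two∈ : 2 ∈ Δ*
    two∈ = DihedralPair.2∈Δ* dihedralPair
    n∸2∈ : n ∸ 2 ∈ Δ*
    n∸2∈ = order∸2∈Δ* σ-order 3≤n
    max∈ : 2 ⊔ (n ∸ 2) ∈ Δ*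
    max∈ with ⊔-sel 2 (n ∸ 2)
    ... | inj₁ eq = subst (_∈ Δ*) (sym eq) two∈
    ... | inj₂ eq = subst (_∈ Δ*) (sym eq) n∸2∈
    max< : 2 ⊔ (n ∸ 2) < 2 * n ∸ 2
    max< = ⊔-pres-<m (∸-monoˡ-≤ 2 (≤-trans (s≤s (s≤s (s≤s (s≤s (s≤s z≤n))))) (*-monoʳ-≤ 2 3≤n)))
                   (∸-monoˡ-< (m<m+n n (≤-trans (≤-trans (s≤s z≤n) 3≤n) (m≤m+n n 0))) (<⇒≤ 3≤n))

theorem6p8 : ∀ {a : Level} (G : FiniteGroup a) →
    let open FiniteGroup G
        open GroupNotions G
        open ProductOneSequences G
    in 3 ≤ ∣G∣ →
      ∃[ D ] (IsDavenport U D ×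
        (1 ∈ Δ* × (∀ (g : Carrier) (k : ℕ) → IsOrder g k → 3 ≤ k → (k ∸ 2) ∈ Δ*)) ×
        (∀ (d : ℕ) → d ∈ Δ* → d ≤ D ∸ 2) ×
        (IsMax Δ* (∣G∣ ∸ 2) ⇔ (IsCyclic ⊎ (∃[ n ] (3 ≤ n × ¬ (2 ∣ n) × IsDihedral n)))) ×
        (∀ (n : ℕ) → 3 ≤ n → ¬ (2 ∣ n) → IsDihedral n →
          (｛ 1 ｝ ∪ ｛ 2 ｝ ∪ ｛ n ∸ 2 ｝ ∪ ｛ 2 * n ∸ 2 ｝) ⊆ Δ* ×
          IsMax (Δ* ∖ ｛ 2 * n ∸ 2 ｝) (2 ⊔ (n ∸ 2))) ×
        (IsMax Δ* (D ∸ 2) →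
          IsCyclic ⊎
          (∃[ G₁ ] (Decidable {ℓ = 0ℓ} G₁ × IsSubgroup G₁ ×
                    IsDavenport G₁ D × GeneratedByInvolutions G₁))))
theorem6p8 G 3≤∣G∣ with D , dav ← Arithmetic.davenport G =
  D , dav ,
  (1∈Δ* 3≤∣G∣ , λ _ _ → order∸2∈Δ*) ,
  (λ _ → Δ*≤D∸2 dav) ,
  mk⇔ (λ (d∈ , _) → max≡∣G∣∸2⇒ 3≤∣G∣ d∈) (max≡∣G∣∸2⇐ 3≤∣G∣) ,
  dihedral-Δ* ,
  λ ((_ , _ , min) , _) → Sum.map₂ (λ (S , S-atom , S≡D) → involution-subgroup dav S-atom S≡D)
    (extremal dav (≤2+∸2 D) min)
  where open Arithmetic G
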